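{- The extraction map, sending a generic $(n,d)$-tropical oriented matroid $\mathcal T$ to the collection $\{M_{I,\bar J}\}$ where $M_{I,\bar J}$ is the unique tope of the minor $\mathcal T|_{I,\bar J}$ with position $\mathbf 1_{\bar J}$, is a bijection from generic $(n,d)$-tropical oriented matroids onto $(n,d)$-matching ensembles.
   Context: Fix positive integers $n,d$; $K_{n,d}$ is the complete bipartite graph with left vertices $[n]$ and right vertices $[\bar d]=\{\bar1,\dots,\bar d\}$; graphs are identified with edge sets; $RD$ is the vector of right-vertex degrees; $\mathbf 1_S$ the indicator vector of $S$. Two acyclic subgraphs are compatible if whenever both contain a perfect matching between the same $I\subseteq[n]$, $\bar J\subseteq[\bar d]$, the matchings coincide. An $(n,d)$-type is an $n$-tuple $T=(T_1,\dots,T_n)$ of nonempty subsets of $[\bar d]$, with graph $G(T)$ having edge $(i,\bar j)$ iff $\bar j\in T_i$. A generic $(n,d)$-tropical oriented matroid is a collection $\mathcal T$ of types with acyclic graphs such that: (Boundary) $(\{\bar j\},\dots,\{\bar j\})\in\mathcal T$ for each $\bar j$; (Surrounding) if $T\in\mathcal T$ and $T'$ is a type with $G(T')\subseteq G(T)$ then $T'\in\mathcal T$; (Compatibility) $G(U),G(V)$ are compatible for all $U,V\in\mathcal T$; (Elimination) for $U,V\in\mathcal T$ and $i\in[n]$ there is $W\in\mathcal T$ with $W_i=U_i\cup V_i$ and $W_{i'}\in\{U_{i'},V_{i'}\}$ for $i'\ne i$. A tope is a type whose graph has all left degrees $1$; its position is $RD$ of its graph. For $I\subseteq[n]$, $\bar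 J\subseteq[\bar d]$, the minor $\mathcal T|_{I,\bar J}$ is obtained by deleting the coordinates outside $I$, removing the elements outside $\bar J$ from each remaining coordinate, discarding tuples with an empty coordinate, and removing duplicates; it is known to be a generic $(|I|,|\bar J|)$-tropical oriented matroid on $I,\bar J$ containing exactly one tope of each position, so $M_{I,\bar J}$ (for $|I|=|\bar J|$) is a well-defined perfect matching between $I$ and $\bar J$. An $(n,d)$-matching ensemble is a collection of bijections $M_{I,\bar J}:I\to\bar J$ (viewed as matching graphs), one for each $I\subseteq[n]$, $\bar J\subseteq[\bar d]$ with $|I|=|\bar J|$, such that (Closure) if $I'\subseteq I$, $\bar J'\subseteq\bar J$ and $M_{I,\bar J}$ contains a perfect matching between $I'$ and $\bar J'$ then $M_{I',\bar J'}\subseteq M_{I,\bar J}$; (Left linkage) if $|I|=|\bar J|+1$, the union of $M_{I',\bar J}$ over $I'\subset I$ with $|I'|=|\bar J|$ is a spanning tree on $I\sqcup\bar J$ in which each vertex of $\bar J$ has degree 2; (Right linkage) if $|I|+1=|\bar J|$, the union of $M_{I,\bar J'}$ over $\bar J'\subset\bar J$ with $|\bar J'|=|I|$ is a spanning tree on $I\sqcup\bar J$ in which each vertex of $I$ has degree 2. -}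

module Defs where

open import Data.Bool.Base using (if_then_else_)
open import Data.Fin.Base using (Fin; toℕ)
open import Data.Fin.Subset using (Subset; _∈_; _⊆_; ∣_∣; Nonempty; ⊥; ⁅_⁆; _∩_; _∪_)
open import Data.Nat.Base using (ℕ; suc; _+_)
open import Data.Nat.DivMod using (_mod_)
open import Data.Product using (_×_; ∃; ∃-syntax; ∃!; Σ-syntax)
open import Data.Sum.Base using (_⊎_; inj₁; inj₂; [_,_]′)
open import Data.Vec.Base using (Vec; lookup; map; replicate; zipWith)
open import Function.Bundles using (_⇔_)
open import Function.Definitions using (Injective)
open import Level using (0ℓ) renaming (suc to lsuc)
open import Relation.Binary.Bundles using (Setoid)
open import Relation.Binary.Construct.Closure.Equivalence using (EqClosure)
open import Relation.Binary.Core using (REL; Rel; _⇒_)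
import Relation.Binary.Construct.On as On
open import Relation.Binary.PropositionalEquality using (_≡_; _≢_; refl; sym; trans)
open import Relation.Nullary.Negation.Core using (¬_)
import Relation.Unary as Unary
open import Relation.Unary.Relation.Binary.Equality using (≐-setoid)

private
  variable
    n d : ℕ

------------------------------------------------------------------------
-- Subgraphs of K_{n,d}

-- A subgraph of the complete bipartite graph on [n] ⊔ [d̄], identified
-- with its set of edges.
Graph : ℕ → ℕ → Set₁
Graph n d = REL (Fin n) (Fin d) 0ℓ

-- An n-tuple of (possibly empty) subsets of [d̄].  Since G below is a
-- bijection between tuples and edge sets, tuples also serve as a finitary
-- encoding of graphs; matchings are stored in this form, so that equality
-- of matchings is propositional equality.
Tuple : ℕ → ℕ → Set
Tuple n d = Vec (Subset d) n

G : Tuple n d → Graph n d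
G T i j = j ∈ lookup T i

Vertex : ℕ → ℕ → Set
Vertex n d = Fin n ⊎ Fin d

_∈_⊔_ : Vertex n d → Subset n → Subset d → Set
v ∈ I ⊔ J = [ _∈ I , _∈ J ]′ v

HasLeftDegree : Graph n d → Fin n → ℕ → Set
HasLeftDegree {d = d} H i k =
  Σ[ N ∈ Subset d ] (∀ j → j ∈ N ⇔ H i j) × ∣ N ∣ ≡ k

HasRightDegree : Graph n d → Fin d → ℕ → Set
HasRightDegree {n = n} H j k =
  Σ[ N ∈ Subset n ] (∀ i → i ∈ N ⇔ H i j) × ∣ N ∣ ≡ k

RD_≈_ : Graph n d → Vec ℕ d → Set
RD H ≈ v = ∀ j → HasRightDegree H j (lookup v j)

𝟏 : Subset d → Vec ℕ d
𝟏 = map (λ b → if b then 1 else 0)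

-- A cycle in a bipartite graph has even length 2k with k ≥ 2; it visits
-- distinct left vertices a₀, …, a_{k-1} and distinct right vertices
-- b₀, …, b_{k-1} in the order a₀ b₀ a₁ b₁ … a_{k-1} b_{k-1} a₀.
next : ∀ {k} → Fin (2 + k) → Fin (2 + k)
next {k} t = suc (toℕ t) mod (2 + k)

record Cycle (H : Graph n d) : Set where
  field
    k           : ℕ
    a           : Fin (2 + k) → Fin n
    b           : Fin (2 + k) → Fin d
    a-injective : Injective _≡_ _≡_ a
    b-injective : Injective _≡_ _≡_ b
    a-b         : ∀ t → H (a t) (b t)
    b-a         : ∀ t → H (a (next t)) (b t)

Acyclic : Graph n d → Set
Acyclic H = ¬ Cycle H

-- Each edge is oriented from left to right; walks in the undirected graph
-- are elements of EqClosure (Adjacent H).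
data Adjacent (H : Graph n d) : Rel (Vertex n d) 0ℓ where
  edge : ∀ {i j} → H i j → Adjacent H (inj₁ i) (inj₂ j)

record IsSpanningTree (I : Subset n) (J : Subset d) (H : Graph n d) : Set where
  field
    within    : ∀ {i j} → H i j → i ∈ I × j ∈ J
    connected : ∀ u v → u ∈ I ⊔ J → v ∈ I ⊔ J → EqClosure (Adjacent H) u v
    acyclic   : Acyclic H

-- P is the graph of a bijection I → J̄.
record IsPerfectMatching (I : Subset n) (J : Subset d) (P : Tuple n d) : Set where
  field
    within : ∀ {i j} → G P i j → i ∈ I × j ∈ J
    left   : ∀ i → i ∈ I → ∃! _≡_ (λ j → G P i j)
    right  : ∀ j → j ∈ J → ∃! _≡_ (λ i → G P i j)

Compatible : Graph n d → Graph n d → Set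
Compatible {n} {d} H K =
  ∀ (I : Subset n) (J : Subset d) (P Q : Tuple n d) →
  IsPerfectMatching I J P → G P ⇒ H →
  IsPerfectMatching I J Q → G Q ⇒ K →
  P ≡ Q

------------------------------------------------------------------------
-- Generic tropical oriented matroids

IsType : Tuple n d → Set
IsType T = ∀ i → Nonempty (lookup T i)

record IsGenericTOM (𝒯 : Unary.Pred (Tuple n d) 0ℓ) : Set where
  field
    types         : ∀ {T} → 𝒯 T → IsType T
    acyclic       : ∀ {T} → 𝒯 T → Acyclic (G T)
    boundary      : ∀ j → 𝒯 (replicate n ⁅ j ⁆)
    surrounding   : ∀ {T T′} → 𝒯 T → IsType T′ → G T′ ⇒ G T → 𝒯 T′
    compatibility : ∀ {U V} → 𝒯 U → 𝒯 V → Compatible (G U) (G V)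
    elimination   : ∀ {U V} → 𝒯 U → 𝒯 V → ∀ i →
                    ∃[ W ] 𝒯 W
                         × lookup W i ≡ lookup U i ∪ lookup V i
                         × (∀ i′ → i′ ≢ i →
                            lookup W i′ ≡ lookup U i′ ⊎ lookup W i′ ≡ lookup V i′)

-- There are finitely many tuples, so classically every collection is
-- decidable; constructively decidability is what makes a predicate on
-- tuples a (finite) collection of tuples.
record GenericTOM (n d : ℕ) : Set₁ where
  field
    collection   : Unary.Pred (Tuple n d) 0ℓ
    decidable    : Unary.Decidable collection
    isGenericTOM : IsGenericTOM collection

-- Two tropical oriented matroids are equal when they have the same types.
GenericTOM-setoid : ℕ → ℕ → Setoid (lsuc 0ℓ) 0ℓ
GenericTOM-setoid n d =
  On.setoid (≐-setoid (Tuple n d) 0ℓ) (GenericTOM.collection {n} {d})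

------------------------------------------------------------------------
-- Minors

-- I-indexed tuples of subsets of J̄ are encoded as [n]-indexed tuples of
-- subsets of [d̄] by placing ⊥ in the deleted coordinates.
restrict : Subset n → Subset d → Tuple n d → Tuple n d
restrict I J T = zipWith (λ i∈I Tᵢ → if i∈I then Tᵢ ∩ J else ⊥) I T

Minor : Unary.Pred (Tuple n d) 0ℓ → Subset n → Subset d → Unary.Pred (Tuple n d) 0ℓ
Minor 𝒯 I J S =
  (∀ i → i ∈ I → Nonempty (lookup S i)) × (∃[ T ] 𝒯 T × S ≡ restrict I J T)

record IsTopeAt (𝒯 : Unary.Pred (Tuple n d) 0ℓ) (I : Subset n) (J : Subset d)
                (v : Vec ℕ d) (S : Tuple n d) : Set where
  field
    minor    : Minor 𝒯 I J S
    tope     : ∀ i → i ∈ I → HasLeftDegree (G S) i 1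
    position : RD G S ≈ v

IsUniqueTopeAt : Unary.Pred (Tuple n d) 0ℓ → Subset n → Subset d →
                 Vec ℕ d → Tuple n d → Set
IsUniqueTopeAt 𝒯 I J v S =
  IsTopeAt 𝒯 I J v S × (∀ {S′} → IsTopeAt 𝒯 I J v S′ → S ≡ S′)

------------------------------------------------------------------------
-- Matching ensembles

Family : ℕ → ℕ → Set
Family n d = (I : Subset n) (J : Subset d) → ∣ I ∣ ≡ ∣ J ∣ → Tuple n d

-- The union of M_{I′,J̄} over I′ ⊆ I with |I′| = |J̄|.
leftUnion : Family n d → Subset n → Subset d → Graph n d
leftUnion M I J i j =
  ∃[ I′ ] I′ ⊆ I × (Σ[ e ∈ ∣ I′ ∣ ≡ ∣ J ∣ ] G (M I′ J e) i j)

-- The union of M_{I,J̄′} over J̄′ ⊆ J̄ with |J̄′| = |I|.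
rightUnion : Family n d → Subset n → Subset d → Graph n d
rightUnion M I J i j =
  ∃[ J′ ] J′ ⊆ J × (Σ[ e ∈ ∣ I ∣ ≡ ∣ J′ ∣ ] G (M I J′ e) i j)

record IsMatchingEnsemble (M : Family n d) : Set where
  field
    matching     : ∀ I J e → IsPerfectMatching I J (M I J e)
    closure      : ∀ {I J I′ J′} e e′ → I′ ⊆ I → J′ ⊆ J →
                   (∃[ P ] IsPerfectMatching I′ J′ P × G P ⇒ G (M I J e)) →
                   G (M I′ J′ e′) ⇒ G (M I J e)
    leftLinkage  : ∀ I J → ∣ I ∣ ≡ ∣ J ∣ + 1 →
                   IsSpanningTree I J (leftUnion M I J)
                   × (∀ j → j ∈ J → HasRightDegree (leftUnion M I J) j 2)
    rightLinkage : ∀ I J → ∣ I ∣ + 1 ≡ ∣ J ∣ →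
                   IsSpanningTree I J (rightUnion M I J)
                   × (∀ i → i ∈ I → HasLeftDegree (rightUnion M I J) i 2)

record MatchingEnsemble (n d : ℕ) : Set where
  field
    M                  : Family n d
    isMatchingEnsemble : IsMatchingEnsemble M

MatchingEnsemble-setoid : ℕ → ℕ → Setoid 0ℓ 0ℓ
MatchingEnsemble-setoid n d = record
  { Carrier       = MatchingEnsemble n d
  ; _≈_           = λ ℳ ℳ′ → ∀ I J e →
                      MatchingEnsemble.M ℳ I J e ≡ MatchingEnsemble.M ℳ′ I J e
  ; isEquivalence = record
    { refl  = λ _ _ _ → refl
    ; sym   = λ p I J e → sym (p I J e)
    ; trans = λ p q I J e → trans (p I J e) (q I J e)
    }
  }

------------------------------------------------------------------------
-- The extraction map

-- This determines the map φ up to ≈, and includes that the tope defining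
-- M_{I,J̄} exists and is unique.
IsExtractionMap : (GenericTOM n d → MatchingEnsemble n d) → Set₁
IsExtractionMap {n} {d} φ =
  ∀ (𝒯 : GenericTOM n d) I J (e : ∣ I ∣ ≡ ∣ J ∣) →
  IsUniqueTopeAt (GenericTOM.collection 𝒯) I J (𝟏 J) (MatchingEnsemble.M (φ 𝒯) I J e)

{-# OPTIONS --safe #-}

-- A matching ensemble is determined by local data: the linkage axioms only
-- say that among the matchings M_{I,J̄-x} a left vertex has at most two
-- partners, and dually.  This makes the structure symmetric in the two sides.
--
-- A graph is compatible with it if every matching it contains is the given
-- one.  For |J| = |I| + 1 the linkage tree on I ⊔ J̄, with the remaining left
-- vertices attached as leaves, is compatible.  A Farkas-type theorem follows:
-- for any two-colouring of K_{n,d} one of these trees has an edge of the first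
-- colour at every left vertex, or a dual tree has an edge of the second colour
-- at every right vertex; the constraint at a vertex is reduced to the cases
-- where it is dropped and where it is tightened to an equation.
--
-- The types compatible with an ensemble form a tropical oriented matroid.  To
-- eliminate between two of them at a, double the left vertex a by an
-- infinitesimal perturbation and apply the two-colour theorem.
--
-- Conversely, eliminating in a tropical oriented matroid produces, for
-- |J| = |I| + 1, a type with values in J̄ in which every coordinate of I has
-- two elements; alternating paths in it give the matchings and their linkage.
-- By the two-colour theorem every compatible tope, hence every compatible type,
-- belongs to the matroid, so that the matchings determine it.

module Submission where

open import Defs
open import Data.Bool.Base using (Bool; true; false; _xor_; not; if_then_else_)
open import Data.Bool.Properties using () renaming (_≟_ to _≟ᵇ_)
open import Data.Empty using (⊥-elim) renaming (⊥ to Empty)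
open import Data.Fin.Base using (Fin; zero; suc; toℕ; fromℕ<) renaming (_<_ to _<ᶠ_)
open import Data.Fin.Properties using (any?; all?; <-cmp; toℕ<n; toℕ-injective; toℕ-fromℕ<)
  renaming (_≟_ to _≟ᶠ_; <-trans to <ᶠ-trans; <-irrefl to <ᶠ-irrefl)
open import Data.Fin.Subset using (Subset; inside; outside; _∈_; _∉_; _⊆_; ∣_∣; Nonempty; ⁅_⁆; _∪_; _∩_; ⊤)
  renaming (⊥ to ∅)
open import Data.Fin.Subset.Properties using (_∈?_; ⊆-antisym; p⊆q⇒∣p∣≤∣q∣; ∉⊥; x∈⁅x⁆; x∈⁅y⁆⇒x≡y;
  x∈p∪q⁺; x∈p∪q⁻; x∈p∩q⁺; x∈p∩q⁻; ∪-idem; ∣⁅x⁆∣≡1; anySubset?; ∈⊤)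
open import Data.List.Base using (List; allFin) renaming ([] to []ᴸ; _∷_ to _∷ᴸ_)
open import Data.List.Relation.Unary.Any using () renaming (here to hereᴸ; there to thereᴸ)
open import Data.List.Membership.Propositional using () renaming (_∈_ to _∈ᴸ_)
open import Data.List.Membership.Propositional.Properties using (∈-allFin)
open import Data.Nat.Base using (ℕ; zero; suc; _+_; _∸_; _≤_; _<_; z≤n; s≤s; s≤s⁻¹; NonZero; >-nonZero⁻¹)
open import Data.Nat.DivMod using (_%_; n%n≡0; m<n⇒m%n≡m)
import Data.Nat.Properties as ℕ
open import Data.Product.Base using (Σ-syntax; ∃-syntax; _×_; _,_; proj₁; proj₂)
open import Data.Sum.Base using (_⊎_; inj₁; inj₂; [_,_]′)
open import Data.Vec.Base using (Vec; []; _∷_; lookup; tabulate; here; there; _[_]≔_; replicate)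
open import Data.Vec.Properties using (lookup∘tabulate; []=⇒lookup; lookup⇒[]=; []≔-updates; []≔-minimal; lookup∘update; lookup∘update′; ≡-dec;
  tabulate∘lookup; tabulate-cong; lookup-replicate; lookup-zipWith; lookup-map)
open import Function.Base using (_∘_; id; case_of_)
open import Function.Bundles using (mk⇔; Equivalence; Bijection)
open import Relation.Binary.Construct.Closure.Equivalence using (EqClosure; symmetric; transitive)
open import Relation.Binary.Construct.Closure.ReflexiveTransitive using (_◅_) renaming (ε to []ʷ)
open import Relation.Binary.Construct.Closure.Symmetric using (fwd; bwd)
open import Relation.Binary.Definitions using (tri<; tri≈; tri>)
open import Relation.Binary.PropositionalEquality using (_≡_; _≢_; refl; sym; trans; cong; subst; ≢-sym)
open import Relation.Nullary.Decidable using (Dec; yes; no; does; _×-dec_; _⊎-dec_; _→-dec_; ¬?; dec-true; dec-false; map′)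
open import Relation.Nullary.Negation.Core using (¬_; contradiction)

-- The two-colour theorem selects one neighbour at each left vertex, so by itself it yields topes,
-- whereas elimination asks for two values in one coordinate. Doubling makes two coordinates of one,
-- and the order on the right vertices records the direction of the perturbation. The same device
-- splits a common coordinate with several elements, so elimination of types reduces to that of
-- topes by induction on the number of differing coordinates and on the number of surplus elements.
--
-- Most impossibility arguments have one source: two different matchings with the same ends cannot
-- both be compatible. Alternating walks between compatible graphs therefore cannot close up, which
-- is used both to make walks end and to exclude certificates.
--
-- A tropical oriented matroid is not visibly symmetric in its two sides. A type with two elements
-- in each coordinate of `I` gives the right linkage by counting; the left linkage has to compare
-- matchings that leave out different left vertices, and needs a separate pushing argument.

private
  variable
    m n d : ℕ

-- Finite sets

infixl 6 _⊕_ _⊖_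

_⊕_ _⊖_ : Subset n → Fin n → Subset n
p ⊕ x = p [ x ]≔ inside
p ⊖ x = p [ x ]≔ outside

∈-⊕ : ∀ (p : Subset n) x → x ∈ p ⊕ x
∈-⊕ p x = []≔-updates p x

⊆-⊕ : ∀ (p : Subset n) x {y} → y ∈ p → y ∈ p ⊕ x
⊆-⊕ p x {y} y∈p with y ≟ᶠ x
... | yes refl = ∈-⊕ p x
... | no y≢x   = []≔-minimal p y x y≢x y∈p

⊕-inv : ∀ (p : Subset n) x {y} → y ∈ p ⊕ x → y ≡ x ⊎ y ∈ p
⊕-inv p x {y} h with y ≟ᶠ x
... | yes e  = inj₁ e
... | no y≢x = inj₂ (lookup⇒[]= y p (trans (sym (lookup∘update′ y≢x p inside)) ([]=⇒lookup h)))

⊕-inv′ : ∀ (p : Subset n) x {y} → y ∈ p ⊕ x → y ≢ x → y ∈ p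
⊕-inv′ p x h y≢x with ⊕-inv p x h
... | inj₁ e = contradiction e y≢x
... | inj₂ q = q

∈-⊖ : ∀ {p : Subset n} {x y} → y ∈ p → y ≢ x → y ∈ p ⊖ x
∈-⊖ {p = p} {x} {y} y∈p y≢x = []≔-minimal p y x y≢x y∈p

⊖-≢ : ∀ (p : Subset n) {x y} → y ∈ p ⊖ x → y ≢ x
⊖-≢ p {x} h refl with trans (sym ([]=⇒lookup h)) (lookup∘update x p outside)
... | ()

⊖-⊆ : ∀ (p : Subset n) {x y} → y ∈ p ⊖ x → y ∈ p
⊖-⊆ p {x} {y} h =
  lookup⇒[]= y p (trans (sym (lookup∘update′ (⊖-≢ p h) p outside)) ([]=⇒lookup h))

⊕⊖ : ∀ {p : Subset n} {x} → x ∉ p → (p ⊕ x) ⊖ x ≡ p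
⊕⊖ {p = p} {x} x∉p = ⊆-antisym
  (λ h → ⊕-inv′ p x (⊖-⊆ (p ⊕ x) h) (⊖-≢ (p ⊕ x) h))
  (λ h → ∈-⊖ (⊆-⊕ p x h) λ { refl → x∉p h })

⊖⊕ : ∀ {p : Subset n} {x} → x ∈ p → (p ⊖ x) ⊕ x ≡ p
⊖⊕ {p = p} {x} x∈p = ⊆-antisym
  (λ h → case ⊕-inv (p ⊖ x) x h of λ { (inj₁ refl) → x∈p ; (inj₂ q) → ⊖-⊆ p q })
  (λ {y} h → case y ≟ᶠ x of λ
    { (yes refl) → ∈-⊕ (p ⊖ x) x ; (no ne) → ⊆-⊕ (p ⊖ x) x (∈-⊖ h ne) })

⊖-comm : ∀ (p : Subset n) x y → (p ⊖ x) ⊖ y ≡ (p ⊖ y) ⊖ x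
⊖-comm p x y = ⊆-antisym (swap x y) (swap y x)
  where
  swap : ∀ x y {z} → z ∈ (p ⊖ x) ⊖ y → z ∈ (p ⊖ y) ⊖ x
  swap x y h = ∈-⊖ (∈-⊖ (⊖-⊆ p (⊖-⊆ (p ⊖ x) h)) (⊖-≢ (p ⊖ x) h)) (⊖-≢ p (⊖-⊆ (p ⊖ x) h))

∣⊖∣ : ∀ {p : Subset n} {x} → x ∈ p → ∣ p ∣ ≡ suc ∣ p ⊖ x ∣
∣⊖∣ here = refl
∣⊖∣ {p = outside ∷ p} (there h) = ∣⊖∣ h
∣⊖∣ {p = inside ∷ p}  (there h) = cong suc (∣⊖∣ h)

∣⊕∣ : ∀ {p : Subset n} {x} → x ∉ p → ∣ p ⊕ x ∣ ≡ suc ∣ p ∣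
∣⊕∣ {p = p} {x} x∉p = trans (∣⊖∣ (∈-⊕ p x)) (cong (suc ∘ ∣_∣) (⊕⊖ x∉p))

∣⊖∣-≡ : ∀ {I : Subset m} {J : Subset n} {x} → ∣ J ∣ ≡ suc ∣ I ∣ → x ∈ J → ∣ I ∣ ≡ ∣ J ⊖ x ∣
∣⊖∣-≡ e x∈J = ℕ.suc-injective (trans (sym e) (∣⊖∣ x∈J))

∣⊖⊖∣-≡ : ∀ {I : Subset m} {J : Subset n} {x y} → ∣ I ∣ ≡ ∣ J ∣ → x ∈ I → y ∈ J → ∣ I ⊖ x ∣ ≡ ∣ J ⊖ y ∣
∣⊖⊖∣-≡ e x∈I y∈J = ℕ.suc-injective (trans (sym (∣⊖∣ x∈I)) (trans e (∣⊖∣ y∈J)))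

∣∣-nonempty : ∀ {p : Subset n} {k} → ∣ p ∣ ≡ suc k → Nonempty p
∣∣-nonempty {p = inside ∷ p}  e = zero , here
∣∣-nonempty {p = outside ∷ p} e with ∣∣-nonempty {p = p} e
... | x , h = suc x , there h

subset : {P : Fin n → Set} → (∀ i → Dec (P i)) → Subset n
subset P? = tabulate (does ∘ P?)

subset⁺ : {P : Fin n → Set} (P? : ∀ i → Dec (P i)) → ∀ {i} → P i → i ∈ subset P?
subset⁺ P? {i} p = lookup⇒[]= i _ (trans (lookup∘tabulate _ i) (dec-true (P? i) p))

subset⁻ : {P : Fin n → Set} (P? : ∀ i → Dec (P i)) → ∀ {i} → i ∈ subset P? → P i
subset⁻ P? {i} h with P? i | trans (sym (lookup∘tabulate (does ∘ P?) i)) ([]=⇒lookup h)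
... | yes p | _ = p
... | no _  | ()

image : (Fin m → Fin n) → Subset m → Subset n
image f I = subset λ j → any? λ i → (i ∈? I) ×-dec (f i ≟ᶠ j)

image⁺ : ∀ (f : Fin m → Fin n) I {i} → i ∈ I → f i ∈ image f I
image⁺ f I {i} i∈I = subset⁺ (λ j → any? λ i → (i ∈? I) ×-dec (f i ≟ᶠ j)) (i , i∈I , refl)

image⁻ : ∀ (f : Fin m → Fin n) I {j} → j ∈ image f I → ∃[ i ] i ∈ I × f i ≡ j
image⁻ f I = subset⁻ (λ j → any? λ i → (i ∈? I) ×-dec (f i ≟ᶠ j))

-- A relation instead of a function lets matchings be counted without choosing partners. Each
-- element of `p` uses up a partner in `q`, which is removed before the rest is counted.
card-≤ : (p : Subset m) (q : Subset n) (R : Fin m → Fin n → Set) →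
         (∀ {i} → i ∈ p → ∃[ j ] j ∈ q × R i j) →
         (∀ {i i′ j} → i ∈ p → i′ ∈ p → R i j → R i′ j → i ≡ i′) → ∣ p ∣ ≤ ∣ q ∣
card-≤ []            q R tot inj = z≤n
card-≤ (outside ∷ p) q R tot inj = card-≤ p q (R ∘ suc) (tot ∘ there)
  λ a b r s → case inj (there a) (there b) r s of λ { refl → refl }
card-≤ (inside ∷ p)  q R tot inj with tot here
... | j₀ , j₀∈q , r₀ = ℕ.≤-trans (s≤s below) (ℕ.≤-reflexive (sym (∣⊖∣ j₀∈q)))
  where
  below : ∣ p ∣ ≤ ∣ q ⊖ j₀ ∣
  below = card-≤ p (q ⊖ j₀) (R ∘ suc)
    (λ h → case tot (there h) of λ (j , j∈q , r) →
       j , ∈-⊖ j∈q (λ { refl → case inj here (there h) r₀ r of λ () }) , r)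
    λ a b r s → case inj (there a) (there b) r s of λ { refl → refl }

⊆-∣∣-≡ : ∀ {p q : Subset n} → p ⊆ q → ∣ q ∣ ≤ ∣ p ∣ → p ≡ q
⊆-∣∣-≡ {p = p} {q} p⊆q h = ⊆-antisym p⊆q λ {x} x∈q → case x ∈? p of λ
  { (yes x∈p) → x∈p
  ; (no x∉p) → contradiction
      (ℕ.≤-trans (ℕ.≤-reflexive (sym (∣⊖∣ x∈q)))
        (ℕ.≤-trans h (p⊆q⇒∣p∣≤∣q∣ λ {y} y∈p → ∈-⊖ (p⊆q y∈p) λ { refl → x∉p y∈p })))
      (ℕ.<-irrefl refl) }

sized-subset : ∀ (p : Subset n) k → k ≤ ∣ p ∣ → ∃[ q ] q ⊆ p × ∣ q ∣ ≡ k
sized-subset []            zero    h = [] , id , refl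
sized-subset (outside ∷ p) k       h with sized-subset p k h
... | q , q⊆p , e = outside ∷ q , (λ { (there a) → there (q⊆p a) }) , e
sized-subset (inside ∷ p)  zero    h with sized-subset p zero z≤n
... | q , q⊆p , e = outside ∷ q , (λ { (there a) → there (q⊆p a) }) , e
sized-subset (inside ∷ p)  (suc k) h with sized-subset p k (s≤s⁻¹ h)
... | q , q⊆p , e = inside ∷ q , (λ { here → here ; (there a) → there (q⊆p a) }) , cong suc e

update : {A : Set} → (Fin n → A) → Fin n → A → Fin n → A
update f x a y = if does (y ≟ᶠ x) then a else f y

update-≡ : {A : Set} (f : Fin n → A) (x : Fin n) (a : A) → update f x a x ≡ a
update-≡ f x a rewrite dec-true (x ≟ᶠ x) refl = refl

update-≢ : {A : Set} (f : Fin n → A) {x y : Fin n} {a : A} → y ≢ x → update f x a y ≡ f y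
update-≢ f {x} {y} y≢x rewrite dec-false (y ≟ᶠ x) y≢x = refl

record Bij (I : Subset m) (J : Subset n) (f : Fin m → Fin n) : Set where
  field
    into : ∀ {i} → i ∈ I → f i ∈ J
    inj  : ∀ {i i′} → i ∈ I → i′ ∈ I → f i ≡ f i′ → i ≡ i′
    onto : ∀ {j} → j ∈ J → ∃[ i ] i ∈ I × f i ≡ j

bij-from-card : ∀ {I : Subset m} {J : Subset n} {f} → ∣ J ∣ ≤ ∣ I ∣ →
                (∀ {i} → i ∈ I → f i ∈ J) →
                (∀ {i i′} → i ∈ I → i′ ∈ I → f i ≡ f i′ → i ≡ i′) → Bij I J f
bij-from-card {I = I} {J} {f} h into inj = record
  { into = into ; inj = inj
  ; onto = λ j∈J → image⁻ f I (subst (_ ∈_) (sym im≡J) j∈J) }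
  where
  im⊆J : image f I ⊆ J
  im⊆J j∈ with image⁻ f I j∈
  ... | i , i∈I , refl = into i∈I
  im≡J : image f I ≡ J
  im≡J = ⊆-∣∣-≡ im⊆J (ℕ.≤-trans h
    (card-≤ I (image f I) (λ i j → f i ≡ j) (λ i∈I → _ , image⁺ f I i∈I , refl)
      λ a b r s → inj a b (trans r (sym s))))

-- The iterated images of `K` shrink until one step keeps the size; there `g` is onto and hence
-- one-to-one. The number `k` bounds the size for the recursion.
bijective-core : ∀ (g : Fin n → Fin n) k K → ∣ K ∣ ≤ k → Nonempty K →
                 (∀ {x} → x ∈ K → g x ∈ K) → ∃[ K′ ] K′ ⊆ K × Nonempty K′ × Bij K′ K′ g
bijective-core g zero K h (x , x∈K) st with ℕ.≤-trans (ℕ.≤-reflexive (sym (∣⊖∣ x∈K))) h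
... | ()
bijective-core g (suc k) K h (x , x∈K) st with ℕ.≤-<-connex ∣ K ∣ ∣ image g K ∣
... | inj₂ lt with bijective-core g k (image g K) (s≤s⁻¹ (ℕ.≤-trans lt h)) (_ , image⁺ g K x∈K)
                    (λ y∈ → case image⁻ g K y∈ of λ { (z , z∈K , refl) → image⁺ g K (st z∈K) })
...   | K′ , K′⊆ , ne , b = K′ , (λ z∈ → case image⁻ g K (K′⊆ z∈) of λ { (z , z∈K , refl) → st z∈K }) , ne , b
bijective-core g (suc k) K h (x , x∈K) st | inj₁ le = K , id , (x , x∈K) , record { into = st ; inj = inj ; onto = onto }
  where
  im≡ : image g K ≡ K
  im≡ = ⊆-∣∣-≡ (λ y∈ → case image⁻ g K y∈ of λ { (z , z∈K , refl) → st z∈K }) le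
  onto : ∀ {j} → j ∈ K → ∃[ i ] i ∈ K × g i ≡ j
  onto j∈K = image⁻ g K (subst (_ ∈_) (sym im≡) j∈K)
  inj : ∀ {i i′} → i ∈ K → i′ ∈ K → g i ≡ g i′ → i ≡ i′
  inj {i} {i′} i∈K i′∈K e with i ≟ᶠ i′
  ... | yes p = p
  ... | no i≢i′ = contradiction (ℕ.≤-trans (ℕ.≤-reflexive (sym (∣⊖∣ i∈K))) (card-≤ K (K ⊖ i) (λ y z → g z ≡ y) pre λ _ _ r s → trans (sym r) s)) (ℕ.<-irrefl refl)
    where
    pre : ∀ {y} → y ∈ K → ∃[ z ] z ∈ K ⊖ i × g z ≡ y
    pre y∈K with onto y∈K
    ... | z , z∈K , e′ with z ≟ᶠ i
    ...   | yes refl = i′ , ∈-⊖ i′∈K (≢-sym i≢i′) , trans (sym e) e′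
    ...   | no z≢i   = z , ∈-⊖ z∈K z≢i , e′

-- Perfect matchings as relations

BiRel : ℕ → ℕ → Set₁
BiRel n d = Fin n → Fin d → Set

infix 4 _⊑_
_⊑_ : BiRel n d → BiRel n d → Set
P ⊑ Q = ∀ {i j} → P i j → Q i j

flip′ : BiRel n d → BiRel d n
flip′ P j i = P i j

record PM (I : Subset n) (J : Subset d) (P : BiRel n d) : Set where
  field
    domˡ : ∀ {i j} → P i j → i ∈ I
    domʳ : ∀ {i j} → P i j → j ∈ J
    totˡ : ∀ {i} → i ∈ I → ∃[ j ] P i j
    totʳ : ∀ {j} → j ∈ J → ∃[ i ] P i j
    func : ∀ {i j j′} → P i j → P i j′ → j ≡ j′
    inj  : ∀ {i i′ j} → P i j → P i′ j → i ≡ i′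

module _ {I : Subset n} {J : Subset d} {P : BiRel n d} (p : PM I J P) where
  open PM p

  pm-flip : PM J I (flip′ P)
  pm-flip = record { domˡ = domʳ ; domʳ = domˡ ; totˡ = totʳ ; totʳ = totˡ ; func = inj ; inj = func }

  pm-card : ∣ I ∣ ≡ ∣ J ∣
  pm-card = ℕ.≤-antisym
    (card-≤ I J P (λ h → case totˡ h of λ (j , q) → j , domʳ q , q) λ _ _ → inj)
    (card-≤ J I (flip′ P) (λ h → case totʳ h of λ (i , q) → i , domˡ q , q) λ _ _ → func)

  pm-dec : ∀ i j → Dec (P i j)
  pm-dec i j with i ∈? I
  ... | no i∉I = no (i∉I ∘ domˡ)
  ... | yes i∈I with totˡ i∈I
  ...   | k , q with k ≟ᶠ j
  ...     | yes refl = yes q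
  ...     | no k≢j   = no (k≢j ∘ func q)

  pm-delete : ∀ {x y} → P x y → PM (I ⊖ x) (J ⊖ y) (λ i j → P i j × i ≢ x)
  pm-delete {x} {y} q = record
    { domˡ = λ (r , ne) → ∈-⊖ (domˡ r) ne
    ; domʳ = λ (r , ne) → ∈-⊖ (domʳ r) λ { refl → ne (inj r q) }
    ; totˡ = λ h → case totˡ (⊖-⊆ I h) of λ (j , r) → j , r , ⊖-≢ I h
    ; totʳ = λ h → case totʳ (⊖-⊆ J h) of λ (i , r) → i , r , λ { refl → ⊖-≢ J h (func r q) }
    ; func = λ (r , _) (s , _) → func r s
    ; inj  = λ (r , _) (s , _) → inj r s }

  pm-add : ∀ {x y} → x ∉ I → y ∉ J → PM (I ⊕ x) (J ⊕ y) (λ i j → (i ≡ x × j ≡ y) ⊎ P i j)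
  pm-add {x} {y} x∉I y∉J = record
    { domˡ = λ { (inj₁ (refl , _)) → ∈-⊕ I x ; (inj₂ q) → ⊆-⊕ I x (domˡ q) }
    ; domʳ = λ { (inj₁ (_ , refl)) → ∈-⊕ J y ; (inj₂ q) → ⊆-⊕ J y (domʳ q) }
    ; totˡ = λ h → case ⊕-inv I x h of λ
        { (inj₁ refl) → y , inj₁ (refl , refl)
        ; (inj₂ q) → case totˡ q of λ (j , r) → j , inj₂ r }
    ; totʳ = λ h → case ⊕-inv J y h of λ
        { (inj₁ refl) → x , inj₁ (refl , refl)
        ; (inj₂ q) → case totʳ q of λ (j , r) → j , inj₂ r }
    ; func = λ { (inj₁ (_ , refl)) (inj₁ (_ , refl)) → refl
               ; (inj₁ (refl , _)) (inj₂ r) → contradiction (domˡ r) x∉I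
               ; (inj₂ r) (inj₁ (refl , _)) → contradiction (domˡ r) x∉I
               ; (inj₂ r) (inj₂ s) → func r s }
    ; inj  = λ { (inj₁ (refl , _)) (inj₁ (refl , _)) → refl
               ; (inj₁ (_ , refl)) (inj₂ r) → contradiction (domʳ r) y∉J
               ; (inj₂ r) (inj₁ (_ , refl)) → contradiction (domʳ r) y∉J
               ; (inj₂ r) (inj₂ s) → inj r s } }

  pm-fun : Fin d → ∃[ f ] Bij I J f × (∀ {i} → i ∈ I → P i (f i))
  pm-fun j₀ = f , record
      { into = λ h → domʳ (f-P h)
      ; inj  = λ a b e → inj (f-P a) (subst (P _) (sym e) (f-P b))
      ; onto = λ h → case totʳ h of λ (i , q) → i , domˡ q , func (f-P (domˡ q)) q }
    , f-P
    where
    f : Fin _ → Fin _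
    f i with i ∈? I
    ... | yes h = proj₁ (totˡ h)
    ... | no _  = j₀
    f-P : ∀ {i} → i ∈ I → P i (f i)
    f-P {i} i∈I with i ∈? I
    ... | yes h = proj₂ (totˡ h)
    ... | no i∉ = contradiction i∈I i∉

bij-pm : ∀ {I : Subset n} {J : Subset d} {f} → Bij I J f → PM I J (λ i j → i ∈ I × f i ≡ j)
bij-pm b = record
  { domˡ = proj₁
  ; domʳ = λ { (h , refl) → B.into h }
  ; totˡ = λ h → _ , h , refl
  ; totʳ = λ h → B.onto h
  ; func = λ { (_ , refl) (_ , refl) → refl }
  ; inj  = λ (a , e) (b , e′) → B.inj a b (trans e (sym e′)) }
  where module B = Bij b

pm-⊒ : ∀ {I : Subset n} {J : Subset d} {P Q : BiRel n d} →
       PM I J P → PM I J Q → P ⊑ Q → Q ⊑ P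
pm-⊒ p q P⊑Q {i} {j} r with PM.totˡ p (PM.domˡ q r)
... | k , s with PM.func q (P⊑Q s) r
...   | refl = s

-- Matching ensembles, with the linkage axioms in local form: among the
-- matchings M_{I,J-x} a left vertex has at most two partners, and dually.

record Sys (n d : ℕ) : Set₁ where
  field
    E       : Subset n → Subset d → BiRel n d
    pm      : ∀ {I J} → ∣ I ∣ ≡ ∣ J ∣ → PM I J (E I J)
    closure : ∀ {I J I′ J′ P} → ∣ I ∣ ≡ ∣ J ∣ → PM I′ J′ P → P ⊑ E I J → P ⊑ E I′ J′
    R1      : ∀ {I J i x y z a b c} → ∣ J ∣ ≡ suc ∣ I ∣ → x ∈ J → y ∈ J → z ∈ J →
              E I (J ⊖ x) i a → E I (J ⊖ y) i b → E I (J ⊖ z) i c → a ≡ b ⊎ b ≡ c ⊎ a ≡ c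
    L1      : ∀ {I J j x y z a b c} → ∣ I ∣ ≡ suc ∣ J ∣ → x ∈ I → y ∈ I → z ∈ I →
              E (I ⊖ x) J a j → E (I ⊖ y) J b j → E (I ⊖ z) J c j → a ≡ b ⊎ b ≡ c ⊎ a ≡ c

infix 10 _ᵀ
_ᵀ : Sys n d → Sys d n
S ᵀ = record
  { E       = λ J I → flip′ (E I J)
  ; pm      = λ e → pm-flip (pm (sym e))
  ; closure = λ e p P⊑ → closure (sym e) (pm-flip p) P⊑
  ; R1      = λ e → L1 e
  ; L1      = λ e → R1 e }
  where open Sys S

Comp : Sys n d → BiRel n d → Set₁
Comp S H = ∀ {I J P} → PM I J P → P ⊑ H → P ⊑ Sys.E S I J

comp-mono : (S : Sys n d) {H K : BiRel n d} → H ⊑ K → Comp S K → Comp S H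
comp-mono S H⊑K c p P⊑H = c p (λ q → H⊑K (P⊑H q))

flip-comp : (S : Sys n d) {H : BiRel d n} → Comp (S ᵀ) H → Comp S (flip′ H)
flip-comp S c p P⊑ = c (pm-flip p) P⊑

-- Alternating between compatible U and V from right vertices in K never
-- gets stuck in a nontrivial way: the closed alternating walk would be made
-- of two different matchings with the same ends.
no-alternation : (S : Sys n d) {U V : BiRel n d} → Comp S U → Comp S V →
  (σ : Fin n → Fin d) (τ : Fin d → Fin n) (K : Subset d) → Nonempty K →
  (∀ {k} → k ∈ K → V (τ k) k × U (τ k) (σ (τ k)) × σ (τ k) ∈ K × σ (τ k) ≢ k) → Empty
no-alternation S {U} {V} cU cV σ τ K ne h
  with bijective-core (σ ∘ τ) ∣ K ∣ K ℕ.≤-refl ne (λ k∈ → proj₁ (proj₂ (proj₂ (h k∈))))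
... | K′ , K′⊆K , (k₀ , k₀∈) , b = proj₂ (proj₂ (proj₂ (h (K′⊆K k₀∈))))
        (PM.func (Sys.pm S (pm-card pmQ)) (cU pmP P⊑U (k₀ , k₀∈ , refl , refl))
                                            (cV pmQ Q⊑V (k₀ , k₀∈ , refl , refl)))
  where
  module B = Bij b
  I′ = image τ K′
  -- Since `σ ∘ τ` permutes `K′`, both relations match the rows `τ k` with the columns `K′`; one
  -- pairs `τ k` with `σ (τ k)`, the other with `k`.
  P Q : BiRel _ _
  P i j = ∃[ k ] k ∈ K′ × τ k ≡ i × σ (τ k) ≡ j
  Q i j = ∃[ k ] k ∈ K′ × τ k ≡ i × k ≡ j
  τ-inj : ∀ {k l} → k ∈ K′ → l ∈ K′ → τ k ≡ τ l → k ≡ l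
  τ-inj a b e = B.inj a b (cong σ e)
  pmP : PM I′ K′ P
  pmP = record
    { domˡ = λ { (k , k∈ , refl , _) → image⁺ τ K′ k∈ }
    ; domʳ = λ { (k , k∈ , _ , refl) → B.into k∈ }
    ; totˡ = λ i∈ → case image⁻ τ K′ i∈ of λ (k , k∈ , e) → _ , k , k∈ , e , refl
    ; totʳ = λ j∈ → case B.onto j∈ of λ (k , k∈ , e) → _ , k , k∈ , refl , e
    ; func = λ { (k , k∈ , refl , refl) (l , l∈ , e , refl) → cong σ (sym e) }
    ; inj  = λ { (k , k∈ , refl , refl) (l , l∈ , refl , e) → cong τ (B.inj k∈ l∈ (sym e)) } }
  pmQ : PM I′ K′ Q
  pmQ = record
    { domˡ = λ { (k , k∈ , refl , _) → image⁺ τ K′ k∈ }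
    ; domʳ = λ { (k , k∈ , _ , refl) → k∈ }
    ; totˡ = λ i∈ → case image⁻ τ K′ i∈ of λ (k , k∈ , e) → k , k , k∈ , e , refl
    ; totʳ = λ {j} j∈ → _ , j , j∈ , refl , refl
    ; func = λ { (k , k∈ , refl , refl) (l , l∈ , e , refl) → τ-inj k∈ l∈ (sym e) }
    ; inj  = λ { (k , k∈ , refl , refl) (l , l∈ , refl , refl) → refl } }
  P⊑U : P ⊑ U
  P⊑U (k , k∈ , refl , refl) = proj₁ (proj₂ (h (K′⊆K k∈)))
  Q⊑V : Q ⊑ V
  Q⊑V (k , k∈ , refl , refl) = proj₁ (h (K′⊆K k∈))

-- Walking along nxt until a terminal row e, and shifting every row on the
-- way to its successor: x is vacated at the expense of e = end x.
record Vacate (I : Subset n) (Term : Fin n → Set) (nxt end : Fin n → Fin n) (x : Fin n) : Set where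
  field
    shift : Fin n → Fin n
    e∈I   : end x ∈ I
    term  : Term (end x)
    bij   : Bij (I ⊖ end x) (I ⊖ x) shift
    moves : ∀ {i} → i ∈ I → i ≢ end x →
            shift i ≡ i ⊎ (shift i ≡ nxt i × ¬ Term i × end i ≡ end x)

-- Induction along a well-founded functional graph.
peel : ∀ {ℓ} (I : Subset n) (Term : Fin n → Set) (nxt : Fin n → Fin n) →
  (∀ {i} → i ∈ I → ¬ Term i → nxt i ∈ I) →
  (∀ {K} → K ⊆ I → Nonempty K → ∃[ i ] i ∈ K × (Term i ⊎ (¬ Term i × nxt i ∉ K))) →
  (Q : Subset n → Set ℓ) → Q ∅ →
  (∀ {i G} → G ⊆ I → i ∈ I → i ∉ G → Term i ⊎ (¬ Term i × nxt i ∈ G) → Q G → Q (G ⊕ i)) → Q I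
peel I Term nxt stay wf Q base step = go ∣ I ∣ I _ id (λ h → contradiction h ∉⊥) (λ a b → contradiction a b) (λ _ b → ∉⊥ b) ℕ.≤-refl base
  where
  -- `K` holds the rows still to come and `G` those done. The row that `wf` finds in `K` ends, or
  -- has a successor outside `K`, which is then already in `G`.
  go : ∀ k K G → K ⊆ I → G ⊆ I → (∀ {i} → i ∈ I → i ∉ K → i ∈ G) → (∀ {i} → i ∈ K → i ∉ G) →
       ∣ K ∣ ≤ k → Q G → Q I
  go k K G K⊆ G⊆ cov dis le q with any? (_∈? K)
  ... | no ¬ne = subst Q (⊆-antisym G⊆ λ h → cov h λ h′ → ¬ne (_ , h′)) q
  ... | yes ne with k | wf K⊆ ne
  ...   | zero | _ = contradiction (ℕ.≤-trans (ℕ.≤-reflexive (sym (∣⊖∣ (proj₂ ne)))) le) λ ()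
  ...   | suc k′ | i , i∈K , t = go k′ (K ⊖ i) (G ⊕ i)
          (λ h → K⊆ (⊖-⊆ K h))
          (λ h → case ⊕-inv G i h of λ { (inj₁ refl) → K⊆ i∈K ; (inj₂ h′) → G⊆ h′ })
          (λ {j} j∈ j∉ → case j ≟ᶠ i of λ
            { (yes refl) → ∈-⊕ G i ; (no ne′) → ⊆-⊕ G i (cov j∈ λ j∈K → j∉ (∈-⊖ j∈K ne′)) })
          (λ j∈ j∈′ → dis (⊖-⊆ K j∈) (⊕-inv′ G i j∈′ (⊖-≢ K j∈)))
          (s≤s⁻¹ (ℕ.≤-trans (ℕ.≤-reflexive (sym (∣⊖∣ i∈K))) le))
          (step G⊆ (K⊆ i∈K) (dis i∈K)
            (case t of λ { (inj₁ t) → inj₁ t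
                         ; (inj₂ (nt , n∉)) → inj₂ (nt , cov (stay (K⊆ i∈K) nt) n∉) }) q)

vacate-walk : (I : Subset n) (Term : Fin n → Set) (nxt : Fin n → Fin n) →
  (∀ {i} → i ∈ I → ¬ Term i → nxt i ∈ I) →
  (∀ {K} → K ⊆ I → Nonempty K → ∃[ i ] i ∈ K × (Term i ⊎ (¬ Term i × nxt i ∉ K))) →
  ∃[ end ] (∀ {x} → x ∈ I → Vacate I Term nxt end x)
vacate-walk {n} I Term nxt stay wf = proj₁ peeled , λ x∈ → proj₁ (proj₂ peeled x∈)
  where
  -- Besides giving the walk from `x`, the invariant says that it ends in `G` and moves no row
  -- outside `G`. Hence the next row can be put in front of it by changing a single value of the
  -- shift.
  Motive : Subset n → Set
  Motive G = Σ[ end ∈ (Fin n → Fin n) ] (∀ {x} → x ∈ G → Σ[ v ∈ Vacate I Term nxt end x ]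
               end x ∈ G × (∀ {i} → i ∈ I → i ∉ G → Vacate.shift v i ≡ i))
  step : ∀ {i G} → G ⊆ I → i ∈ I → i ∉ G → Term i ⊎ (¬ Term i × nxt i ∈ G) → Motive G → Motive (G ⊕ i)
  step {i} {G} G⊆I i∈I i∉G t (end , v) = end′ , λ x∈ → case ⊕-inv G i x∈ of λ
      { (inj₁ refl) → new t refl ; (inj₂ x∈G) → old x∈G }
    where
    e : Fin n
    e = case t of λ { (inj₁ _) → i ; (inj₂ _) → end (nxt i) }
    end′ = update end i e
    keep : ∀ {x} → x ∈ G → end′ x ≡ end x
    keep x∈G = update-≢ end λ { refl → i∉G x∈G }
    old : ∀ {x} → x ∈ G → Σ[ v ∈ Vacate I Term nxt end′ x ]
               end′ x ∈ G ⊕ i × (∀ {j} → j ∈ I → j ∉ G ⊕ i → Vacate.shift v j ≡ j)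
    old {x} x∈G with v x∈G
    ... | w , e∈G , fix = record
        { shift = shift
        ; e∈I = subst (_∈ I) (sym (keep x∈G)) e∈I
        ; term = subst Term (sym (keep x∈G)) term
        ; bij = subst (λ z → Bij (I ⊖ z) (I ⊖ x) shift) (sym (keep x∈G)) bij
        ; moves = λ {j} j∈I j≢ → subst (λ z → shift j ≡ j ⊎ (shift j ≡ nxt j × ¬ Term j × end′ j ≡ z))
            (sym (keep x∈G)) (mv j∈I λ eq → j≢ (trans eq (sym (keep x∈G)))) }
      , subst (_∈ G ⊕ i) (sym (keep x∈G)) (⊆-⊕ G i e∈G) , λ j∈ j∉ → fix j∈ λ h → j∉ (⊆-⊕ G i h)
      where
      open Vacate w
      mv : ∀ {j} → j ∈ I → j ≢ end x → shift j ≡ j ⊎ (shift j ≡ nxt j × ¬ Term j × end′ j ≡ end x)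
      mv {j} j∈I j≢ with j ∈? G
      ... | no j∉G = inj₁ (fix j∈I j∉G)
      ... | yes j∈G with moves j∈I j≢
      ...   | inj₁ q = inj₁ q
      ...   | inj₂ (a , b , c) = inj₂ (a , b , trans (keep j∈G) c)
    new : (t′ : Term i ⊎ (¬ Term i × nxt i ∈ G)) → t ≡ t′ → Σ[ v ∈ Vacate I Term nxt end′ i ]
               end′ i ∈ G ⊕ i × (∀ {j} → j ∈ I → j ∉ G ⊕ i → Vacate.shift v j ≡ j)
    new (inj₁ ti) refl = record
        { shift = id
        ; e∈I = subst (_∈ I) (sym eq) i∈I
        ; term = subst Term (sym eq) ti
        ; bij = subst (λ z → Bij (I ⊖ z) (I ⊖ i) id) (sym eq)
            (record { into = id ; inj = λ _ _ r → r ; onto = λ h → _ , h , refl })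
        ; moves = λ _ _ → inj₁ refl }
      , subst (_∈ G ⊕ i) (sym eq) (∈-⊕ G i) , λ _ _ → refl
      where
      eq : end′ i ≡ i
      eq = update-≡ end i e
    new (inj₂ (nt , n∈G)) refl with v n∈G
    ... | w , e∈G , fix = record
        { shift = g
        ; e∈I = subst (_∈ I) (sym eq) e∈I
        ; term = subst Term (sym eq) term
        ; bij = subst (λ z → Bij (I ⊖ z) (I ⊖ i) g) (sym eq) record { into = g-into ; inj = g-inj ; onto = g-onto }
        ; moves = λ {j} j∈I j≢ → subst (λ z → g j ≡ j ⊎ (g j ≡ nxt j × ¬ Term j × end′ j ≡ z))
            (sym eq) (g-moves j∈I λ q → j≢ (trans q (sym eq))) }
      , subst (_∈ G ⊕ i) (sym eq) (⊆-⊕ G i e∈G)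
      , λ {j} j∈ j∉ → trans (update-≢ shift λ { refl → j∉ (∈-⊕ G i) }) (fix j∈ λ h → j∉ (⊆-⊕ G i h))
      where
      open Vacate w
      module B = Bij bij
      x′ = nxt i
      g = update shift i x′
      eq : end′ i ≡ end x′
      eq = update-≡ end i e
      si : shift i ≡ i
      si = fix i∈I i∉G
      i≢e : i ≢ end x′
      i≢e q = i∉G (subst (_∈ G) (sym q) e∈G)
      g-i : g i ≡ x′
      g-i = update-≡ shift i x′
      g-j : ∀ {j} → j ≢ i → g j ≡ shift j
      g-j ne = update-≢ shift ne
      i∈⊖ : i ∈ I ⊖ end x′
      i∈⊖ = ∈-⊖ i∈I i≢e
      g-into : ∀ {j} → j ∈ I ⊖ end x′ → g j ∈ I ⊖ i
      g-into {j} j∈ with j ≟ᶠ i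
      ... | yes refl = ∈-⊖ (G⊆I n∈G) λ eq → i∉G (subst (_∈ G) eq n∈G)
      ... | no j≢i = ∈-⊖ (⊖-⊆ I (B.into j∈)) λ q → j≢i (B.inj j∈ i∈⊖ (trans q (sym si)))
      g-inj : ∀ {j k} → j ∈ I ⊖ end x′ → k ∈ I ⊖ end x′ → g j ≡ g k → j ≡ k
      g-inj {j} {k} j∈ k∈ q with j ≟ᶠ i | k ≟ᶠ i
      ... | yes refl | yes refl = refl
      ... | yes refl | no k≢i = contradiction (sym q) (⊖-≢ I (B.into k∈))
      ... | no j≢i | yes refl = contradiction q (⊖-≢ I (B.into j∈))
      ... | no j≢i | no k≢i = B.inj j∈ k∈ q
      g-onto : ∀ {c} → c ∈ I ⊖ i → ∃[ j ] j ∈ I ⊖ end x′ × g j ≡ c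
      g-onto {c} c∈ with c ≟ᶠ x′
      ... | yes refl = i , i∈⊖ , g-i
      ... | no c≢ with B.onto (∈-⊖ (⊖-⊆ I c∈) c≢)
      ...   | j , j∈ , q = j , j∈ , trans (g-j λ { refl → ⊖-≢ I c∈ (trans (sym q) si) }) q
      g-moves : ∀ {j} → j ∈ I → j ≢ end x′ → g j ≡ j ⊎ (g j ≡ nxt j × ¬ Term j × end′ j ≡ end x′)
      g-moves {j} j∈I j≢ with j ≟ᶠ i
      ... | yes refl = inj₂ (refl , nt , refl)
      ... | no j≢i with j ∈? G
      ...   | no j∉G = inj₁ (fix j∈I j∉G)
      ...   | yes j∈G with moves j∈I j≢
      ...     | inj₁ q = inj₁ q
      ...     | inj₂ q = inj₂ q
  peeled : Motive I
  peeled = peel I Term nxt stay wf Motive (id , λ h → contradiction h ∉⊥) step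

abstract
  vacate : (I : Subset n) (Term : Fin n → Set) (nxt : Fin n → Fin n) →
    (∀ {i} → i ∈ I → ¬ Term i → nxt i ∈ I) →
    (∀ {K} → K ⊆ I → Nonempty K → ∃[ i ] i ∈ K × (Term i ⊎ (¬ Term i × nxt i ∉ K))) →
    ∃[ end ] (∀ {x} → x ∈ I → Vacate I Term nxt end x)
  vacate = vacate-walk

-- Linkage graphs and their completions

Nb : Sys n d → Subset n → Subset d → BiRel n d
Nb S I J i j = ∃[ x ] x ∈ J × Sys.E S I (J ⊖ x) i j

module Linkage (S : Sys n d) {I : Subset n} {J : Subset d} (c : ∣ J ∣ ≡ suc ∣ I ∣) where
  open Sys S

  pm⊖ : ∀ {x} → x ∈ J → PM I (J ⊖ x) (E I (J ⊖ x))
  pm⊖ x∈J = pm (∣⊖∣-≡ {I = I} {J} c x∈J)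

  nb-domˡ : ∀ {i j} → Nb S I J i j → i ∈ I
  nb-domˡ (x , x∈J , e) = PM.domˡ (pm⊖ x∈J) e

  nb-domʳ : ∀ {i j} → Nb S I J i j → j ∈ J
  nb-domʳ (x , x∈J , e) = ⊖-⊆ J (PM.domʳ (pm⊖ x∈J) e)

  nb? : ∀ i j → Dec (Nb S I J i j)
  nb? i j = any? λ x → edge? x
    where
    edge? : ∀ x → Dec (x ∈ J × E I (J ⊖ x) i j)
    edge? x with x ∈? J
    ... | no x∉  = no (x∉ ∘ proj₁)
    ... | yes x∈ = map′ (x∈ ,_) proj₂ (pm-dec (pm⊖ x∈) i j)

  nb-two : ∀ {i a b k} → Nb S I J i a → Nb S I J i b → Nb S I J i k → a ≡ b ⊎ b ≡ k ⊎ a ≡ k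
  nb-two (_ , x∈J , p) (_ , y∈J , q) (_ , z∈J , r) = R1 c x∈J y∈J z∈J p q r

  nb-other : ∀ {i} → i ∈ I → ∀ a → ∃[ b ] Nb S I J i b × b ≢ a
  nb-other i∈I a with a ∈? J
  ... | yes a∈J = case PM.totˡ (pm⊖ a∈J) i∈I of λ (b , e) →
                    b , (a , a∈J , e) , ⊖-≢ J (PM.domʳ (pm⊖ a∈J) e)
  ... | no a∉J  = case ∣∣-nonempty {p = J} c of λ (x , x∈J) → case PM.totˡ (pm⊖ x∈J) i∈I of λ (b , e) →
                    b , (x , x∈J , e) , λ { refl → a∉J (nb-domʳ (x , x∈J , e)) }

  -- M_{I,J-b} maps K injectively into L - b.
  tight : ∀ {K : Subset n} {L : Subset d} {i₀} → K ⊆ I → i₀ ∈ K →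
          (∀ {i j} → i ∈ K → Nb S I J i j → j ∈ L) → ∣ L ∣ ≤ ∣ K ∣ → Empty
  tight {K} {L} {i₀} K⊆I i₀∈K h L≤K with nb-other (K⊆I i₀∈K) (proj₁ (∣∣-nonempty {p = J} c))
  ... | b , nb , _ = ℕ.<-irrefl refl (ℕ.≤-trans (s≤s K≤L⊖b) (ℕ.≤-trans (ℕ.≤-reflexive (sym (∣⊖∣ (h i₀∈K nb)))) L≤K))
    where
    b∈J = nb-domʳ nb
    K≤L⊖b : ∣ K ∣ ≤ ∣ L ⊖ b ∣
    K≤L⊖b = card-≤ K (L ⊖ b) (E I (J ⊖ b))
      (λ i∈K → case PM.totˡ (pm⊖ b∈J) (K⊆I i∈K) of λ (k , e) →
        k , ∈-⊖ (h i∈K (b , b∈J , e)) (⊖-≢ J (PM.domʳ (pm⊖ b∈J) e)) , e)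
      λ _ _ → PM.inj (pm⊖ b∈J)

  -- In a row where `P` and `Q` differ, the two partners are all the neighbours it has. The
  -- neighbourhood of the differing rows `K` thus lies in the set `L` of their `Q`-partners, which
  -- is no larger than `K`, against `tight`.
  unique-pm : ∀ {I₁ J₁} {P Q : BiRel n d} → PM I₁ J₁ P → PM I₁ J₁ Q → I₁ ⊆ I →
              P ⊑ Nb S I J → Q ⊑ Nb S I J → P ⊑ Q
  unique-pm {I₁} {J₁} {P} {Q} p q I₁⊆I P⊑ Q⊑ {i} {j} r with PM.totˡ q (PM.domˡ p r)
  ... | k , s with k ≟ᶠ j
  ...   | yes refl = s
  ...   | no k≢j   = ⊥-elim (tight {K} {L} K⊆I i∈K inL L≤K)
    where
    Dif : Fin n → Set
    Dif i = ∃[ a ] ∃[ b ] P i a × Q i b × a ≢ b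
    dif? : ∀ i → Dec (Dif i)
    dif? i = any? λ a → any? λ b → pm-dec p i a ×-dec (pm-dec q i b ×-dec ¬? (a ≟ᶠ b))
    K = subset dif?
    col? : ∀ b → Dec (∃[ i ] i ∈ K × Q i b)
    col? b = any? λ i → (i ∈? K) ×-dec pm-dec q i b
    L = subset col?
    K⊆I : K ⊆ I
    K⊆I h = case subset⁻ dif? h of λ (_ , _ , u , _) → I₁⊆I (PM.domˡ p u)
    i∈K : i ∈ K
    i∈K = subset⁺ dif? (j , k , r , s , ≢-sym k≢j)
    L≤K : ∣ L ∣ ≤ ∣ K ∣
    L≤K = card-≤ L K (flip′ Q) (λ h → subset⁻ col? h) λ _ _ → PM.func q
    inL : ∀ {i j} → i ∈ K → Nb S I J i j → j ∈ L
    inL {i} {j} i∈K nb with subset⁻ dif? i∈K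
    ... | a , b , u , v , a≢b with nb-two (P⊑ u) (Q⊑ v) nb
    ...   | inj₁ a≡b = contradiction a≡b a≢b
    ...   | inj₂ (inj₁ refl) = subset⁺ col? (i , i∈K , v)
    -- The `P`-partner of `i` is the `Q`-partner of some row `i′`, as the ends agree, and `i′` is
    -- again a row where the two differ.
    ...   | inj₂ (inj₂ refl) with PM.totʳ q (PM.domʳ p u)
    ...     | i′ , v′ with PM.totˡ p (PM.domˡ q v′)
    ...       | a′ , u′ = subset⁺ col? (i′ , subset⁺ dif? (a′ , a , u′ , v′ , a′≢a) , v′)
      where
      a′≢a : a′ ≢ a
      a′≢a refl with PM.inj p u u′
      ... | refl = a≢b (PM.func q v′ v)

  -- Otherwise every neighbour of `K`, being some `f i` or `o i`, lies in the image of `f`, which is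
  -- too small by `tight`. This is why alternating walks in the linkage tree end.
  escape : ∀ {K : Subset n} (f o : Fin n → Fin d) → K ⊆ I → Nonempty K →
           (∀ {i} → i ∈ K → Nb S I J i (f i) × Nb S I J i (o i) × o i ≢ f i) →
           ∃[ i ] i ∈ K × o i ∉ image f K
  escape {K} f o K⊆I (i₀ , i₀∈K) h with any? (λ i → (i ∈? K) ×-dec ¬? (o i ∈? image f K))
  ... | yes r = r
  ... | no none = ⊥-elim (tight K⊆I i₀∈K inL
          (card-≤ (image f K) K (λ j i → f i ≡ j) (λ h → image⁻ f K h) λ _ _ u v → trans (sym u) v))
    where
    inL : ∀ {i j} → i ∈ K → Nb S I J i j → j ∈ image f K
    inL {i} i∈K nb with h i∈K
    ... | nf , no′ , o≢f with nb-two nf no′ nb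
    ...   | inj₁ e = contradiction (sym e) o≢f
    ...   | inj₂ (inj₂ refl) = image⁺ f K i∈K
    ...   | inj₂ (inj₁ refl) with o i ∈? image f K
    ...     | yes r = r
    ...     | no r  = contradiction (i , i∈K , r) none

-- The linkage tree on I ⊔ J together with the remaining left vertices as leaves.
Bas : Sys n d → Subset n → Subset d → BiRel n d
Bas S I J i j = (i ∈ I × Nb S I J i j) ⊎ (i ∉ I × Sys.E S (I ⊕ i) J i j)

module _ (S : Sys n d) {I : Subset n} {J : Subset d} (c : ∣ J ∣ ≡ suc ∣ I ∣) where
  open Sys S
  open Linkage S {I} {J} c

  ∣I⊕∣ : ∀ {i} → i ∉ I → ∣ I ⊕ i ∣ ≡ ∣ J ∣
  ∣I⊕∣ i∉I = trans (∣⊕∣ i∉I) (sym c)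

  bas-domʳ : ∀ {i j} → Bas S I J i j → j ∈ J
  bas-domʳ (inj₁ (_ , nb)) = nb-domʳ nb
  bas-domʳ (inj₂ (i∉I , e)) = PM.domʳ (pm (∣I⊕∣ i∉I)) e

  bas-tot : ∀ i → ∃[ j ] Bas S I J i j
  bas-tot i with i ∈? I
  ... | yes i∈I = case nb-other i∈I (proj₁ (∣∣-nonempty {p = J} c)) of λ (j , nb , _) → j , inj₁ (i∈I , nb)
  ... | no i∉I  = case PM.totˡ (pm (∣I⊕∣ i∉I)) (∈-⊕ I i) of λ (j , e) → j , inj₂ (i∉I , e)

  bas-row : ∀ {i j} → i ∈ I → Bas S I J i j → Nb S I J i j
  bas-row i∈I (inj₁ (_ , nb)) = nb
  bas-row i∈I (inj₂ (i∉I , _)) = contradiction i∈I i∉I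

  private
    -- Once `I` is covered, counting leaves two cases. Either `I′` is `I` and `P` misses one vertex
    -- of `J`, so that `unique-pm` compares it with a matching defining the tree; or there is
    -- exactly one leaf row `i₀`, whose edge comes from `E (I ⊕ i₀) J`, and the comparison is made
    -- after deleting that row.
    saturated : ∀ {I′ J′ P} → PM I′ J′ P → P ⊑ Bas S I J → I ⊆ I′ → P ⊑ E I′ J′
    saturated {I′} {J′} {P} p P⊑ I⊆I′ {i} {j} r with any? (λ i → (i ∈? I′) ×-dec ¬? (i ∈? I))
    ... | no none = E-step
      where
      I′≡I : I ≡ I′
      I′≡I = ⊆-antisym I⊆I′ λ {k} h → case k ∈? I of λ { (yes k∈) → k∈ ; (no k∉) → contradiction (k , h , k∉) none }
      J′⊆J : J′ ⊆ J
      J′⊆J h = case PM.totʳ p h of λ (_ , q) → bas-domʳ (P⊑ q)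
      E-step : E I′ J′ i j
      E-step with any? (λ x → (x ∈? J) ×-dec ¬? (x ∈? J′))
      ... | no ¬x = contradiction (p⊆q⇒∣p∣≤∣q∣ {p = J} {J′} λ {x} x∈J → case x ∈? J′ of λ
                      { (yes h) → h ; (no h) → contradiction (x , x∈J , h) ¬x })
                      (λ le → ℕ.<-irrefl refl (ℕ.≤-trans (ℕ.≤-reflexive (trans (cong suc (trans (sym (pm-card p)) (cong ∣_∣ (sym I′≡I)))) (sym c))) le))
      ... | yes (x , x∈J , x∉J′) = go I′≡I J′≡
        where
        J′≡ : J′ ≡ J ⊖ x
        J′≡ = ⊆-∣∣-≡ (λ h → ∈-⊖ (J′⊆J h) λ { refl → x∉J′ h })
          (ℕ.≤-reflexive (trans (sym (∣⊖∣-≡ {I = I} {J} c x∈J)) (trans (cong ∣_∣ I′≡I) (pm-card p))))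
        go : I ≡ I′ → J′ ≡ J ⊖ x → E I′ J′ i j
        go refl refl = unique-pm p (pm⊖ x∈J) id (λ q → bas-row (PM.domˡ p q) (P⊑ q)) (λ q → x , x∈J , q) r
    ... | yes (i₀ , i₀∈I′ , i₀∉I) with PM.totˡ p i₀∈I′
    ...   | k₀ , r₀ = go I′≡ J′≡
      where
      J′⊆J : J′ ⊆ J
      J′⊆J h = case PM.totʳ p h of λ (_ , q) → bas-domʳ (P⊑ q)
      I′≡ : I ⊕ i₀ ≡ I′
      I′≡ = ⊆-∣∣-≡ (λ h → case ⊕-inv I i₀ h of λ { (inj₁ refl) → i₀∈I′ ; (inj₂ h′) → I⊆I′ h′ })
        (ℕ.≤-trans (ℕ.≤-reflexive (pm-card p)) (ℕ.≤-trans (p⊆q⇒∣p∣≤∣q∣ J′⊆J) (ℕ.≤-reflexive (sym (∣I⊕∣ i₀∉I)))))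
      J′≡ : J′ ≡ J
      J′≡ = ⊆-∣∣-≡ J′⊆J (ℕ.≤-reflexive (trans (sym (∣I⊕∣ i₀∉I)) (trans (cong ∣_∣ I′≡) (pm-card p))))
      e₀ : E (I ⊕ i₀) J i₀ k₀
      e₀ = case P⊑ r₀ of λ { (inj₁ (h , _)) → contradiction h i₀∉I ; (inj₂ (_ , e)) → e }
      go : I ⊕ i₀ ≡ I′ → J′ ≡ J → E I′ J′ i j
      go refl refl with i ≟ᶠ i₀
      ... | yes refl = subst (E (I ⊕ i₀) J i₀) (PM.func p r₀ r) e₀
      ... | no i≢ = proj₁ (unique-pm p′ q′ id
               (λ (q , ne) → bas-row (⊕-inv′ I i₀ (PM.domˡ p q) ne) (P⊑ q))
               (λ q → k₀ , k₀∈J , closure (∣I⊕∣ i₀∉I) q′ proj₁ q) (r , i≢))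
        where
        k₀∈J = PM.domʳ p r₀
        p′ : PM I (J ⊖ k₀) (λ i j → P i j × i ≢ i₀)
        p′ = subst (λ z → PM z (J ⊖ k₀) (λ i j → P i j × i ≢ i₀)) (⊕⊖ i₀∉I) (pm-delete p r₀)
        q′ : PM I (J ⊖ k₀) (λ i j → E (I ⊕ i₀) J i j × i ≢ i₀)
        q′ = subst (λ z → PM z (J ⊖ k₀) (λ i j → E (I ⊕ i₀) J i j × i ≢ i₀)) (⊕⊖ i₀∉I) (pm-delete (pm (∣I⊕∣ i₀∉I)) e₀)

  module Push {I′ : Subset n} {J′ : Subset d} {P : BiRel n d} (p : PM I′ J′ P) (P⊑ : P ⊑ Bas S I J)
    {m : Fin n} (m∈I : m ∈ I) (m∉I′ : m ∉ I′)
    (IH : ∀ {I″ J″ P″} → (∀ {i} → i ∈ I → i ∉ I″ → i ∉ I′ × i ≢ m) → PM I″ J″ P″ →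
          P″ ⊑ Bas S I J → P″ ⊑ E I″ J″) where
    cIJ = pm-card p
    b₁ b₂ : Fin d
    nb₁ = nb-other m∈I (proj₁ (∣∣-nonempty {p = J} c))
    b₁ = proj₁ nb₁
    nb₂ = nb-other m∈I b₁
    b₂ = proj₁ nb₂
    pf = pm-fun p b₁
    f = proj₁ pf
    module F = Bij (proj₁ (proj₂ pf))
    P-f : ∀ {i} → i ∈ I′ → P i (f i)
    P-f = proj₂ (proj₂ pf)
    qf = pm-fun (pm-flip p) m
    q = proj₁ qf
    module Q = Bij (proj₁ (proj₂ qf))
    P-q : ∀ {j} → j ∈ J′ → P (q j) j
    P-q = proj₂ (proj₂ qf)
    fq : ∀ {j} → j ∈ J′ → f (q j) ≡ j
    fq j∈ = PM.func p (P-f (Q.into j∈)) (P-q j∈)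
    o : Fin n → Fin d
    o i with i ∈? I
    ... | yes i∈I = proj₁ (nb-other i∈I (f i))
    ... | no _    = b₁
    o-nb : ∀ {i} → i ∈ I → Nb S I J i (o i) × o i ≢ f i
    o-nb {i} i∈I with i ∈? I
    ... | yes h = proj₂ (nb-other h (f i))
    ... | no h  = contradiction i∈I h
    -- A displaced leaf has no second edge to move to, and a row whose other neighbour is free
    -- displaces nobody; at both the push ends.
    Term : Fin n → Set
    Term i = i ∉ I ⊎ (i ∈ I × o i ∉ J′)
    nxt : Fin n → Fin n
    nxt i = q (o i)
    ¬term : ∀ {i} → ¬ Term i → i ∈ I × o i ∈ J′
    ¬term {i} nt with i ∈? I | o i ∈? J′
    ... | no h  | _     = contradiction (inj₁ h) nt
    ... | yes h | yes g = h , g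
    ... | yes h | no g  = contradiction (inj₂ (h , g)) nt
    term¬ : ∀ {i} → i ∈ I → o i ∈ J′ → ¬ Term i
    term¬ a b (inj₁ x) = x a
    term¬ a b (inj₂ (_ , x)) = x b
    wf : ∀ {K} → K ⊆ I′ → Nonempty K → ∃[ i ] i ∈ K × (Term i ⊎ (¬ Term i × nxt i ∉ K))
    wf {K} K⊆ ne with any? (λ i → (i ∈? K) ×-dec (¬? (i ∈? I)))
    ... | yes (i , i∈K , h) = i , i∈K , inj₁ (inj₁ h)
    ... | no allI with escape f o K⊆I ne (λ {i} i∈K → bas-row (K⊆I i∈K) (P⊑ (P-f (K⊆ i∈K))) , o-nb (K⊆I i∈K))
      where
      K⊆I : ∀ {i} → i ∈ K → i ∈ I
      K⊆I {i} i∈K = case i ∈? I of λ { (yes h) → h ; (no h) → contradiction (i , i∈K , h) allI }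
    ...   | i , i∈K , o∉ = i , i∈K , exits (i ∈? I) (o i ∈? J′)
      where
      exits : Dec (i ∈ I) → Dec (o i ∈ J′) → Term i ⊎ (¬ Term i × nxt i ∉ K)
      exits (no h)  _          = inj₁ (inj₁ h)
      exits (yes h) (no o∉J′)  = inj₁ (inj₂ (h , o∉J′))
      exits (yes h) (yes o∈J′) = inj₂ (term¬ h o∈J′ , λ n∈K → o∉ (subst (_∈ image f K) (fq o∈J′) (image⁺ f K n∈K)))
    vac = vacate I′ Term nxt (λ _ nt → Q.into (proj₂ (¬term nt))) wf
    end = proj₁ vac
    -- The matching `A` gives `b` to `m` and leaves out the row `e` where the push ended. By `keep`,
    -- a row that lost its old edge lies on a walk ending in `e`.
    record Pushed (b : Fin d) : Set₁ where
      field
        e    : Fin n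
        e∈   : e ∈ I′
        te   : Term e
        A    : BiRel n d
        Ab   : A m b
        good : A ⊑ E ((I′ ⊖ e) ⊕ m) J′
        keep : ∀ {i} → i ∈ I′ → i ≢ e → A i (f i) ⊎ (¬ Term i × end i ≡ e)
    push : ∀ b → Nb S I J m b → (P ⊑ E I′ J′) ⊎ Pushed b
    push b nb with b ∈? J′
    -- If `b` is free, `P` together with the edge from `m` to `b` misses one row fewer, and
    -- `closure` returns to `P`.
    ... | no b∉ = inj₁ λ r → closure (pm-card pm+) p (IH new pm+ ⊑+ ∘ inj₂) r
      where
      pm+ = pm-add p m∉I′ b∉
      new : ∀ {i} → i ∈ I → i ∉ I′ ⊕ m → i ∉ I′ × i ≢ m
      new i∈ i∉ = (λ h → i∉ (⊆-⊕ I′ m h)) , λ { refl → i∉ (∈-⊕ I′ m) }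
      ⊑+ : ∀ {i j} → (i ≡ m × j ≡ b) ⊎ P i j → Bas S I J i j
      ⊑+ (inj₁ (refl , refl)) = inj₁ (m∈I , nb)
      ⊑+ (inj₂ r) = P⊑ r
    ... | yes b∈ = inj₂ record { e = e ; e∈ = V.e∈I ; te = V.term ; A = A ; Ab = inj₁ (refl , refl)
                               ; good = good V.term ; keep = keep }
      where
      x = q b
      x∈ = Q.into b∈
      module V = Vacate (proj₂ vac x∈)
      e = end x
      g = V.shift
      module Gb = Bij V.bij
      A : BiRel n d
      A i j = (i ≡ m × j ≡ b) ⊎ (i ∈ I′ ⊖ e × f (g i) ≡ j)
      fg : Bij (I′ ⊖ e) (J′ ⊖ b) (f ∘ g)
      fg = record
        { into = λ h → ∈-⊖ (F.into (⊖-⊆ I′ (Gb.into h))) λ eq → ⊖-≢ I′ (Gb.into h)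
                   (F.inj (⊖-⊆ I′ (Gb.into h)) x∈ (trans eq (sym (fq b∈))))
        ; inj = λ a a′ eq → Gb.inj a a′ (F.inj (⊖-⊆ I′ (Gb.into a)) (⊖-⊆ I′ (Gb.into a′)) eq)
        ; onto = λ h → case F.onto (⊖-⊆ J′ h) of λ (i , i∈ , eq) →
            case Gb.onto (∈-⊖ i∈ λ { refl → ⊖-≢ J′ h (trans (sym eq) (fq b∈)) }) of λ
              (i′ , i′∈ , eq′) → i′ , i′∈ , trans (cong f eq′) eq }
      pmA : PM ((I′ ⊖ e) ⊕ m) J′ A
      pmA = subst (λ z → PM ((I′ ⊖ e) ⊕ m) z A) (⊖⊕ b∈)
        (pm-add (bij-pm fg) (λ h → m∉I′ (⊖-⊆ I′ h)) λ h → ⊖-≢ J′ h refl)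
      A⊑ : A ⊑ Bas S I J
      A⊑ (inj₁ (refl , refl)) = inj₁ (m∈I , nb)
      A⊑ (inj₂ (i∈ , refl)) with V.moves (⊖-⊆ I′ i∈) (⊖-≢ I′ i∈)
      ... | inj₁ eq = subst (λ z → Bas S I J _ (f z)) (sym eq) (P⊑ (P-f (⊖-⊆ I′ i∈)))
      ... | inj₂ (eq , nt , _) with ¬term nt
      ...   | i∈I , o∈ = inj₁ (i∈I , subst (Nb S I J _) (sym (trans (cong f eq) (fq o∈))) (proj₁ (o-nb i∈I)))
      keep : ∀ {i} → i ∈ I′ → i ≢ e → A i (f i) ⊎ (¬ Term i × end i ≡ e)
      keep i∈ i≢ with V.moves i∈ i≢
      ... | inj₁ eq = inj₁ (inj₂ (∈-⊖ i∈ i≢ , cong f eq))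
      ... | inj₂ (_ , nt , eq) = inj₂ (nt , eq)
      -- Leaving out a leaf costs nothing, since only rows of `I` count as missed. A row of `I` is
      -- first put back on its free neighbour `o e`, and `closure` removes it after the induction
      -- hypothesis.
      good : Term e → A ⊑ E ((I′ ⊖ e) ⊕ m) J′
      good (inj₁ e∉I) = IH (λ {i} i∈I i∉ → (λ h → i∉ (⊆-⊕ _ m (∈-⊖ h λ { refl → e∉I i∈I })))
                             , λ { refl → i∉ (∈-⊕ _ m) }) pmA A⊑
      good (inj₂ (e∈I , o∉)) r = closure (pm-card pm+) pmA (IH new pm+ ⊑+ ∘ inj₂) r
        where
        e∉ : e ∉ (I′ ⊖ e) ⊕ m
        e∉ h = case ⊕-inv (I′ ⊖ e) m h of λ
          { (inj₁ e≡m) → m∉I′ (subst (_∈ I′) e≡m V.e∈I) ; (inj₂ h′) → ⊖-≢ I′ h′ refl }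
        pm+ = pm-add pmA e∉ o∉
        new : ∀ {i} → i ∈ I → i ∉ ((I′ ⊖ e) ⊕ m) ⊕ e → i ∉ I′ × i ≢ m
        new {i} i∈ i∉ = (λ h → case i ≟ᶠ e of λ
            { (yes i≡e) → i∉ (subst (_∈ ((I′ ⊖ e) ⊕ m) ⊕ e) (sym i≡e) (∈-⊕ _ e))
            ; (no i≢e) → i∉ (⊆-⊕ _ e (⊆-⊕ _ m (∈-⊖ h i≢e))) })
          , λ { refl → i∉ (⊆-⊕ _ e (∈-⊕ _ m)) }
        ⊑+ : ∀ {i j} → (i ≡ e × j ≡ o e) ⊎ A i j → Bas S I J i j
        ⊑+ (inj₁ (refl , refl)) = inj₁ (e∈I , proj₁ (o-nb e∈I))
        ⊑+ (inj₂ r) = A⊑ r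
    X = I′ ⊕ m
    X⊖ : ∀ {e} → e ∈ I′ → (I′ ⊖ e) ⊕ m ≡ X ⊖ e
    X⊖ {e} e∈ = ⊆-antisym
      (λ h → case ⊕-inv _ m h of λ
        { (inj₁ refl) → ∈-⊖ (∈-⊕ I′ m) λ { refl → m∉I′ e∈ }
        ; (inj₂ h′) → ∈-⊖ (⊆-⊕ I′ m (⊖-⊆ I′ h′)) (⊖-≢ I′ h′) })
      (λ h → case ⊕-inv I′ m (⊖-⊆ X h) of λ
        { (inj₁ refl) → ∈-⊕ _ m
        ; (inj₂ h′) → ⊆-⊕ _ m (∈-⊖ h′ (⊖-≢ X h)) })
    -- The two pushes end in different rows, for otherwise one matching of the ensemble would give
    -- `m` two partners. A displaced row walks to a single end, so no edge of `P` is lost in both,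
    -- and all of `P` lies in the left linkage tree on `X`, where matchings are unique.
    combine : Pushed b₁ → Pushed b₂ → P ⊑ E I′ J′
    combine A₁ A₂ with Pushed.e A₁ ≟ᶠ Pushed.e A₂
    ... | yes e≡ = ⊥-elim (proj₂ (proj₂ nb₂) (sym (PM.func (pm cX)
              (A.good A.Ab) (subst (λ z → E ((I′ ⊖ z) ⊕ m) J′ m b₂) (sym e≡) (B.good B.Ab)))))
      where
      module A = Pushed A₁
      module B = Pushed A₂
      cX : ∣ (I′ ⊖ A.e) ⊕ m ∣ ≡ ∣ J′ ∣
      cX = trans (∣⊕∣ λ h → m∉I′ (⊖-⊆ I′ h)) (trans (sym (∣⊖∣ A.e∈)) cIJ)
    ... | no e≢ = λ r → Linkage.unique-pm (S ᵀ) {J′} {X} (trans (∣⊕∣ m∉I′) (cong suc cIJ))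
            (pm-flip p) (pm-flip (pm cIJ)) id P⊑L (λ s → m , ∈-⊕ I′ m , subst (λ z → E z J′ _ _) (sym (⊕⊖ m∉I′)) s) r
      where
      module A = Pushed A₁
      module B = Pushed A₂
      inA : ∀ {i j} → A.A i j → Nb (S ᵀ) J′ X j i
      inA r = A.e , ⊆-⊕ I′ m A.e∈ , subst (λ z → E z J′ _ _) (X⊖ A.e∈) (A.good r)
      inB : ∀ {i j} → B.A i j → Nb (S ᵀ) J′ X j i
      inB r = B.e , ⊆-⊕ I′ m B.e∈ , subst (λ z → E z J′ _ _) (X⊖ B.e∈) (B.good r)
      P⊑L : flip′ P ⊑ Nb (S ᵀ) J′ X
      P⊑L {j} {i} r with PM.func p r (P-f (PM.domˡ p r))
      ... | refl with i ≟ᶠ A.e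
      ...   | yes refl = case B.keep A.e∈ e≢ of λ
                { (inj₁ s) → inB s ; (inj₂ (nt , _)) → contradiction A.te nt }
      ...   | no i≢ with A.keep (PM.domˡ p r) i≢ | i ≟ᶠ B.e
      ...     | inj₁ s | _ = inA s
      ...     | inj₂ (nt , _) | yes refl = contradiction B.te nt
      ...     | inj₂ (_ , e₁) | no i≢B with B.keep (PM.domˡ p r) i≢B
      ...       | inj₁ s = inB s
      ...       | inj₂ (_ , e₂) = contradiction (trans (sym e₁) e₂) e≢
    result : P ⊑ E I′ J′
    result with push b₁ (proj₁ (proj₂ nb₁))
    ... | inj₁ done = done
    ... | inj₂ A₁ with push b₂ (proj₁ (proj₂ nb₂))
    ...   | inj₁ done = done
    ...   | inj₂ A₂ = combine A₁ A₂

  -- Induction on the number of left vertices m of the tree missed by the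
  -- matching P.  Matching m to either of its two neighbours and pushing the
  -- occupant along gives two matchings which miss less and cover P; P is
  -- then the member of the left linkage tree on I′ + m that misses m.
  comp-bas : Comp S (Bas S I J)
  comp-bas p P⊑ = go ∣ I ∣ I (λ i∈I _ → i∈I) ℕ.≤-refl p P⊑
    where
    go : ∀ k D {I′ J′ P} → (∀ {i} → i ∈ I → i ∉ I′ → i ∈ D) → ∣ D ∣ ≤ k →
         PM I′ J′ P → P ⊑ Bas S I J → P ⊑ E I′ J′
    go k D {I′} {J′} {P} cov le p P⊑ with any? (λ m → (m ∈? I) ×-dec ¬? (m ∈? I′))
    ... | no none = saturated p P⊑ λ {i} i∈I → case i ∈? I′ of λ
                      { (yes h) → h ; (no h) → contradiction (i , i∈I , h) none }
    go zero D cov le p P⊑ | yes (m , m∈I , m∉I′) =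
      contradiction (ℕ.≤-trans (ℕ.≤-reflexive (sym (∣⊖∣ (cov m∈I m∉I′)))) le) λ ()
    go (suc k) D {I′} {J′} {P} cov le p P⊑ | yes (m , m∈I , m∉I′) =
      Push.result p P⊑ m∈I m∉I′ λ h → go k (D ⊖ m)
        (λ i∈I i∉ → case h i∈I i∉ of λ (a , b) → ∈-⊖ (cov i∈I a) b)
        (s≤s⁻¹ (ℕ.≤-trans (ℕ.≤-reflexive (sym (∣⊖∣ (cov m∈I m∉I′)))) le))

-- The two-colour theorem

-- A left vertex of mode eq must see both colours, one of mode ge the
-- colour true; a right vertex may be used if its mode is not none, and its
-- colours may be exchanged if its mode is eq.
data Mode : Set where
  none ge eq : Mode

_≟ᵐ_ : (a b : Mode) → Dec (a ≡ b)
none ≟ᵐ none = yes refl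
none ≟ᵐ ge   = no λ ()
none ≟ᵐ eq   = no λ ()
ge   ≟ᵐ none = no λ ()
ge   ≟ᵐ ge   = yes refl
ge   ≟ᵐ eq   = no λ ()
eq   ≟ᵐ none = no λ ()
eq   ≟ᵐ ge   = no λ ()
eq   ≟ᵐ eq   = yes refl

Colouring : ℕ → ℕ → Set
Colouring n d = Fin n → Fin d → Bool

co : Colouring n d → Colouring d n
co A j i = not (A i j)

-- This imitates the sign pattern of a nonzero solution of a linear system over a valued field. Rows
-- are constraints of the kind `ρ`; columns are variables that vanish, are nonnegative or are free
-- according to `κ`; `ε` marks the negative variables; tree edges mark the dominant terms of a row.
record Sol (S : Sys n d) (A : Colouring n d) (ρ : Fin n → Mode) (κ : Fin d → Mode) : Set where
  field
    ε    : Fin d → Bool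
    ε-eq : ∀ {j} → ε j ≡ true → κ j ≡ eq
    I    : Subset n
    J    : Subset d
    card : ∣ J ∣ ≡ suc ∣ I ∣
    used : ∀ {j} → j ∈ J → κ j ≢ none
  Sees : Bool → Fin n → Set
  Sees b i = ∃[ j ] Bas S I J i j × (A i j xor ε j) ≡ b
  field
    row-ge : ∀ {i} → ρ i ≡ ge → Sees true i
    row-eq : ∀ {i} → ρ i ≡ eq → ∀ b → Sees b i

  bas? : ∀ i j → Dec (Bas S I J i j)
  bas? i j with i ∈? I
  ... | yes i∈I = map′ (λ nb → inj₁ (i∈I , nb)) (bas-row S {I} {J} card i∈I) (Linkage.nb? S {I} {J} card i j)
  ... | no i∉I = map′ (λ e → inj₂ (i∉I , e))
      (λ { (inj₁ (i∈I , _)) → contradiction i∈I i∉I ; (inj₂ (_ , e)) → e })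
      (pm-dec (Sys.pm S (∣I⊕∣ S {I} {J} card i∉I)) i j)

  sees? : ∀ b i → Dec (Sees b i)
  sees? b i = any? λ j → bas? i j ×-dec ((A i j xor ε j) ≟ᵇ b)

  pick : (Fin n → Bool) → Fin n → Fin d
  pick w i with sees? (w i) i
  ... | yes (j , _) = j
  ... | no _        = proj₁ (bas-tot S {I} {J} card i)

  pick-bas : ∀ w i → Bas S I J i (pick w i)
  pick-bas w i with sees? (w i) i
  ... | yes (j , b , _) = b
  ... | no _            = proj₂ (bas-tot S {I} {J} card i)

  pick-col : ∀ w {i} → Sees (w i) i → (A i (pick w i) xor ε (pick w i)) ≡ w i
  pick-col w {i} s with sees? (w i) i
  ... | yes (j , _ , q) = q
  ... | no ¬s           = contradiction s ¬s

-- The other alternative in Farkas' lemma: a solution of the transposed system with negated signs,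
-- in which constraints and variables have exchanged roles.
Cert : Sys n d → Colouring n d → (Fin n → Mode) → (Fin d → Mode) → Set
Cert S A ρ κ = Sol (S ᵀ) (co A) κ ρ

private
  bool-clash : ∀ a e δ → (a xor e) ≡ not δ → (not a xor δ) ≡ not e → Empty
  bool-clash false false false ()
  bool-clash false false true p ()
  bool-clash false true false p ()
  bool-clash false true true ()
  bool-clash true false false p ()
  bool-clash true false true ()
  bool-clash true true false ()
  bool-clash true true true p ()

  ≢true : ∀ {b} → b ≢ true → b ≡ false
  ≢true {false} _ = refl
  ≢true {true}  h = contradiction refl h

-- With both exchanges applied, the edges picked in `W` have colour true and those picked in `V`
-- colour false, so alternating between them never returns along the same edge. Only rows used by
-- `V` matter, hence `W` may violate constraints elsewhere.
sol-cert-clash : (S : Sys n d) (A : Colouring n d) {ρ ρ′ : Fin n → Mode} {κ : Fin d → Mode}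
  (W : Sol S A ρ κ) (V : Cert S A ρ′ κ) →
  (∀ {i} → i ∈ Sol.J V → Sol.Sees W (not (Sol.ε V i)) i) → Empty
sol-cert-clash S A {κ = κ} W V h = no-alternation S (comp-bas S {W.I} {W.J} W.card) (flip-comp S (comp-bas (S ᵀ) {V.I} {V.J} V.card))
    σ τ W.J (∣∣-nonempty {p = W.J} W.card) λ {k} k∈ → V.pick-bas _ k , W.pick-bas _ _ , bas-domʳ S {W.I} {W.J} W.card (W.pick-bas _ _) , clash k∈
  where
  module W = Sol W
  module V = Sol V
  σ = W.pick (not ∘ V.ε)
  τ = V.pick (not ∘ W.ε)
  col-sees : ∀ {k} → k ∈ W.J → V.Sees (not (W.ε k)) k
  col-sees {k} k∈ with κ k in e
  ... | none = contradiction e (W.used k∈)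
  ... | eq   = V.row-eq e _
  ... | ge   = subst (λ b → V.Sees (not b) k) (sym (≢true λ t → case trans (sym e) (W.ε-eq t) of λ ())) (V.row-ge e)
  clash : ∀ {k} → k ∈ W.J → σ (τ k) ≢ k
  clash {k} k∈ q = bool-clash (A (τ k) k) (W.ε k) (V.ε (τ k))
    (subst (λ z → (A (τ k) z xor W.ε z) ≡ not (V.ε (τ k))) q
      (W.pick-col (not ∘ V.ε) (h (bas-domʳ (S ᵀ) {V.I} {V.J} V.card (V.pick-bas _ k)))))
    (V.pick-col (not ∘ W.ε) (col-sees k∈))

-- A ge constraint follows from its two relatives: drop it, and if the
-- solution violates it, tighten it to eq; a certificate that exploits the
-- tightening clashes with the violating solution.
row-step : (S : Sys n d) (A : Colouring n d) (ρ : Fin n → Mode) (κ : Fin d → Mode) (r : Fin n) → ρ r ≡ ge →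
  Sol S A (update ρ r none) κ ⊎ Cert S A (update ρ r none) κ →
  Sol S A (update ρ r eq) κ ⊎ Cert S A (update ρ r eq) κ →
  Sol S A ρ κ ⊎ Cert S A ρ κ
row-step S A ρ κ r ρr (inj₂ V) _ = inj₂ record
    { ε = V.ε ; ε-eq = λ {i} h → weak (V.ε-eq h) ; I = V.I ; J = V.J ; card = V.card
    ; used = λ {i} i∈ e → V.used i∈ (weak′ e) ; row-ge = V.row-ge ; row-eq = V.row-eq }
  where
  module V = Sol V
  weak : ∀ {i} → update ρ r none i ≡ eq → ρ i ≡ eq
  weak {i} e with i ≟ᶠ r
  ... | no _ = e
  weak′ : ∀ {i} → ρ i ≡ none → update ρ r none i ≡ none
  weak′ {i} e with i ≟ᶠ r
  ... | yes _ = refl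
  ... | no _  = e
row-step S A ρ κ r ρr (inj₁ W) X with Sol.sees? W true r
row-step S A ρ κ r ρr (inj₁ W) X | yes s = inj₁ record
    { ε = W.ε ; ε-eq = W.ε-eq ; I = W.I ; J = W.J ; card = W.card ; used = W.used
    ; row-ge = λ {i} e → rg i e
    ; row-eq = λ {i} e → W.row-eq (re i e) }
  where
  module W = Sol W
  rg : ∀ i → ρ i ≡ ge → W.Sees true i
  rg i e with i ≟ᶠ r
  ... | yes refl = s
  ... | no i≢r   = W.row-ge (trans (update-≢ ρ i≢r) e)
  re : ∀ i → ρ i ≡ eq → update ρ r none i ≡ eq
  re i e with i ≟ᶠ r
  ... | yes refl = case trans (sym e) ρr of λ ()
  ... | no _     = e
row-step S A ρ κ r ρr (inj₁ W) (inj₁ X) | no ¬s = inj₁ record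
    { ε = X.ε ; ε-eq = X.ε-eq ; I = X.I ; J = X.J ; card = X.card ; used = X.used
    ; row-ge = λ {i} e → rg i e
    ; row-eq = λ {i} e → X.row-eq (re i e) }
  where
  module X = Sol X
  rg : ∀ i → ρ i ≡ ge → X.Sees true i
  rg i e with i ≟ᶠ r
  ... | yes refl = X.row-eq (update-≡ ρ r eq) true
  ... | no i≢r   = X.row-ge (trans (update-≢ ρ i≢r) e)
  re : ∀ i → ρ i ≡ eq → update ρ r eq i ≡ eq
  re i e with i ≟ᶠ r
  ... | yes refl = refl
  ... | no _     = e
row-step S A ρ κ r ρr (inj₁ W) (inj₂ V) | no ¬s with Sol.ε V r in δr
-- Without an exchange at `r`, the certificate is valid for the mode `ge` as well.
... | false = inj₂ record
    { ε = V.ε ; ε-eq = λ {i} h → weak i h ; I = V.I ; J = V.J ; card = V.card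
    ; used = λ {i} i∈ e → V.used i∈ (weak′ i e) ; row-ge = V.row-ge ; row-eq = V.row-eq }
  where
  module V = Sol V
  weak : ∀ i → V.ε i ≡ true → ρ i ≡ eq
  weak i h with i ≟ᶠ r
  ... | yes refl = case trans (sym h) δr of λ ()
  ... | no i≢r   = trans (sym (update-≢ ρ i≢r)) (V.ε-eq h)
  weak′ : ∀ i → ρ i ≡ none → update ρ r eq i ≡ none
  weak′ i e with i ≟ᶠ r
  ... | yes refl = case trans (sym e) ρr of λ ()
  ... | no _     = e
-- As `W` violates the constraint, every colour it sees at `r` is false, which is just what the
-- clash requires at an exchanged row.
... | true = ⊥-elim (sol-cert-clash S A W V sees)
  where
  module W = Sol W
  module V = Sol V
  sees : ∀ {i} → i ∈ V.J → W.Sees (not (V.ε i)) i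
  sees {i} i∈ = sees′ (i ≟ᶠ r)
    where
    sees′ : Dec (i ≡ r) → W.Sees (not (V.ε i)) i
    sees′ (yes refl) = subst (λ b → W.Sees (not b) r) (sym δr)
      (case bas-tot S {W.I} {W.J} W.card r of λ (j , b) → j , b , ≢true λ t → ¬s (j , b , t))
    sees′ (no i≢r) with ρ i in e
    ... | none = contradiction (trans (update-≢ ρ i≢r) e) (V.used i∈)
    ... | eq   = W.row-eq (trans (update-≢ ρ i≢r) e) _
    ... | ge   = subst (λ b → W.Sees (not b) i)
                   (sym (≢true λ t → case trans (sym e) (trans (sym (update-≢ ρ i≢r)) (V.ε-eq t)) of λ ()))
                   (W.row-ge (trans (update-≢ ρ i≢r) e))

private
  xor-solve : ∀ a y → (a xor (a xor y)) ≡ y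
  xor-solve false y = refl
  xor-solve true false = refl
  xor-solve true true = refl

  two-values : ∀ {x y : Bool} → x ≡ not y → ∀ b → x ≡ b ⊎ y ≡ b
  two-values {x} {false} refl false = inj₂ refl
  two-values {x} {false} refl true  = inj₁ refl
  two-values {x} {true}  refl false = inj₁ refl
  two-values {x} {true}  refl true  = inj₂ refl

-- The exchange at f i is determined by the one at o i, starting from the root x₀.
recolour : (S : Sys n d) {I : Subset n} {J : Subset d} → ∣ J ∣ ≡ suc ∣ I ∣ → (A : Colouring n d) →
  ∀ {x₀} → x₀ ∈ J → ∀ b → ∃[ ε ] ε x₀ ≡ b × (∀ j → ε j ≡ true → j ∈ J) ×
  (∀ i → i ∈ I → ∀ b′ → ∃[ j ] Nb S I J i j × (A i j xor ε j) ≡ b′)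
recolour {n} {d} S {I} {J} c A {x₀} x₀∈J b = proj₁ peeled , proj₁ (proj₂ peeled) , proj₁ (proj₂ (proj₂ peeled)) ,
    λ i i∈I b′ → case two-values (proj₁ (proj₂ (proj₂ (proj₂ peeled)) i i∈I)) b′ of λ
      { (inj₁ q) → f i , f-nb i∈I , q ; (inj₂ q) → o i , proj₁ (o-nb i∈I) , q }
  where
  open Linkage S {I} {J} c
  pf = pm-fun (pm⊖ x₀∈J) x₀
  f = proj₁ pf
  module F = Bij (proj₁ (proj₂ pf))
  f-nb : ∀ {i} → i ∈ I → Nb S I J i (f i)
  f-nb i∈I = x₀ , x₀∈J , proj₂ (proj₂ pf) i∈I
  f-J : ∀ {i} → i ∈ I → f i ∈ J
  f-J i∈I = ⊖-⊆ J (F.into i∈I)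
  o′ : ∀ i → Dec (i ∈ I) → Fin d
  o′ i (yes i∈I) = proj₁ (nb-other i∈I (f i))
  o′ i (no _)    = x₀
  o : Fin n → Fin d
  o i = o′ i (i ∈? I)
  o-nb′ : ∀ {i} (D : Dec (i ∈ I)) → i ∈ I → Nb S I J i (o′ i D) × o′ i D ≢ f i
  o-nb′ {i} (yes h) _  = proj₂ (nb-other h (f i))
  o-nb′ (no h) i∈I = contradiction i∈I h
  o-nb : ∀ {i} → i ∈ I → Nb S I J i (o i) × o i ≢ f i
  o-nb {i} = o-nb′ (i ∈? I)
  o-J : ∀ {i} → i ∈ I → o i ≢ x₀ → o i ∈ J ⊖ x₀
  o-J i∈I ne = ∈-⊖ (nb-domʳ (proj₁ (o-nb i∈I))) ne
  nxt : Fin n → Fin n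
  nxt i with o i ∈? (J ⊖ x₀)
  ... | yes h = proj₁ (F.onto h)
  ... | no _  = i
  nxt-f : ∀ i → o i ∈ J ⊖ x₀ → nxt i ∈ I × f (nxt i) ≡ o i
  nxt-f i h with o i ∈? (J ⊖ x₀)
  ... | yes h′ = proj₂ (F.onto h′)
  ... | no h′  = contradiction h h′
  Term : Fin n → Set
  Term i = o i ≡ x₀
  wf : ∀ {K} → K ⊆ I → Nonempty K → ∃[ i ] i ∈ K × (Term i ⊎ (¬ Term i × nxt i ∉ K))
  wf {K} K⊆I ne with escape f o K⊆I ne (λ i∈K → f-nb (K⊆I i∈K) , o-nb (K⊆I i∈K))
  ... | i , i∈K , o∉ with o i ≟ᶠ x₀
  ...   | yes e = i , i∈K , inj₁ e
  ...   | no ¬e = i , i∈K , inj₂ (¬e , λ n∈ → o∉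
            (subst (_∈ image f K) (proj₂ (nxt-f i (o-J (K⊆I i∈K) ¬e))) (image⁺ f K n∈)))
  -- The last component keeps `o i` among the columns already settled, so that later changes, which
  -- occur at new columns `f i`, do not disturb row `i`.
  Motive : Subset n → Set
  Motive G = Σ[ ε ∈ (Fin d → Bool) ] ε x₀ ≡ b × (∀ j → ε j ≡ true → j ∈ J) ×
    (∀ i → i ∈ G → (A i (f i) xor ε (f i)) ≡ not (A i (o i) xor ε (o i)) × (o i ≡ x₀ ⊎ ∃[ k ] k ∈ G × f k ≡ o i))
  base : Motive ∅
  base = update (λ _ → false) x₀ b , update-≡ (λ _ → false) x₀ b , inJ , λ i i∈ → contradiction i∈ ∉⊥
    where
    inJ : ∀ j → update (λ _ → false) x₀ b j ≡ true → j ∈ J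
    inJ j e with j ≟ᶠ x₀
    ... | yes refl = x₀∈J
    inJ j () | no _
  step : ∀ {i G} → G ⊆ I → i ∈ I → i ∉ G → Term i ⊎ (¬ Term i × nxt i ∈ G) → Motive G → Motive (G ⊕ i)
  step {i} {G} G⊆I i∈I i∉G t (ε , εx₀ , εJ , h) = ε′ , trans (update-≢ ε (≢-sym (⊖-≢ J (F.into i∈I)))) εx₀ , inJ , good
    where
    -- The value that makes the two colours at row `i` opposite.
    v = A i (f i) xor not (A i (o i) xor ε (o i))
    ε′ = update ε (f i) v
    inJ : ∀ j → ε′ j ≡ true → j ∈ J
    inJ j e with j ≟ᶠ f i
    ... | yes refl = f-J i∈I
    ... | no _     = εJ j e
    stable : ∀ {j} → j ≢ f i → ε′ j ≡ ε j
    stable = update-≢ ε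
    good : ∀ k → k ∈ G ⊕ i → (A k (f k) xor ε′ (f k)) ≡ not (A k (o k) xor ε′ (o k)) × (o k ≡ x₀ ⊎ ∃[ l ] l ∈ G ⊕ i × f l ≡ o k)
    good k k∈ with ⊕-inv G i k∈
    ... | inj₁ refl = trans (trans (cong (A i (f i) xor_) (update-≡ ε (f i) v)) (xor-solve (A i (f i)) _))
                        (cong (λ z → not (A i (o i) xor z)) (sym (stable (proj₂ (o-nb i∈I)))))
                    , (case t of λ { (inj₁ e) → inj₁ e
                       ; (inj₂ (ne , n∈)) → inj₂ (nxt i , ⊆-⊕ G i n∈ , proj₂ (nxt-f i (o-J i∈I ne))) })
    ... | inj₂ k∈G with h k k∈G
    ...   | q , r = trans (cong (A k (f k) xor_) (stable fk≢)) (trans q (cong (λ z → not (A k (o k) xor z)) (sym (stable ok≢))))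
                  , (case r of λ { (inj₁ e) → inj₁ e ; (inj₂ (l , l∈ , e)) → inj₂ (l , ⊆-⊕ G i l∈ , e) })
      where
      f≢ : ∀ {l} → l ∈ G → f l ≢ f i
      f≢ l∈ e = i∉G (subst (_∈ G) (F.inj (G⊆I l∈) i∈I e) l∈)
      fk≢ = f≢ k∈G
      ok≢ : o k ≢ f i
      ok≢ e = case r of λ { (inj₁ e′) → ⊖-≢ J (F.into i∈I) (trans (sym e) e′)
                          ; (inj₂ (l , l∈ , e′)) → f≢ l∈ (trans e′ e) }
  peeled : Motive I
  peeled = peel I Term nxt (λ {i} i∈I ne → proj₁ (nxt-f i (o-J i∈I ne))) wf Motive base step

-- The numbers of eq constraints on the two sides decide.
terminal : (S : Sys n d) (A : Colouring n d) (ρ : Fin n → Mode) (κ : Fin d → Mode) (g : Fin d) → κ g ≡ ge →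
  (∀ j → κ j ≡ ge → j ≡ g) → (∀ i → ρ i ≢ ge) → Sol S A ρ κ ⊎ Cert S A ρ κ
terminal {n} {d} S A ρ κ g κg onlyg noge = decide (ℕ.≤-<-connex ∣ Iq ∣ ∣ Tq ∣)
  where
  eqρ? = λ i → ρ i ≟ᵐ eq
  eqκ? = λ j → κ j ≟ᵐ eq
  Iq = subset eqρ?
  Tq = subset eqκ?
  solution : ∀ {T₀} → T₀ ⊆ Tq → ∣ T₀ ∣ ≡ ∣ Iq ∣ → Sol S A ρ κ
  solution {T₀} T₀⊆ e = record
    { ε = proj₁ rec ; ε-eq = λ {j} → εeq j ; I = Iq ; J = T₀ ⊕ g ; card = c
    ; used = λ j∈ e′ → case ⊕-inv T₀ g j∈ of λ
        { (inj₁ refl) → case trans (sym κg) e′ of λ ()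
        ; (inj₂ h) → case trans (sym (inT h)) e′ of λ () }
    ; row-ge = λ {i} h → contradiction h (noge i)
    ; row-eq = λ {i} h b → let i∈ = subset⁺ eqρ? h in
        case proj₂ (proj₂ (proj₂ rec)) i i∈ b of λ (j , nb , q) → j , inj₁ (i∈ , nb) , q }
    where
    inT : ∀ {j} → j ∈ T₀ → κ j ≡ eq
    inT h = subset⁻ eqκ? (T₀⊆ h)
    c : ∣ T₀ ⊕ g ∣ ≡ suc ∣ Iq ∣
    c = trans (∣⊕∣ λ h → case trans (sym κg) (inT h) of λ ()) (cong suc e)
    -- A column of mode `ge` must not be exchanged, so `g` is made the root, with value false.
    rec = recolour S {Iq} {T₀ ⊕ g} c A (∈-⊕ T₀ g) false
    εeq : ∀ j → proj₁ rec j ≡ true → κ j ≡ eq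
    εeq j h with ⊕-inv T₀ g (proj₁ (proj₂ (proj₂ rec)) j h)
    ... | inj₁ refl = case trans (sym h) (proj₁ (proj₂ rec)) of λ ()
    ... | inj₂ h′   = inT h′
  certificate : ∀ {K₀} → K₀ ⊆ Iq → ∣ K₀ ∣ ≡ suc ∣ Tq ∣ → Cert S A ρ κ
  certificate {K₀} K₀⊆ e = record
    { ε = proj₁ rec ; ε-eq = λ {i} h → subset⁻ eqρ? (K₀⊆ (proj₁ (proj₂ (proj₂ rec)) i h))
    ; I = Tq ; J = K₀ ; card = e
    ; used = λ i∈ e′ → case trans (sym (subset⁻ eqρ? (K₀⊆ i∈))) e′ of λ ()
    ; row-ge = λ {j} h → case onlyg j h of λ { refl → r₀ , proj₂ bg , rooted (A r₀ g) (proj₁ (proj₂ rec)) }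
    ; row-eq = λ {j} h b → let j∈ = subset⁺ eqκ? h in
        case proj₂ (proj₂ (proj₂ rec)) j j∈ b of λ (i , nb , q) → i , inj₁ (j∈ , nb) , q }
    where
    bg = bas-tot (S ᵀ) {Tq} {K₀} e g
    r₀ = proj₁ bg
    -- The root is a neighbour `r₀` of `g`, and its value is chosen so that `g` sees the colour true
    -- there.
    rec = recolour (S ᵀ) {Tq} {K₀} e (co A) (bas-domʳ (S ᵀ) {Tq} {K₀} e (proj₂ bg)) (A r₀ g)
    rooted : ∀ a {x} → x ≡ a → (not a xor x) ≡ true
    rooted true  refl = refl
    rooted false refl = refl
  decide : _ → Sol S A ρ κ ⊎ Cert S A ρ κ
  decide (inj₁ le) = case sized-subset Tq ∣ Iq ∣ le of λ (_ , T₀⊆ , e) → inj₁ (solution (λ {x} → T₀⊆ {x}) e)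
  decide (inj₂ lt) = case sized-subset Iq (suc ∣ Tq ∣) lt of λ (_ , K₀⊆ , e) → inj₂ (certificate (λ {x} → K₀⊆ {x}) e)

private
  not-not-xor : ∀ a e → (not (not a) xor e) ≡ (a xor e)
  not-not-xor false e = refl
  not-not-xor true  e = refl

sol-ᵀᵀ : (S : Sys n d) (A : Colouring n d) {ρ : Fin n → Mode} {κ : Fin d → Mode} →
         Sol (S ᵀ ᵀ) (co (co A)) ρ κ → Sol S A ρ κ
sol-ᵀᵀ S A W = record
  { ε = W.ε ; ε-eq = W.ε-eq ; I = W.I ; J = W.J ; card = W.card ; used = W.used
  ; row-ge = λ h → case W.row-ge h of λ (j , b , q) → j , b , trans (sym (not-not-xor (A _ j) _)) q
  ; row-eq = λ h v → case W.row-eq h v of λ (j , b , q) → j , b , trans (sym (not-not-xor (A _ j) _)) q }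
  where module W = Sol W

sol-ᵀᵀ⁻ : (S : Sys n d) (A : Colouring n d) {ρ : Fin n → Mode} {κ : Fin d → Mode} →
          Sol S A ρ κ → Sol (S ᵀ ᵀ) (co (co A)) ρ κ
sol-ᵀᵀ⁻ S A W = record
  { ε = W.ε ; ε-eq = W.ε-eq ; I = W.I ; J = W.J ; card = W.card ; used = W.used
  ; row-ge = λ h → case W.row-ge h of λ (j , b , q) → j , b , trans (not-not-xor (A _ j) _) q
  ; row-eq = λ h v → case W.row-eq h v of λ (j , b , q) → j , b , trans (not-not-xor (A _ j) _) q }
  where module W = Sol W

-- The lists contain the vertices that may still have mode `ge`; `row-step` removes them one by one,
-- on the right side through the transpose. The vertex `g` keeps its mode to the end, because a
-- solution needs one right vertex more than it has left ones.
two-colour-modes : (S : Sys n d) (A : Colouring n d) (g : Fin d) (ls : List (Fin n)) (ks : List (Fin d))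
  (ρ : Fin n → Mode) (κ : Fin d → Mode) → κ g ≡ ge →
  (∀ i → ρ i ≡ ge → i ∈ᴸ ls) → (∀ j → κ j ≡ ge → j ≡ g ⊎ j ∈ᴸ ks) → Sol S A ρ κ ⊎ Cert S A ρ κ
two-colour-modes S A g (r ∷ᴸ ls) ks ρ κ κg hρ hκ with ρ r ≟ᵐ ge
... | yes ρr = row-step S A ρ κ r ρr (rest none λ ()) (rest eq λ ())
  where
  rest : ∀ m → m ≢ ge → Sol S A (update ρ r m) κ ⊎ Cert S A (update ρ r m) κ
  rest m m≢ = two-colour-modes S A g ls ks (update ρ r m) κ κg hρ′ hκ
    where
    hρ′ : ∀ i → update ρ r m i ≡ ge → i ∈ᴸ ls
    hρ′ i h with i ≟ᶠ r
    ... | yes _ = contradiction h m≢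
    ... | no i≢r with hρ i h
    ...   | hereᴸ e = contradiction e i≢r
    ...   | thereᴸ q = q
... | no ρr = two-colour-modes S A g ls ks ρ κ κg
    (λ i h → case hρ i h of λ { (hereᴸ refl) → contradiction h ρr ; (thereᴸ q) → q }) hκ
two-colour-modes S A g []ᴸ (r ∷ᴸ ks) ρ κ κg hρ hκ with κ r ≟ᵐ ge | r ≟ᶠ g
... | yes κr | no r≢g = [ inj₂ , inj₁ ∘ sol-ᵀᵀ S A ]′ (row-step (S ᵀ) (co A) κ ρ r κr (rest none λ ()) (rest eq λ ()))
  where
  rest : ∀ m → m ≢ ge → Sol (S ᵀ) (co A) (update κ r m) ρ ⊎ Cert (S ᵀ) (co A) (update κ r m) ρ
  rest m m≢ = [ inj₂ ∘ sol-ᵀᵀ⁻ S A , inj₁ ]′ (two-colour-modes S A g []ᴸ ks ρ (update κ r m) (trans (update-≢ κ (≢-sym r≢g)) κg) hρ hκ′)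
    where
    hκ′ : ∀ i → update κ r m i ≡ ge → i ≡ g ⊎ i ∈ᴸ ks
    hκ′ i h with i ≟ᶠ r
    ... | yes _ = contradiction h m≢
    ... | no i≢r with hκ i h
    ...   | inj₁ e = inj₁ e
    ...   | inj₂ (hereᴸ e) = contradiction e i≢r
    ...   | inj₂ (thereᴸ q) = inj₂ q
... | no κr | _ = two-colour-modes S A g []ᴸ ks ρ κ κg hρ
    (λ i h → case hκ i h of λ { (inj₁ e) → inj₁ e ; (inj₂ (hereᴸ refl)) → contradiction h κr ; (inj₂ (thereᴸ q)) → inj₂ q })
... | yes _ | yes refl = two-colour-modes S A g []ᴸ ks ρ κ κg hρ
    (λ i h → case hκ i h of λ { (inj₁ e) → inj₁ e ; (inj₂ (hereᴸ e)) → inj₁ e ; (inj₂ (thereᴸ q)) → inj₂ q })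
two-colour-modes S A g []ᴸ []ᴸ ρ κ κg hρ hκ = terminal S A ρ κ g κg
  (λ j h → case hκ j h of λ { (inj₁ e) → e ; (inj₂ ()) }) (λ i h → case hρ i h of λ ())

two-colour : (S : Sys n d) (A : Colouring n d) → Fin d →
  (∃[ I ] ∃[ J ] ∣ J ∣ ≡ suc ∣ I ∣ × (∀ i → ∃[ j ] Bas S I J i j × A i j ≡ true)) ⊎
  (∃[ I ] ∃[ J ] ∣ I ∣ ≡ suc ∣ J ∣ × (∀ j → ∃[ i ] Bas (S ᵀ) J I j i × A i j ≡ false))
two-colour {n} {d} S A g
  with two-colour-modes S A g (allFin n) (allFin d) (λ _ → ge) (λ _ → ge) refl (λ i _ → ∈-allFin i) (λ j _ → inj₂ (∈-allFin j))
... | inj₁ W = inj₁ (Sol.I W , Sol.J W , Sol.card W , λ i → case Sol.row-ge W {i} refl of λ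
        (j , b , q) → j , b , unflip (A i j) (λ t → case Sol.ε-eq W t of λ ()) q)
  where
  unflip : ∀ a {e} → e ≢ true → (a xor e) ≡ true → a ≡ true
  unflip true  _ _ = refl
  unflip false h q = contradiction q h
... | inj₂ V = inj₂ (Sol.J V , Sol.I V , Sol.card V , λ j → case Sol.row-ge V {j} refl of λ
        (i , b , q) → i , b , unflip (A i j) (λ t → case Sol.ε-eq V t of λ ()) q)
  where
  unflip : ∀ a {e} → e ≢ true → (not a xor e) ≡ true → a ≡ false
  unflip false _ _ = refl
  unflip true  h q = contradiction q h

-- Doubling a left vertex

pm-tail₀ : ∀ {I : Subset n} {J : Subset d} {P : BiRel (suc n) d} → PM (outside ∷ I) J P → PM I J (P ∘ suc)
pm-tail₀ p = record
  { domˡ = λ q → case P.domˡ q of λ { (there h) → h }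
  ; domʳ = P.domʳ ; totˡ = λ h → P.totˡ (there h)
  ; totʳ = λ h → case P.totʳ h of λ { (zero , q) → case P.domˡ q of λ () ; (suc i , q) → i , q }
  ; func = P.func ; inj = λ q r → case P.inj q r of λ { refl → refl } }
  where module P = PM p

pm-tail : ∀ {I : Subset n} {J : Subset d} {P : BiRel (suc n) d} {x} → PM (inside ∷ I) J P → P zero x →
          PM I (J ⊖ x) (P ∘ suc)
pm-tail {J = J} p z = record
  { domˡ = λ q → case P.domˡ q of λ { (there h) → h }
  ; domʳ = λ q → ∈-⊖ (P.domʳ q) λ { refl → case P.inj q z of λ () }
  ; totˡ = λ h → P.totˡ (there h)
  ; totʳ = λ h → case P.totʳ (⊖-⊆ J h) of λ
      { (zero , q) → contradiction (P.func q z) (⊖-≢ J h) ; (suc i , q) → i , q }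
  ; func = P.func ; inj = λ q r → case P.inj q r of λ { refl → refl } }
  where module P = PM p

⊖-exchange : ∀ {J : Subset d} {x y} → x ∈ J → x ≢ y → ((J ⊖ x) ⊖ y) ⊕ x ≡ J ⊖ y
⊖-exchange {J = J} {x} {y} x∈J x≢y = trans (cong (_⊕ x) (⊖-comm J x y)) (⊖⊕ (∈-⊖ x∈J x≢y))

pm-exchange : ∀ {I : Subset n} {J : Subset d} {P : BiRel n d} {a x y} → x ∈ J → PM I (J ⊖ x) P → P a y →
              PM I (J ⊖ y) (λ i j → (i ≡ a × j ≡ x) ⊎ (P i j × i ≢ a))
pm-exchange {I = I} {J} {P} {a} {x} {y} x∈J p q =
  subst (λ z → PM z (J ⊖ y) R) (⊖⊕ (PM.domˡ p q))
    (subst (λ z → PM ((I ⊖ a) ⊕ a) z R) (⊖-exchange x∈J (≢-sym (⊖-≢ J (PM.domʳ p q))))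
      (pm-add (pm-delete p q) (λ h → ⊖-≢ I h refl) λ h → ⊖-≢ J (⊖-⊆ (J ⊖ x) h) refl))
  where R = λ i j → (i ≡ a × j ≡ x) ⊎ (P i j × i ≢ a)

pm-insert : ∀ {I : Subset n} {J : Subset d} {P : BiRel n d} {a x} → a ∉ I → x ∈ J → PM I (J ⊖ x) P →
            PM (I ⊕ a) J (λ i j → (i ≡ a × j ≡ x) ⊎ P i j)
pm-insert {I = I} {J} {P} {a} {x} a∉ x∈ p =
  subst (λ z → PM (I ⊕ a) z (λ i j → (i ≡ a × j ≡ x) ⊎ P i j)) (⊖⊕ x∈) (pm-add p a∉ λ h → ⊖-≢ J h refl)

private
  pigeon : ∀ {A : Set} {p q r u v : A} → p ≡ u ⊎ p ≡ v → q ≡ u ⊎ q ≡ v → r ≡ u ⊎ r ≡ v → p ≡ q ⊎ q ≡ r ⊎ p ≡ r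
  pigeon (inj₁ refl) (inj₁ refl) _ = inj₁ refl
  pigeon (inj₂ refl) (inj₂ refl) _ = inj₁ refl
  pigeon (inj₁ refl) (inj₂ refl) (inj₁ refl) = inj₂ (inj₂ refl)
  pigeon (inj₁ refl) (inj₂ refl) (inj₂ refl) = inj₂ (inj₁ refl)
  pigeon (inj₂ refl) (inj₁ refl) (inj₁ refl) = inj₂ (inj₁ refl)
  pigeon (inj₂ refl) (inj₁ refl) (inj₂ refl) = inj₂ (inj₂ refl)

  OneOf : ∀ {A : Set} → A → A → A → A → Set
  OneOf α β γ t = t ≡ α ⊎ t ≡ β ⊎ t ≡ γ

  others : ∀ {A : Set} {α β γ p : A} → OneOf α β γ p →
           ∃[ u ] ∃[ v ] (∀ {t} → OneOf α β γ t → t ≢ p → t ≡ u ⊎ t ≡ v)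
  others {α = α} {β} {γ} (inj₁ refl) = β , γ , λ
    { (inj₁ e) ne → contradiction e ne ; (inj₂ e) _ → e }
  others {α = α} {β} {γ} (inj₂ (inj₁ refl)) = α , γ , λ
    { (inj₁ e) _ → inj₁ e ; (inj₂ (inj₁ e)) ne → contradiction e ne ; (inj₂ (inj₂ e)) _ → inj₂ e }
  others {α = α} {β} {γ} (inj₂ (inj₂ refl)) = α , β , λ
    { (inj₁ e) _ → inj₁ e ; (inj₂ (inj₁ e)) _ → inj₂ e ; (inj₂ (inj₂ e)) ne → contradiction e ne }

  share : ∀ {α β γ p q r s : Fin d} → OneOf α β γ p → OneOf α β γ q → OneOf α β γ r → OneOf α β γ s →
          p ≢ q → r ≢ s → (r ≡ p ⊎ r ≡ q) ⊎ (s ≡ p ⊎ s ≡ q)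
  share {p = p} {q} {r} {s} op oq or os p≢q r≢s with r ≟ᶠ p | s ≟ᶠ p | r ≟ᶠ q | s ≟ᶠ q | others op
  ... | yes e | _ | _ | _ | _ = inj₁ (inj₁ e)
  ... | no _ | yes e | _ | _ | _ = inj₂ (inj₁ e)
  ... | no _ | no _ | yes e | _ | _ = inj₁ (inj₂ e)
  ... | no _ | no _ | no _ | yes e | _ = inj₂ (inj₂ e)
  ... | no r≢p | no s≢p | no r≢q | no s≢q | u , v , h with h or r≢p | h os s≢p | h oq (≢-sym p≢q)
  ...   | inj₁ refl | inj₁ refl | _ = contradiction refl r≢s
  ...   | inj₂ refl | inj₂ refl | _ = contradiction refl r≢s
  ...   | inj₁ refl | inj₂ refl | inj₁ refl = contradiction refl r≢q
  ...   | inj₁ refl | inj₂ refl | inj₂ refl = contradiction refl s≢q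
  ...   | inj₂ refl | inj₁ refl | inj₁ refl = contradiction refl s≢q
  ...   | inj₂ refl | inj₁ refl | inj₂ refl = contradiction refl r≢q

record StrictOrder (A : Set) : Set₁ where
  field
    _≺_ : A → A → Set
    tri : ∀ x y → x ≺ y ⊎ x ≡ y ⊎ y ≺ x
    irr : ∀ {x} → ¬ (x ≺ x)
    tr  : ∀ {x y z} → x ≺ y → y ≺ z → x ≺ z

reverse : ∀ {A} → StrictOrder A → StrictOrder A
reverse O = record { _≺_ = λ x y → y ≺ x
                   ; tri = λ x y → case tri y x of λ
                       { (inj₁ h) → inj₁ h ; (inj₂ (inj₁ e)) → inj₂ (inj₁ (sym e)) ; (inj₂ (inj₂ h)) → inj₂ (inj₂ h) }
                   ; irr = irr ; tr = λ p q → tr q p }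
  where open StrictOrder O

private
  -- No pᵢ is maximal among α, β, γ, which leaves two values for three of them.
  lower : ∀ {A} (O : StrictOrder A) → let open StrictOrder O in ∀ {α β γ p₁ p₂ p₃ q₁ q₂ q₃ : A} →
          OneOf α β γ p₁ → OneOf α β γ p₂ → OneOf α β γ p₃ → OneOf α β γ q₁ → OneOf α β γ q₂ → OneOf α β γ q₃ →
          p₁ ≺ q₁ → p₂ ≺ q₂ → p₃ ≺ q₃ → p₁ ≡ p₂ ⊎ p₂ ≡ p₃ ⊎ p₁ ≡ p₃
  lower O {α} {β} {γ} a₁ a₂ a₃ b₁ b₂ b₃ l₁ l₂ l₃ with top
    where
    open StrictOrder O
    ≮-trans : ∀ {x y z} → ¬ (x ≺ y) → ¬ (y ≺ z) → ¬ (x ≺ z)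
    ≮-trans {x} {y} x≮y y≮z x≺z with tri x y
    ... | inj₁ l           = x≮y l
    ... | inj₂ (inj₁ refl) = y≮z x≺z
    ... | inj₂ (inj₂ l)    = y≮z (tr l x≺z)
    max : ∀ x y → ∃[ t ] (t ≡ x ⊎ t ≡ y) × ¬ (t ≺ x) × ¬ (t ≺ y)
    max x y with tri x y
    ... | inj₁ l           = y , inj₂ refl , (λ h → irr (tr l h)) , irr
    ... | inj₂ (inj₁ refl) = x , inj₁ refl , irr , irr
    ... | inj₂ (inj₂ l)    = x , inj₁ refl , irr , λ h → irr (tr l h)
    top : ∃[ t ] OneOf α β γ t × (∀ {s} → OneOf α β γ s → ¬ (t ≺ s))
    top with max α β
    ... | m , om , m≮α , m≮β with max m γ
    ...   | t , ot , t≮m , t≮γ = t , inTriple ot om , λ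
              { (inj₁ refl) → ≮-trans t≮m m≮α ; (inj₂ (inj₁ refl)) → ≮-trans t≮m m≮β ; (inj₂ (inj₂ refl)) → t≮γ }
      where
      inTriple : ∀ {t m} → t ≡ m ⊎ t ≡ γ → m ≡ α ⊎ m ≡ β → OneOf α β γ t
      inTriple (inj₁ refl) (inj₁ e) = inj₁ e
      inTriple (inj₁ refl) (inj₂ e) = inj₂ (inj₁ e)
      inTriple (inj₂ e)    _        = inj₂ (inj₂ e)
  ... | t , ot , mx with others ot
  ...   | u , v , h = pigeon (h a₁ λ { refl → mx b₁ l₁ }) (h a₂ λ { refl → mx b₂ l₂ }) (h a₃ λ { refl → mx b₃ l₃ })

-- The new left vertex zero is a copy of a, infinitesimally perturbed so
-- that zero gets the ≺-smaller one of the two partners of {zero, a}.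
module Double (S : Sys n d) (a : Fin n) (O : StrictOrder (Fin d)) where
  open Sys S
  open StrictOrder O

  -- The two neighbours of `a` in the linkage tree on `I` and `J`: each becomes the partner of `a`
  -- when the other is left out.
  Pair : Subset n → Subset d → Fin d → Fin d → Set
  Pair I J x y = x ∈ J × y ∈ J × E I (J ⊖ x) a y × E I (J ⊖ y) a x

  Z : Subset n → Subset d → Fin d → Set
  Z I J x = (a ∉ I × E (I ⊕ a) J a x) ⊎ (a ∈ I × ∃[ y ] Pair I J x y × x ≺ y)

  -- Away from `a`, both matchings are the one between `I ⊖ a` and `J` without `x` and `y`, by
  -- `closure`.
  agree : ∀ {I J x y i j} → ∣ J ∣ ≡ suc ∣ I ∣ → Pair I J x y → i ≢ a → E I (J ⊖ x) i j → E I (J ⊖ y) i j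
  agree {I} {J} {x} {y} c (x∈ , y∈ , p , q) i≢a e =
    proj₁ (pm-⊒ pm₂ (pm (∣⊖⊖∣-≡ (∣⊖∣-≡ {I = I} {J} c x∈) (PM.domˡ px p) (PM.domʳ px p)))
      (λ r → closure (∣⊖∣-≡ {I = I} {J} c y∈) pm₂ proj₁ r)
      (closure (∣⊖∣-≡ {I = I} {J} c x∈) (pm-delete px p) proj₁ (e , i≢a)))
    where
    px = pm {I} {J ⊖ x} (∣⊖∣-≡ {I = I} {J} c x∈)
    py = pm {I} {J ⊖ y} (∣⊖∣-≡ {I = I} {J} c y∈)
    pm₂ : PM (I ⊖ a) ((J ⊖ x) ⊖ y) (λ i j → E I (J ⊖ y) i j × i ≢ a)
    pm₂ = subst (λ z → PM (I ⊖ a) z (λ i j → E I (J ⊖ y) i j × i ≢ a)) (⊖-comm J y x) (pm-delete py q)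

  swap-pair : ∀ {I J x y} → Pair I J x y → Pair I J y x
  swap-pair (a , b , c , d) = b , a , d , c

  pair-≢ : ∀ {I J x y} → ∣ J ∣ ≡ suc ∣ I ∣ → Pair I J x y → y ≢ x
  pair-≢ {I} {J} c (x∈ , _ , p , _) = ⊖-≢ J (PM.domʳ (pm (∣⊖∣-≡ {I = I} {J} c x∈)) p)

  pair-nb : ∀ {I J x y v} → ∣ J ∣ ≡ suc ∣ I ∣ → Pair I J x y → Nb S I J a v → v ≡ x ⊎ v ≡ y
  pair-nb {I} {J} c P@(x∈ , y∈ , p , q) nb with Linkage.nb-two S {I} {J} c (_ , x∈ , p) (_ , y∈ , q) nb
  ... | inj₁ e = contradiction e (pair-≢ c P)
  ... | inj₂ (inj₁ e) = inj₁ (sym e)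
  ... | inj₂ (inj₂ e) = inj₂ (sym e)

  -- Some matching gives `a` the partner `y`, and leaving out `y` gives `x`. Leaving out `x` cannot
  -- produce a third neighbour, so it gives `y` back.
  pair-exists : ∀ {I J x₀} → ∣ J ∣ ≡ suc ∣ I ∣ → a ∈ I → x₀ ∈ J → ∃[ x ] ∃[ y ] Pair I J x y
  pair-exists {I} {J} c a∈ x₀∈ with PM.totˡ (pm (∣⊖∣-≡ {I = I} {J} c x₀∈)) a∈
  ... | y , p with ⊖-⊆ J (PM.domʳ (pm (∣⊖∣-≡ {I = I} {J} c x₀∈)) p)
  ...   | y∈ with PM.totˡ (pm (∣⊖∣-≡ {I = I} {J} c y∈)) a∈
  ...     | x , q with PM.domʳ (pm (∣⊖∣-≡ {I = I} {J} c y∈)) q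
  ...       | x∈′ with ⊖-⊆ J x∈′
  ...         | x∈ with PM.totˡ (pm (∣⊖∣-≡ {I = I} {J} c x∈)) a∈
  ...           | z , r with R1 c x₀∈ y∈ x∈ p q r
  ...             | inj₁ refl = contradiction refl (⊖-≢ J x∈′)
  ...             | inj₂ (inj₁ refl) = contradiction refl (⊖-≢ J (PM.domʳ (pm (∣⊖∣-≡ {I = I} {J} c x∈)) r))
  ...             | inj₂ (inj₂ refl) = x , y , x∈ , y∈ , r , q

  orient : ∀ {I J x y} → ∣ J ∣ ≡ suc ∣ I ∣ → a ∈ I → Pair I J x y → ∃[ z ] Z I J z
  orient {I} {J} {x} {y} c a∈ P with tri x y
  ... | inj₁ l = x , inj₂ (a∈ , y , P , l)
  ... | inj₂ (inj₁ e) = contradiction (sym e) (pair-≢ {I} {J} c P)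
  ... | inj₂ (inj₂ l) = y , inj₂ (a∈ , x , swap-pair P , l)

  Z-exists : ∀ {I J} → ∣ J ∣ ≡ suc ∣ I ∣ → ∃[ x ] Z I J x
  Z-exists {I} {J} c = case a ∈? I of λ
    { (no a∉) → case PM.totˡ (pm {I ⊕ a} {J} (trans (∣⊕∣ a∉) (sym c))) (∈-⊕ I a) of λ (x , e) → x , inj₁ (a∉ , e)
    ; (yes a∈) → case pair-exists {I} {J} c a∈ (proj₂ (∣∣-nonempty {p = J} c)) of λ
        (x , y , P) → orient {I} {J} c a∈ P }

  Z-unique : ∀ {I J x x′} → ∣ J ∣ ≡ suc ∣ I ∣ → Z I J x → Z I J x′ → x ≡ x′
  Z-unique {I} {J} c (inj₁ (a∉ , p)) (inj₁ (_ , q)) = PM.func (pm {I ⊕ a} {J} (trans (∣⊕∣ a∉) (sym c))) p q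
  Z-unique c (inj₁ (a∉ , _)) (inj₂ (a∈ , _)) = contradiction a∈ a∉
  Z-unique c (inj₂ (a∈ , _)) (inj₁ (a∉ , _)) = contradiction a∈ a∉
  Z-unique {I} {J} c (inj₂ (_ , y , P , l)) (inj₂ (_ , y′ , (x′∈ , y′∈ , p , q) , l′))
    with pair-nb {I} {J} c P (_ , x′∈ , p) | pair-nb {I} {J} c P (_ , y′∈ , q)
  ... | _ | inj₁ e = sym e
  ... | inj₁ refl | inj₂ refl = contradiction (tr l l′) irr
  ... | inj₂ refl | inj₂ refl = contradiction l′ irr

  Z-∈ : ∀ {I J x} → ∣ J ∣ ≡ suc ∣ I ∣ → Z I J x → x ∈ J
  Z-∈ {I} {J} c (inj₁ (a∉ , p)) = PM.domʳ (pm {I ⊕ a} {J} (trans (∣⊕∣ a∉) (sym c))) p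
  Z-∈ c (inj₂ (_ , _ , (x∈ , _) , _)) = x∈

  E′ : Subset (suc n) → Subset d → BiRel (suc n) d
  E′ (outside ∷ I) J zero    j = Empty
  E′ (outside ∷ I) J (suc i) j = E I J i j
  E′ (inside ∷ I)  J zero    j = Z I J j
  E′ (inside ∷ I)  J (suc i) j = ∃[ x ] Z I J x × E I (J ⊖ x) i j

  pm′ : ∀ {I J} → ∣ I ∣ ≡ ∣ J ∣ → PM I J (E′ I J)
  pm′ {outside ∷ I} {J} c = record
    { domˡ = λ { {suc i} e → there (P.domˡ e) }
    ; domʳ = λ { {suc i} e → P.domʳ e }
    ; totˡ = λ { (there h) → P.totˡ h }
    ; totʳ = λ h → case P.totʳ h of λ (i , e) → suc i , e
    ; func = λ { {suc i} e e′ → P.func e e′ }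
    ; inj  = λ { {suc i} {suc i′} e e′ → cong suc (P.inj e e′) } }
    where module P = PM (pm {I} {J} c)
  pm′ {inside ∷ I} {J} c′ = record
    { domˡ = λ { {zero} e → here ; {suc i} e → there (P.domˡ (tail e)) }
    ; domʳ = λ { {zero} e → Z-∈ {I} {J} c e ; {suc i} e → ⊖-⊆ J (P.domʳ (tail e)) }
    ; totˡ = λ { here → z , zZ ; (there h) → case P.totˡ h of λ (j , e) → j , z , zZ , e }
    ; totʳ = λ {j} h → case j ≟ᶠ z of λ
        { (yes refl) → zero , zZ
        ; (no ne) → case P.totʳ (∈-⊖ h ne) of λ (i , e) → suc i , z , zZ , e }
    ; func = λ { {zero} e e′ → Z-unique {I} {J} c e e′ ; {suc i} e e′ → P.func (tail e) (tail e′) }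
    ; inj  = λ { {zero} {zero} e e′ → refl
               ; {zero} {suc i} e e′ → contradiction (Z-unique {I} {J} c e zZ) (⊖-≢ J (P.domʳ (tail e′)))
               ; {suc i} {zero} e e′ → contradiction (Z-unique {I} {J} c e′ zZ) (⊖-≢ J (P.domʳ (tail e)))
               ; {suc i} {suc i′} e e′ → cong suc (P.inj (tail e) (tail e′)) } }
    where
    c : ∣ J ∣ ≡ suc ∣ I ∣
    c = sym c′
    z = proj₁ (Z-exists {I} {J} c)
    zZ = proj₂ (Z-exists {I} {J} c)
    module P = PM (pm {I} {J ⊖ z} (∣⊖∣-≡ {I = I} {J} c (Z-∈ {I} {J} c zZ)))
    tail : ∀ {i j} → E′ (inside ∷ I) J (suc i) j → E I (J ⊖ z) i j
    tail (x , zx , e) = subst (λ w → E I (J ⊖ w) _ _) (Z-unique {I} {J} c zx zZ) e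

  shrink : ∀ {I J x i j} → ∣ J ∣ ≡ suc ∣ I ∣ → a ∉ I → E (I ⊕ a) J a x → E I (J ⊖ x) i j → E (I ⊕ a) J i j
  shrink {I} {J} {x} c a∉ e r = proj₁ (pm-⊒ pd (pm (∣⊖∣-≡ {I = I} {J} c (PM.domʳ pa e)))
      (λ q → closure ca pd proj₁ q) r)
    where
    ca : ∣ I ⊕ a ∣ ≡ ∣ J ∣
    ca = trans (∣⊕∣ a∉) (sym c)
    pa = pm {I ⊕ a} {J} ca
    pd : PM I (J ⊖ x) (λ i j → E (I ⊕ a) J i j × i ≢ a)
    pd = subst (λ z → PM z (J ⊖ x) (λ i j → E (I ⊕ a) J i j × i ≢ a)) (⊕⊖ a∉) (pm-delete pa e)

  π : Fin (suc n) → Fin n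
  π zero    = a
  π (suc i) = i

  -- If `a` is not in `I`, just one copy of it is present, and renaming `zero` to `a` recovers a
  -- matching of `S`.
  copy : ∀ {I J} r {j} → ∣ J ∣ ≡ suc ∣ I ∣ → a ∉ I → E′ (inside ∷ I) J r j → E (I ⊕ a) J (π r) j
  copy zero c a∉ (inj₁ (_ , e)) = e
  copy zero c a∉ (inj₂ (a∈ , _)) = contradiction a∈ a∉
  copy {I} {J} (suc i) c a∉ (x , inj₁ (_ , e) , q) = shrink {I} {J} c a∉ e q
  copy (suc i) c a∉ (x , inj₂ (a∈ , _) , _) = contradiction a∈ a∉

  closure′ : ∀ {I J I′ J′ P} → ∣ I ∣ ≡ ∣ J ∣ → PM I′ J′ P → P ⊑ E′ I J → P ⊑ E′ I′ J′
  closure′ {outside ∷ I} {J} {outside ∷ I′} {J′} c p P⊑ {zero} q = P⊑ q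
  closure′ {outside ∷ I} {J} {outside ∷ I′} {J′} c p P⊑ {suc i} q = closure c (pm-tail₀ p) P⊑ q
  closure′ {outside ∷ I} {J} {inside ∷ I′} {J′} c p P⊑ {i} q = ⊥-elim (P⊑ (proj₂ (PM.totˡ p here)))
  closure′ {inside ∷ I} {J} {outside ∷ I′} {J′} c p P⊑ {zero} q = case PM.domˡ p q of λ ()
  closure′ {inside ∷ I} {J} {outside ∷ I′} {J′} c p P⊑ {suc i} q =
      closure (∣⊖∣-≡ {I = I} {J} (sym c) (Z-∈ {I} {J} (sym c) zZ)) (pm-tail₀ p)
        (λ r → case P⊑ r of λ (x , zx , e) → subst (λ w → E I (J ⊖ w) _ _) (Z-unique {I} {J} (sym c) zx zZ) e) q
    where zZ = proj₂ (Z-exists {I} {J} (sym c))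
  closure′ {inside ∷ I} {J} {inside ∷ I′} {J′} {P} c′ p P⊑ {r₀} = result r₀
    where
    c : ∣ J ∣ ≡ suc ∣ I ∣
    c = sym c′
    x₀ = proj₁ (PM.totˡ p here)
    q₀ = proj₂ (PM.totˡ p here)
    zZ : Z I J x₀
    zZ = P⊑ q₀
    pt = pm-tail p q₀
    x₀∈′ = PM.domʳ p q₀
    tail : ∀ {i j} → P (suc i) j → E I (J ⊖ x₀) i j
    tail r = case P⊑ r of λ (x , zx , e) → subst (λ w → E I (J ⊖ w) _ _) (Z-unique {I} {J} c zx zZ) e
    cx : ∣ I ∣ ≡ ∣ J ⊖ x₀ ∣
    cx = ∣⊖∣-≡ {I = I} {J} c (Z-∈ {I} {J} c zZ)
    tail′ : ∀ {i j} → P (suc i) j → E I′ (J′ ⊖ x₀) i j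
    tail′ r = closure cx pt tail r
    zZ′ : Z I′ J′ x₀
    zZ′ with zZ | a ∈? I′
    ... | inj₁ (a∉ , e) | yes a∈′ = contradiction (PM.domˡ (pm cx) (tail (proj₂ (PM.totˡ pt a∈′)))) a∉
    ... | inj₁ (a∉ , e) | no a∉′ = inj₁ (a∉′ , closure (trans (∣⊕∣ a∉) (sym c)) (pm-insert a∉′ x₀∈′ pt)
            (λ { (inj₁ (refl , refl)) → e ; (inj₂ r) → shrink {I} {J} c a∉ e (tail r) }) (inj₁ (refl , refl)))
    -- The submatching contains only the copy `zero`, so it sits inside the matching that leaves out
    -- `y`, where `a` itself has the partner `x₀`.
    ... | inj₂ (a∈ , y , Py@(x∈ , y∈ , e , e′) , l) | no a∉′ = inj₁ (a∉′ ,
            closure (∣⊖∣-≡ {I = I} {J} c y∈) (pm-insert a∉′ x₀∈′ pt)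
            (λ { (inj₁ (refl , refl)) → e′
               ; (inj₂ r) → agree {I} {J} c Py (λ { refl → a∉′ (PM.domˡ pt r) }) (tail r) }) (inj₁ (refl , refl)))
    ... | inj₂ (a∈ , y , Py@(x∈ , y∈ , e , e′) , l) | yes a∈′ with PM.totˡ pt a∈′
    ...   | y₁ , r₁ with PM.func (pm cx) (tail r₁) e
    ...     | refl = inj₂ (a∈′ , y , (x₀∈′ , PM.domʳ p r₁ , tail′ r₁ ,
              closure (∣⊖∣-≡ {I = I} {J} c y∈) (pm-exchange x₀∈′ pt r₁)
                (λ { (inj₁ (refl , refl)) → e′ ; (inj₂ (r , ne)) → agree {I} {J} c Py ne (tail r) })
                (inj₁ (refl , refl))) , l)
    result : ∀ r {j} → P r j → E′ (inside ∷ I′) J′ r j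
    result zero    q = subst (Z I′ J′) (PM.func p q₀ q) zZ′
    result (suc i) q = x₀ , zZ′ , tail′ q

  -- Three right vertices such that the partner of a with any two right
  -- vertices removed lies among them.
  record Triple (I : Subset n) (J : Subset d) : Set where
    field
      α β γ : Fin d
      α∈ : α ∈ J
      β∈ : β ∈ J
      γ∈ : γ ∈ J
      eγ : E I ((J ⊖ α) ⊖ β) a γ
      eα : E I ((J ⊖ β) ⊖ γ) a α
      eβ : E I ((J ⊖ γ) ⊖ α) a β
      β≢α : β ≢ α
      γ≢α : γ ≢ α
      γ≢β : γ ≢ β

  module _ {I : Subset n} {J : Subset d} (c : ∣ J ∣ ≡ suc (suc ∣ I ∣)) (a∈ : a ∈ I) where

    c⊖ : ∀ {x} → x ∈ J → ∣ J ⊖ x ∣ ≡ suc ∣ I ∣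
    c⊖ x∈ = ℕ.suc-injective (trans (sym (∣⊖∣ x∈)) c)

    comm : ∀ {x y i j} → E I ((J ⊖ x) ⊖ y) i j → E I ((J ⊖ y) ⊖ x) i j
    comm {x} {y} = subst (λ w → E I w _ _) (⊖-comm J x y)

    -- Let `γ` be the partner of `a` when `α` and `β` are left out. In the tree on `J ⊖ α` the
    -- neighbours of `a` are then `β` and `γ`, so leaving out `γ` as well must give `β`; the tree on
    -- `J ⊖ β` is treated likewise.
    triple-from : ∀ {x₀ α β} → x₀ ∈ J → Pair I (J ⊖ x₀) α β → Triple I J
    triple-from {x₀} {α} {β} x₀∈ P@(α∈′ , β∈′ , e , e′) = record
      { α∈ = α∈ ; β∈ = β∈ ; γ∈ = γ∈ ; eγ = eγ ; eα = eα ; eβ = eβ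
      ; β≢α = β≢α ; γ≢α = γ≢α ; γ≢β = γ≢β }
      where
      α∈ = ⊖-⊆ J α∈′
      β∈ = ⊖-⊆ J β∈′
      β≢α : β ≢ α
      β≢α = pair-≢ {I} {J ⊖ x₀} (c⊖ x₀∈) P
      pα = pm {I} {(J ⊖ α) ⊖ β} (∣⊖∣-≡ {I = I} {J ⊖ α} (c⊖ α∈) (∈-⊖ β∈ β≢α))
      γ = proj₁ (PM.totˡ pα a∈)
      eγ : E I ((J ⊖ α) ⊖ β) a γ
      eγ = proj₂ (PM.totˡ pα a∈)
      γ∈″ = PM.domʳ pα eγ
      γ∈′ = ⊖-⊆ (J ⊖ α) γ∈″
      γ∈ = ⊖-⊆ J γ∈′
      γ≢α = ⊖-≢ J γ∈′
      γ≢β = ⊖-≢ (J ⊖ α) γ∈″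
      module Lα = Linkage S {I} {J ⊖ α} (c⊖ α∈)
      module Lβ = Linkage S {I} {J ⊖ β} (c⊖ β∈)
      eβ : E I ((J ⊖ γ) ⊖ α) a β
      eβ with PM.totˡ (Lα.pm⊖ γ∈′) a∈
      ... | v , r with Lα.nb-two (x₀ , ∈-⊖ x₀∈ (≢-sym (⊖-≢ J α∈′)) , comm e) (β , ∈-⊖ β∈ β≢α , eγ) (γ , γ∈′ , r)
      ...   | inj₁ q = contradiction (sym q) γ≢β
      ...   | inj₂ (inj₁ q) = contradiction (sym q) (⊖-≢ (J ⊖ α) (PM.domʳ (Lα.pm⊖ γ∈′) r))
      ...   | inj₂ (inj₂ refl) = comm r
      eα : E I ((J ⊖ β) ⊖ γ) a α
      eα with PM.totˡ (Lβ.pm⊖ (∈-⊖ γ∈ γ≢β)) a∈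
      ... | v , r with Lβ.nb-two (x₀ , ∈-⊖ x₀∈ (≢-sym (⊖-≢ J β∈′)) , comm e′) (α , ∈-⊖ α∈ (≢-sym β≢α) , comm eγ) (γ , ∈-⊖ γ∈ γ≢β , r)
      ...   | inj₁ q = contradiction (sym q) γ≢α
      ...   | inj₂ (inj₁ q) = contradiction (sym q) (⊖-≢ (J ⊖ β) (PM.domʳ (Lβ.pm⊖ (∈-⊖ γ∈ γ≢β)) r))
      ...   | inj₂ (inj₂ refl) = r

    triple : Triple I J
    triple = case ∣∣-nonempty {p = J} c of λ (x₀ , x₀∈) →
      case pair-exists {I} {J ⊖ x₀} (c⊖ x₀∈) a∈ (proj₂ (∣∣-nonempty {p = J ⊖ x₀} (c⊖ x₀∈))) of λ
        (_ , _ , P) → triple-from x₀∈ P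

    module _ (t : Triple I J) where
      open Triple t

      nbα : ∀ {v} → Nb S I (J ⊖ α) a v → v ≡ β ⊎ v ≡ γ
      nbα nb with Linkage.nb-two S {I} {J ⊖ α} (c⊖ α∈) (γ , ∈-⊖ γ∈ γ≢α , comm eβ) (β , ∈-⊖ β∈ β≢α , eγ) nb
      ... | inj₁ q = contradiction (sym q) γ≢β
      ... | inj₂ (inj₁ q) = inj₂ (sym q)
      ... | inj₂ (inj₂ q) = inj₁ (sym q)
      nbβ : ∀ {v} → Nb S I (J ⊖ β) a v → v ≡ α ⊎ v ≡ γ
      nbβ nb with Linkage.nb-two S {I} {J ⊖ β} (c⊖ β∈) (γ , ∈-⊖ γ∈ γ≢β , eα) (α , ∈-⊖ α∈ (≢-sym β≢α) , comm eγ) nb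
      ... | inj₁ q = contradiction (sym q) γ≢α
      ... | inj₂ (inj₁ q) = inj₂ (sym q)
      ... | inj₂ (inj₂ q) = inj₁ (sym q)
      nbγ : ∀ {v} → Nb S I (J ⊖ γ) a v → v ≡ α ⊎ v ≡ β
      nbγ nb with Linkage.nb-two S {I} {J ⊖ γ} (c⊖ γ∈) (β , ∈-⊖ β∈ (≢-sym γ≢β) , comm eα) (α , ∈-⊖ α∈ (≢-sym γ≢α) , eβ) nb
      ... | inj₁ q = contradiction (sym q) β≢α
      ... | inj₂ (inj₁ q) = inj₂ (sym q)
      ... | inj₂ (inj₂ q) = inj₁ (sym q)

      -- For a further vertex `y`, leave out `y` together with `α`, `β` or `γ`. The resulting
      -- partners of `a` lie in three different pairs without a common element, so they are not all
      -- equal and exhaust the two neighbours of `a` in the tree on `J ⊖ y`.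
      among : ∀ {y v} → y ∈ J → Nb S I (J ⊖ y) a v → OneOf α β γ v
      among {y} {v} y∈ nb with y ≟ᶠ α | y ≟ᶠ β | y ≟ᶠ γ
      ... | yes refl | _ | _ = inj₂ (nbα nb)
      ... | no _ | yes refl | _ = case nbβ nb of λ { (inj₁ q) → inj₁ q ; (inj₂ q) → inj₂ (inj₂ q) }
      ... | no _ | no _ | yes refl = case nbγ nb of λ { (inj₁ q) → inj₁ q ; (inj₂ q) → inj₂ (inj₁ q) }
      ... | no y≢α | no y≢β | no y≢γ = pick³ (nbα (y , ∈-⊖ y∈ y≢α , comm (proj₂ p)))
                                            (nbβ (y , ∈-⊖ y∈ y≢β , comm (proj₂ q)))
                                            (nbγ (y , ∈-⊖ y∈ y≢γ , comm (proj₂ r)))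
        where
        module L = Linkage S {I} {J ⊖ y} (c⊖ y∈)
        α∈′ = ∈-⊖ α∈ (≢-sym y≢α)
        β∈′ = ∈-⊖ β∈ (≢-sym y≢β)
        γ∈′ = ∈-⊖ γ∈ (≢-sym y≢γ)
        p = PM.totˡ (L.pm⊖ α∈′) a∈
        q = PM.totˡ (L.pm⊖ β∈′) a∈
        r = PM.totˡ (L.pm⊖ γ∈′) a∈
        nbp = α , α∈′ , proj₂ p
        nbq = β , β∈′ , proj₂ q
        nbr = γ , γ∈′ , proj₂ r
        pick³ : proj₁ p ≡ β ⊎ proj₁ p ≡ γ → proj₁ q ≡ α ⊎ proj₁ q ≡ γ → proj₁ r ≡ α ⊎ proj₁ r ≡ β → OneOf α β γ v
        pick³ P Q R with L.nb-two nbp nbq nb | L.nb-two nbp nbr nb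
        pick³ (inj₁ e) Q R | inj₂ (inj₂ e′) | _ = inj₂ (inj₁ (trans (sym e′) e))
        pick³ (inj₂ e) Q R | inj₂ (inj₂ e′) | _ = inj₂ (inj₂ (trans (sym e′) e))
        pick³ P (inj₁ e) R | inj₂ (inj₁ e′) | _ = inj₁ (trans (sym e′) e)
        pick³ P (inj₂ e) R | inj₂ (inj₁ e′) | _ = inj₂ (inj₂ (trans (sym e′) e))
        pick³ P Q (inj₁ e) | inj₁ _ | inj₂ (inj₁ e′) = inj₁ (trans (sym e′) e)
        pick³ P Q (inj₂ e) | inj₁ _ | inj₂ (inj₁ e′) = inj₂ (inj₁ (trans (sym e′) e))
        pick³ (inj₁ e) Q R | inj₁ _ | inj₂ (inj₂ e′) = inj₂ (inj₁ (trans (sym e′) e))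
        pick³ (inj₂ e) Q R | inj₁ _ | inj₂ (inj₂ e′) = inj₂ (inj₂ (trans (sym e′) e))
        pick³ (inj₁ e) (inj₁ f) R | inj₁ pq | inj₁ _ = contradiction (trans (sym e) (trans pq f)) β≢α
        pick³ (inj₁ e) (inj₂ f) R | inj₁ pq | inj₁ _ = contradiction (sym (trans (sym e) (trans pq f))) γ≢β
        pick³ (inj₂ e) Q (inj₁ f) | inj₁ _ | inj₁ pr = contradiction (trans (sym e) (trans pr f)) γ≢α
        pick³ (inj₂ e) Q (inj₂ f) | inj₁ _ | inj₁ pr = contradiction (trans (sym e) (trans pr f)) γ≢β

      record Split (x p : Fin d) : Set where
        field
          q    : Fin d
          pair : Pair I (J ⊖ x) p q
          p≺q  : p ≺ q
          op   : OneOf α β γ p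
          oq   : OneOf α β γ q

      split : ∀ {x p} → x ∈ J → Z I (J ⊖ x) p → Split x p
      split x∈ (inj₁ (a∉ , _)) = contradiction a∈ a∉
      split {p = p} x∈ (inj₂ (_ , q , P@(p∈ , q∈ , e , e′) , l)) = record
        { q = q ; pair = P ; p≺q = l ; op = among x∈ (q , q∈ , e′) ; oq = among x∈ (p , p∈ , e) }

      R1-zero : ∀ {x y z u v w} → x ∈ J → y ∈ J → z ∈ J → Z I (J ⊖ x) u → Z I (J ⊖ y) v → Z I (J ⊖ z) w →
                u ≡ v ⊎ v ≡ w ⊎ u ≡ w
      R1-zero x∈ y∈ z∈ e f g = lower O (op s) (op s′) (op s″) (oq s) (oq s′) (oq s″) (p≺q s) (p≺q s′) (p≺q s″)
        where
        open Split
        s = split x∈ e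
        s′ = split y∈ f
        s″ = split z∈ g

      R1-a : ∀ {x y z u v w} → x ∈ J → y ∈ J → z ∈ J → E′ (inside ∷ I) (J ⊖ x) (suc a) u →
             E′ (inside ∷ I) (J ⊖ y) (suc a) v → E′ (inside ∷ I) (J ⊖ z) (suc a) w → u ≡ v ⊎ v ≡ w ⊎ u ≡ w
      R1-a {x} {y} {z} {u} {v} {w} x∈ y∈ z∈ e f g =
        lower (reverse O) (proj₁ (high x∈ e)) (proj₁ (high y∈ f)) (proj₁ (high z∈ g))
          (proj₁ (proj₂ (proj₂ (high x∈ e)))) (proj₁ (proj₂ (proj₂ (high y∈ f)))) (proj₁ (proj₂ (proj₂ (high z∈ g))))
          (proj₂ (proj₂ (proj₂ (high x∈ e)))) (proj₂ (proj₂ (proj₂ (high y∈ f)))) (proj₂ (proj₂ (proj₂ (high z∈ g))))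
        where
        high : ∀ {x u} → x ∈ J → E′ (inside ∷ I) (J ⊖ x) (suc a) u → OneOf α β γ u × ∃[ p ] OneOf α β γ p × p ≺ u
        high {x} x∈ (p , zp , r) with split x∈ zp
        ... | s with Split.pair s
        ...   | p∈ , _ , e , _ with PM.func (pm (∣⊖∣-≡ {I = I} {J ⊖ x} (c⊖ x∈) p∈)) r e
        ...     | refl = Split.oq s , p , Split.op s , Split.p≺q s

      -- By `agree`, one vertex `δ` is a neighbour of `i` in each of the three trees on `J ⊖ α`,
      -- `J ⊖ β` and `J ⊖ γ`, leaving room for one more in each. Every partner of `i` in the doubled
      -- ensemble occurs in two of these trees, so any two partners share one of them.
      R1-other : ∀ {i x y z u v w} → i ∈ I → i ≢ a → x ∈ J → y ∈ J → z ∈ J → E′ (inside ∷ I) (J ⊖ x) (suc i) u →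
             E′ (inside ∷ I) (J ⊖ y) (suc i) v → E′ (inside ∷ I) (J ⊖ z) (suc i) w → u ≡ v ⊎ v ≡ w ⊎ u ≡ w
      R1-other {i} {x} {y} {z} {u} {v} {w} i∈ i≢a x∈ y∈ z∈ e f g
        with u ≟ᶠ v | v ≟ᶠ w | u ≟ᶠ w
      ... | yes q | _ | _ = inj₁ q
      ... | no _ | yes q | _ = inj₂ (inj₁ q)
      ... | no _ | no _ | yes q = inj₂ (inj₂ q)
      ... | no uv | no vw | no uw = ⊥-elim (case u ≟ᶠ δ of λ
          { (no uδ) → case v ≟ᶠ δ of λ
              { (no vδ) → clash (view x∈ e) (view y∈ f) uv uδ vδ
              ; (yes vδ) → clash (view x∈ e) (view z∈ g) uw uδ λ wδ → vw (trans vδ (sym wδ)) }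
          ; (yes uδ) → clash (view y∈ f) (view z∈ g) vw (λ vδ → uv (trans uδ (sym vδ))) (λ wδ → uw (trans uδ (sym wδ))) })
        where
        δe = PM.totˡ (pm (∣⊖∣-≡ {I = I} {J ⊖ α} (c⊖ α∈) (∈-⊖ β∈ β≢α))) i∈
        δ = proj₁ δe
        δ∈ : ∀ {t} → OneOf α β γ t → Nb S I (J ⊖ t) i δ
        δ∈ (inj₁ refl) = β , ∈-⊖ β∈ β≢α , proj₂ δe
        δ∈ (inj₂ (inj₁ refl)) = γ , ∈-⊖ γ∈ γ≢β , agree {I} {J ⊖ β} (c⊖ β∈)
          (∈-⊖ α∈ (≢-sym β≢α) , ∈-⊖ γ∈ γ≢β , comm eγ , eα) i≢a (comm (proj₂ δe))
        δ∈ (inj₂ (inj₂ refl)) = α , ∈-⊖ α∈ (≢-sym γ≢α) , comm (agree {I} {J ⊖ α} (c⊖ α∈)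
          (∈-⊖ β∈ β≢α , ∈-⊖ γ∈ γ≢α , eγ , comm eβ) i≢a (proj₂ δe))
        View : Fin d → Set
        View v = ∃[ p ] ∃[ q ] OneOf α β γ p × OneOf α β γ q × p ≢ q × Nb S I (J ⊖ p) i v × Nb S I (J ⊖ q) i v
        view : ∀ {x v} → x ∈ J → E′ (inside ∷ I) (J ⊖ x) (suc i) v → View v
        view {x} x∈ (p , zp , r) with split x∈ zp
        ... | s with Split.pair s
        ...   | P@(p∈ , q∈ , _) = p , Split.q s , Split.op s , Split.oq s , ≢-sym (pair-≢ {I} {J ⊖ x} (c⊖ x∈) P)
              , (x , ∈-⊖ x∈ (≢-sym (⊖-≢ J p∈)) , comm r)
              , (x , ∈-⊖ x∈ (≢-sym (⊖-≢ J q∈)) , comm (agree {I} {J ⊖ x} (c⊖ x∈) P i≢a r))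
        t∈J : ∀ {t} → OneOf α β γ t → t ∈ J
        t∈J (inj₁ refl) = α∈
        t∈J (inj₂ (inj₁ refl)) = β∈
        t∈J (inj₂ (inj₂ refl)) = γ∈
        three : ∀ {t v w} → OneOf α β γ t → Nb S I (J ⊖ t) i v → Nb S I (J ⊖ t) i w → v ≢ w → v ≢ δ → w ≢ δ → Empty
        three {t} ot nv nw vw vδ wδ with Linkage.nb-two S {I} {J ⊖ t} (c⊖ (t∈J ot)) nv nw (δ∈ ot)
        ... | inj₁ q = vw q
        ... | inj₂ (inj₁ q) = wδ q
        ... | inj₂ (inj₂ q) = vδ q
        clash : ∀ {v w} → View v → View w → v ≢ w → v ≢ δ → w ≢ δ → Empty
        clash (p , q , op , oq , pq , vp , vq) (r , s , or , os , rs , wr , ws) vw vδ wδ with share op oq or os pq rs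
        ... | inj₁ (inj₁ refl) = three or vp wr vw vδ wδ
        ... | inj₁ (inj₂ refl) = three or vq wr vw vδ wδ
        ... | inj₂ (inj₁ refl) = three os vp ws vw vδ wδ
        ... | inj₂ (inj₂ refl) = three os vq ws vw vδ wδ

      R1-both : ∀ {i x y z u v w} → x ∈ J → y ∈ J → z ∈ J → E′ (inside ∷ I) (J ⊖ x) i u →
                E′ (inside ∷ I) (J ⊖ y) i v → E′ (inside ∷ I) (J ⊖ z) i w → u ≡ v ⊎ v ≡ w ⊎ u ≡ w
      R1-both {zero} = R1-zero
      R1-both {suc i} {x} x∈ y∈ z∈ e@(p , zp , r) f g with i ≟ᶠ a
      ... | yes refl = R1-a x∈ y∈ z∈ e f g
      ... | no i≢a = R1-other (PM.domˡ (pm (∣⊖∣-≡ {I = I} {J ⊖ x} (c⊖ x∈) (Z-∈ {I} {J ⊖ x} (c⊖ x∈) zp))) r) i≢a x∈ y∈ z∈ e f g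

  R1′ : ∀ {I J i x y z u v w} → ∣ J ∣ ≡ suc ∣ I ∣ → x ∈ J → y ∈ J → z ∈ J →
        E′ I (J ⊖ x) i u → E′ I (J ⊖ y) i v → E′ I (J ⊖ z) i w → u ≡ v ⊎ v ≡ w ⊎ u ≡ w
  R1′ {outside ∷ I} {J} {suc i} c x∈ y∈ z∈ e f g = R1 {I} {J} c x∈ y∈ z∈ e f g
  R1′ {inside ∷ I} {J} {i} c x∈ y∈ z∈ e f g with a ∈? I
  ... | yes a∈ = R1-both {I} {J} c a∈ (triple {I} {J} c a∈) {i} x∈ y∈ z∈ e f g
  ... | no a∉ = R1 {I ⊕ a} {J} (trans c (cong suc (sym (∣⊕∣ a∉)))) x∈ y∈ z∈
                  (copy {I} i (cc x∈) a∉ e) (copy {I} i (cc y∈) a∉ f) (copy {I} i (cc z∈) a∉ g)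
    where
    cc : ∀ {x} → x ∈ J → ∣ J ⊖ x ∣ ≡ suc ∣ I ∣
    cc x∈ = ℕ.suc-injective (trans (sym (∣⊖∣ x∈)) c)

  -- Removing the right vertex k₀ matched with a reduces the left linkage of
  -- both copies to that of I.
  module _ {I : Subset n} {J : Subset d} (c : ∣ I ∣ ≡ ∣ J ∣) (a∈ : a ∈ I) where
    private
      pI = pm {I} {J} c
      k₀ = proj₁ (PM.totˡ pI a∈)
      e₀ : E I J a k₀
      e₀ = proj₂ (PM.totˡ pI a∈)
      k₀∈ = PM.domʳ pI e₀
      cK : ∣ I ∣ ≡ suc ∣ J ⊖ k₀ ∣
      cK = trans c (∣⊖∣ k₀∈)

      minus-a : ∀ {i j} → E I J i j → i ≢ a → E (I ⊖ a) (J ⊖ k₀) i j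
      minus-a e ne = closure c (pm-delete pI e₀) proj₁ (e , ne)

      -- Translates a row `w` of the reduced linkage into a row of the doubled ensemble. If `w` is
      -- `a`, the pair of `a` consists of `j` and `k₀`, and the smaller one belongs to `zero`.
      Matches : Fin d → Fin (suc n) → Fin n → Set
      Matches j r w = (w ≢ a × r ≡ suc w) ⊎ (w ≡ a × j ≺ k₀ × r ≡ zero) ⊎ (w ≡ a × k₀ ≺ j × r ≡ suc a)

      matches-unique : ∀ {j r r′ w} → Matches j r w → Matches j r′ w → r ≡ r′
      matches-unique (inj₁ (_ , refl)) (inj₁ (_ , refl)) = refl
      matches-unique (inj₁ (ne , _)) (inj₂ (inj₁ (e , _))) = contradiction e ne
      matches-unique (inj₁ (ne , _)) (inj₂ (inj₂ (e , _))) = contradiction e ne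
      matches-unique (inj₂ (inj₁ (e , _))) (inj₁ (ne , _)) = contradiction e ne
      matches-unique (inj₂ (inj₂ (e , _))) (inj₁ (ne , _)) = contradiction e ne
      matches-unique (inj₂ (inj₁ (_ , _ , refl))) (inj₂ (inj₁ (_ , _ , refl))) = refl
      matches-unique (inj₂ (inj₂ (_ , _ , refl))) (inj₂ (inj₂ (_ , _ , refl))) = refl
      matches-unique (inj₂ (inj₁ (_ , l , _))) (inj₂ (inj₂ (_ , l′ , _))) = contradiction (tr l l′) irr
      matches-unique (inj₂ (inj₂ (_ , l , _))) (inj₂ (inj₁ (_ , l′ , _))) = contradiction (tr l l′) irr

      Reduced : Fin d → Fin (suc n) → Set
      Reduced j r = (j ≡ k₀ × (r ≡ zero ⊎ r ≡ suc a)) ⊎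
                    (j ≢ k₀ × ∃[ w ] Matches j r w × ∃[ x ] x ∈ I × E (I ⊖ x) (J ⊖ k₀) w j)

      direct : ∀ {i j} → E I J i j → Reduced j (suc i)
      direct {i} {j} e with j ≟ᶠ k₀
      ... | yes refl = inj₁ (refl , inj₂ (cong suc (PM.inj pI e e₀)))
      ... | no j≢ = inj₂ (j≢ , i , inj₁ (i≢a , refl) , a , a∈ , minus-a e i≢a)
        where
        i≢a : i ≢ a
        i≢a refl = j≢ (PM.func pI e e₀)

      reduce : ∀ x {j r} → x ∈ inside ∷ I → E′ ((inside ∷ I) ⊖ x) J r j → Reduced j r
      reduce zero {r = suc i} x∈ e = direct e
      reduce (suc x) {j} {r} (there x∈) e with x ≟ᶠ a
      ... | yes refl = via r (subst (λ z → E z J (π r) j) (⊖⊕ a∈) (copy {I ⊖ a} {J} r (trans (sym c) (∣⊖∣ a∈)) (λ h → ⊖-≢ I h refl) e))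
        where
        via : ∀ r → E I J (π r) j → Reduced j r
        via zero h with PM.func pI h e₀
        ... | refl = inj₁ (refl , inj₁ refl)
        via (suc i) h = direct h
      ... | no x≢a = body r e
        where
        I₁ = I ⊖ x
        a∈₁ : a ∈ I₁
        a∈₁ = ∈-⊖ a∈ (≢-sym x≢a)
        c₁ : ∣ J ∣ ≡ suc ∣ I₁ ∣
        c₁ = trans (sym c) (∣⊖∣ x∈)
        module L = Linkage S {I₁} {J} c₁
        xl = PM.totˡ pI x∈
        nbk : Nb S I₁ J a k₀
        nbk = proj₁ xl , PM.domʳ pI (proj₂ xl) , closure c (pm-delete pI (proj₂ xl)) proj₁ (e₀ , ≢-sym x≢a)
        body : ∀ r → E′ (inside ∷ I₁) J r j → Reduced j r
        body zero (inj₁ (a∉ , _)) = contradiction a∈₁ a∉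
        body zero (inj₂ (_ , y , P@(j∈ , y∈ , p , q) , l)) with pair-nb {I₁} {J} c₁ P nbk
        ... | inj₁ refl = inj₁ (refl , inj₁ refl)
        ... | inj₂ refl = inj₂ (≢-sym (pair-≢ {I₁} {J} c₁ P) , a , inj₂ (inj₁ (refl , l , refl)) , x , x∈ , q)
        body (suc i) (z , inj₁ (a∉ , _) , _) = contradiction a∈₁ a∉
        body (suc i) (z , inj₂ (_ , y , P@(z∈ , y∈ , p , q) , l) , g) with pair-nb {I₁} {J} c₁ P nbk | i ≟ᶠ a
        ... | inj₁ refl | yes refl with PM.func (L.pm⊖ z∈) g p
        ...   | refl = inj₂ (pair-≢ {I₁} {J} c₁ P , a , inj₂ (inj₂ (refl , l , refl)) , x , x∈ , g)
        body (suc i) (z , inj₂ (_ , y , P@(z∈ , y∈ , p , q) , l) , g) | inj₁ refl | no i≢a =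
          inj₂ (⊖-≢ J (PM.domʳ (L.pm⊖ z∈) g) , i , inj₁ (i≢a , refl) , x , x∈ , g)
        body (suc i) (z , inj₂ (_ , y , P@(z∈ , y∈ , p , q) , l) , g) | inj₂ refl | yes refl with PM.func (L.pm⊖ z∈) g p
        ...   | refl = inj₁ (refl , inj₂ refl)
        body (suc i) (z , inj₂ (_ , y , P@(z∈ , y∈ , p , q) , l) , g) | inj₂ refl | no i≢a with agree {I₁} {J} c₁ P i≢a g
        ...   | g′ = inj₂ (⊖-≢ J (PM.domʳ (L.pm⊖ y∈) g′) , i , inj₁ (i≢a , refl) , x , x∈ , g′)

    L1-both : ∀ {j x y z u v w} → x ∈ inside ∷ I → y ∈ inside ∷ I → z ∈ inside ∷ I →
              E′ ((inside ∷ I) ⊖ x) J u j → E′ ((inside ∷ I) ⊖ y) J v j → E′ ((inside ∷ I) ⊖ z) J w j →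
              u ≡ v ⊎ v ≡ w ⊎ u ≡ w
    L1-both {x = x} {y} {z} x∈ y∈ z∈ e f g with reduce x x∈ e | reduce y y∈ f | reduce z z∈ g
    ... | inj₁ (_ , p) | inj₁ (_ , q) | inj₁ (_ , r) = pigeon p q r
    ... | inj₁ (h , _) | inj₂ (ne , _) | _ = contradiction h ne
    ... | inj₁ (h , _) | _ | inj₂ (ne , _) = contradiction h ne
    ... | inj₂ (ne , _) | inj₁ (h , _) | _ = contradiction h ne
    ... | inj₂ (ne , _) | _ | inj₁ (h , _) = contradiction h ne
    ... | inj₂ (_ , _ , m₁ , x₁ , x₁∈ , h₁) | inj₂ (_ , _ , m₂ , x₂ , x₂∈ , h₂) | inj₂ (_ , _ , m₃ , x₃ , x₃∈ , h₃)
      with L1 {I} {J ⊖ k₀} cK x₁∈ x₂∈ x₃∈ h₁ h₂ h₃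
    ...   | inj₁ refl = inj₁ (matches-unique m₁ m₂)
    ...   | inj₂ (inj₁ refl) = inj₂ (inj₁ (matches-unique m₂ m₃))
    ...   | inj₂ (inj₂ refl) = inj₂ (inj₂ (matches-unique m₁ m₃))

  L1′ : ∀ {I J j x y z u v w} → ∣ I ∣ ≡ suc ∣ J ∣ → x ∈ I → y ∈ I → z ∈ I →
        E′ (I ⊖ x) J u j → E′ (I ⊖ y) J v j → E′ (I ⊖ z) J w j → u ≡ v ⊎ v ≡ w ⊎ u ≡ w
  L1′ {outside ∷ I} {J} {u = suc u} {suc v} {suc w} c (there x∈) (there y∈) (there z∈) e f g with L1 {I} {J} c x∈ y∈ z∈ e f g
  ... | inj₁ q = inj₁ (cong suc q)
  ... | inj₂ (inj₁ q) = inj₂ (inj₁ (cong suc q))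
  ... | inj₂ (inj₂ q) = inj₂ (inj₂ (cong suc q))
  L1′ {inside ∷ I} {J} {j} {x} {y} {z} {u} {v} {w} c x∈ y∈ z∈ e f g with a ∈? I
  ... | yes a∈ = L1-both {I} {J} (ℕ.suc-injective c) a∈ x∈ y∈ z∈ e f g
  ... | no a∉ = go (L1 {I ⊕ a} {J} (trans (∣⊕∣ a∉) c) (π∈ x∈) (π∈ y∈) (π∈ z∈) (cp x∈ e) (cp y∈ f) (cp z∈ g))
    where
    π∈ : ∀ {x} → x ∈ inside ∷ I → π x ∈ I ⊕ a
    π∈ here = ∈-⊕ I a
    π∈ (there h) = ⊆-⊕ I a h
    c′ : ∣ I ∣ ≡ ∣ J ∣
    c′ = ℕ.suc-injective c
    cp : ∀ {x r} → x ∈ inside ∷ I → E′ ((inside ∷ I) ⊖ x) J r j → E ((I ⊕ a) ⊖ π x) J (π r) j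
    cp {r = suc r} here e = subst (λ z → E z J r j) (sym (⊕⊖ a∉)) e
    cp {suc x} {r} (there h) e = subst (λ z → E z J (π r) j)
      (⊆-antisym (λ q → case ⊕-inv (I ⊖ x) a q of λ
          { (inj₁ refl) → ∈-⊖ (∈-⊕ I a) λ { refl → a∉ h } ; (inj₂ q′) → ∈-⊖ (⊆-⊕ I a (⊖-⊆ I q′)) (⊖-≢ I q′) })
        (λ q → case ⊕-inv I a (⊖-⊆ (I ⊕ a) q) of λ
          { (inj₁ refl) → ∈-⊕ (I ⊖ x) a ; (inj₂ q′) → ⊆-⊕ (I ⊖ x) a (∈-⊖ q′ (⊖-≢ (I ⊕ a) q)) }))
      (copy {I ⊖ x} {J} r (trans (sym c′) (∣⊖∣ h)) (λ q → a∉ (⊖-⊆ I q)) e)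
    I′ = inside ∷ I
    dom : ∀ {x r} → x ∈ I′ → E′ (I′ ⊖ x) J r j → r ∈ I′
    dom {x} x∈ e = ⊖-⊆ I′ (PM.domˡ (pm′ {I′ ⊖ x} {J} (ℕ.suc-injective (trans (sym (∣⊖∣ x∈)) c))) e)
    π-inj : ∀ {r s} → r ∈ I′ → s ∈ I′ → π r ≡ π s → r ≡ s
    π-inj here here _ = refl
    π-inj here (there h) refl = contradiction h a∉
    π-inj (there h) here refl = contradiction h a∉
    π-inj (there _) (there _) q = cong suc q
    go : π u ≡ π v ⊎ π v ≡ π w ⊎ π u ≡ π w → u ≡ v ⊎ v ≡ w ⊎ u ≡ w
    go (inj₁ q) = inj₁ (π-inj (dom x∈ e) (dom y∈ f) q)
    go (inj₂ (inj₁ q)) = inj₂ (inj₁ (π-inj (dom y∈ f) (dom z∈ g) q))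
    go (inj₂ (inj₂ q)) = inj₂ (inj₂ (π-inj (dom x∈ e) (dom z∈ g) q))

  double : Sys (suc n) d
  double = record
    { E = E′ ; pm = λ {I} {J} → pm′ {I} {J}
    ; closure = λ {I} {J} {I′} {J′} → closure′ {I} {J} {I′} {J′}
    ; R1 = λ {I} {J} → R1′ {I} {J} ; L1 = λ {I} {J} → L1′ {I} {J} }

  -- When `zero` and `a` are matched with `x₀` and `y`, giving `a` either of the two yields a
  -- matching inside `U`. Hence they form a `Pair`, and `mono` orders it the way the doubled
  -- ensemble does.
  double-comp : ∀ {U : BiRel n d} {U′ : BiRel (suc n) d} → Comp S U →
    (∀ {i j} → U′ (suc i) j → U i j) → (∀ {j} → U′ zero j → U a j) →
    (∀ {j k} → U′ zero j → U′ (suc a) k → j ≡ k ⊎ j ≺ k) → Comp double U′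
  double-comp cU h h₀ mono {outside ∷ I} p P⊑ {zero} q = case PM.domˡ p q of λ ()
  double-comp cU h h₀ mono {outside ∷ I} p P⊑ {suc i} q = cU (pm-tail₀ p) (λ r → h (P⊑ r)) q
  double-comp {U} cU h h₀ mono {inside ∷ I} {J} {P} p P⊑ {r₀} = result r₀
    where
    x₀ = proj₁ (PM.totˡ p here)
    q₀ = proj₂ (PM.totˡ p here)
    x₀∈ = PM.domʳ p q₀
    pt = pm-tail p q₀
    tail : ∀ {i j} → P (suc i) j → E I (J ⊖ x₀) i j
    tail = cU pt (λ r → h (P⊑ r))
    zZ : Z I J x₀
    zZ with a ∈? I
    ... | no a∉ = inj₁ (a∉ , cU (pm-insert a∉ x₀∈ pt)
            (λ { (inj₁ (refl , refl)) → h₀ (P⊑ q₀) ; (inj₂ r) → h (P⊑ r) }) (inj₁ (refl , refl)))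
    ... | yes a∈ with PM.totˡ pt a∈
    ...   | y , r with mono (P⊑ q₀) (P⊑ r)
    ...     | inj₁ refl = contradiction (PM.inj p q₀ r) λ ()
    ...     | inj₂ l = inj₂ (a∈ , y , (x₀∈ , PM.domʳ p r , tail r , cU (pm-exchange x₀∈ pt r)
            (λ { (inj₁ (refl , refl)) → h₀ (P⊑ q₀) ; (inj₂ (s , _)) → h (P⊑ s) }) (inj₁ (refl , refl))) , l)
    result : ∀ r {j} → P r j → E′ (inside ∷ I) J r j
    result zero    q = subst (Z I J) (PM.func p q₀ q) zZ
    result (suc i) q = x₀ , zZ , tail q

  private
    comp-suc⁻ : ∀ {U′ : BiRel (suc n) d} {I J} {P : BiRel n d} → Comp double U′ → PM I J P →
                (∀ {i j} → P i j → U′ (suc i) j) → P ⊑ E I J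
    comp-suc⁻ {I = I} {J} {P} cU p P⊑U q = cU {outside ∷ I} {J} {P₀} p₀ (λ { {suc i} r → P⊑U r }) {suc _} q
      where
      P₀ : BiRel (suc n) d
      P₀ zero    j = Empty
      P₀ (suc i) j = P i j
      p₀ : PM (outside ∷ I) J P₀
      p₀ = record
        { domˡ = λ { {suc i} r → there (PM.domˡ p r) } ; domʳ = λ { {suc i} r → PM.domʳ p r }
        ; totˡ = λ { (there m) → PM.totˡ p m } ; totʳ = λ m → case PM.totʳ p m of λ (i , r) → suc i , r
        ; func = λ { {suc i} r s → PM.func p r s } ; inj = λ { {suc i} {suc i′} r s → cong suc (PM.inj p r s) } }

  -- A matching inside `T` uses `a` at most once, so it lifts to a matching with a single copy of
  -- `a`, namely one that carries the edge in question.
  double-comp⁻ : ∀ {T : BiRel n d} {U′ : BiRel (suc n) d} → Comp double U′ →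
    (∀ {i j} → T i j → i ≢ a → U′ (suc i) j) → (∀ {j} → T a j → U′ zero j ⊎ U′ (suc a) j) → Comp S T
  double-comp⁻ {T} {U′} cU h h₀ {I} {J} {P} p P⊑ {i₀} {j₀} q₀ with a ∈? I
  ... | no a∉ = comp-suc⁻ cU p (λ { {i} r → h (P⊑ r) λ { refl → a∉ (PM.domˡ p r) } }) q₀
  ... | yes a∈ with PM.totˡ p a∈
  ...   | x , r with h₀ (P⊑ r)
  ...     | inj₂ u = comp-suc⁻ cU p (λ { {i} {j} s → case i ≟ᶠ a of λ
                { (yes refl) → subst (U′ (suc a)) (PM.func p r s) u ; (no ne) → h (P⊑ s) ne } }) q₀
  ...     | inj₁ u = case i₀ ≟ᶠ a of λ
              { (yes refl) → back zero (PM.func p r q₀) ; (no ne) → back (suc i₀) (q₀ , ne) }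
    where
    I⁻ = I ⊖ a
    P₁ : BiRel (suc n) d
    P₁ zero    j = x ≡ j
    P₁ (suc i) j = P i j × i ≢ a
    p₁ : PM (inside ∷ I⁻) J P₁
    p₁ = record
      { domˡ = λ { {zero} _ → here ; {suc i} (s , ne) → there (∈-⊖ (PM.domˡ p s) ne) }
      ; domʳ = λ { {zero} refl → PM.domʳ p r ; {suc i} (s , _) → PM.domʳ p s }
      ; totˡ = λ { here → x , refl ; (there m) → case PM.totˡ p (⊖-⊆ I m) of λ (j , s) → j , s , ⊖-≢ I m }
      ; totʳ = λ m → case PM.totʳ p m of λ (i , s) → case i ≟ᶠ a of λ
          { (yes refl) → zero , PM.func p r s ; (no ne) → suc i , s , ne }
      ; func = λ { {zero} refl refl → refl ; {suc i} (s , _) (t , _) → PM.func p s t }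
      ; inj = λ { {zero} {zero} _ _ → refl ; {zero} {suc i} refl (s , ne) → contradiction (PM.inj p s r) ne
                ; {suc i} {zero} (s , ne) refl → contradiction (PM.inj p s r) ne
                ; {suc i} {suc i′} (s , _) (t , _) → cong suc (PM.inj p s t) } }
    P₁⊑ : P₁ ⊑ U′
    P₁⊑ {zero} refl = u
    P₁⊑ {suc i} (s , ne) = h (P⊑ s) ne
    back : ∀ r′ {j} → P₁ r′ j → E I J (π r′) j
    back r′ s = subst (λ z → E z J (π r′) _) (⊖⊕ a∈)
      (copy {I⁻} {J} r′ (trans (sym (pm-card p)) (∣⊖∣ a∈)) (λ m → ⊖-≢ I m refl) (cU p₁ P₁⊑ s))

-- Elimination of compatible types

-- Placing `u` first decides that the new copy prefers `u`; the order of the other vertices merely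
-- makes the relation total.
first : Fin d → StrictOrder (Fin d)
first u = record { _≺_ = _≺_ ; tri = tri ; irr = irr ; tr = tr }
  where
  _≺_ : Fin _ → Fin _ → Set
  x ≺ y = (x ≡ u × y ≢ u) ⊎ (x ≢ u × y ≢ u × x <ᶠ y)
  tri : ∀ x y → x ≺ y ⊎ x ≡ y ⊎ y ≺ x
  tri x y with x ≟ᶠ u | y ≟ᶠ u | <-cmp x y
  ... | yes refl | yes refl | _ = inj₂ (inj₁ refl)
  ... | yes p | no q | _ = inj₁ (inj₁ (p , q))
  ... | no p | yes q | _ = inj₂ (inj₂ (inj₁ (q , p)))
  ... | no p | no q | tri< l _ _ = inj₁ (inj₂ (p , q , l))
  ... | no p | no q | tri≈ _ e _ = inj₂ (inj₁ e)
  ... | no p | no q | tri> _ _ l = inj₂ (inj₂ (inj₂ (q , p , l)))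
  irr : ∀ {x} → ¬ (x ≺ x)
  irr (inj₁ (p , q)) = q p
  irr (inj₂ (_ , _ , l)) = <ᶠ-irrefl refl l
  tr : ∀ {x y z} → x ≺ y → y ≺ z → x ≺ z
  tr (inj₁ (p , q)) (inj₁ (p′ , q′)) = contradiction p′ q
  tr (inj₁ (p , q)) (inj₂ (_ , q′ , _)) = inj₁ (p , q′)
  tr (inj₂ (_ , q , _)) (inj₁ (p′ , _)) = contradiction p′ q
  tr (inj₂ (p , _ , l)) (inj₂ (_ , q′ , l′)) = inj₂ (p , q′ , <ᶠ-trans l l′)

Sel : (Fin n → Fin d) → BiRel n d
Sel U i j = U i ≡ j

private
  does-true : ∀ {P : Set} (D : Dec P) → does D ≡ true → P
  does-true (yes p) _ = p

  does-false : ∀ {P : Set} (D : Dec P) → does D ≡ false → ¬ P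
  does-false (no p) _ = p

-- The copy zero of a prefers U a, so that the matching {(zero, V a), (a, U a)}
-- cannot occur in a certificate.
eliminate-topes : (S : Sys n d) (U V : Fin n → Fin d) → Comp S (Sel U) → Comp S (Sel V) →
  ∀ a → U a ≢ V a → ∃[ X ] (∀ i → X i ≡ U i ⊎ X i ≡ V i) ×
    Comp S (λ i j → (i ≢ a × X i ≡ j) ⊎ (i ≡ a × j ≡ U a)) ×
    Comp S (λ i j → (i ≢ a × X i ≡ j) ⊎ (i ≡ a × j ≡ V a))
eliminate-topes {n} {d} S U V cU cV a u≢v = [ solution , (λ cert → ⊥-elim (no-cert cert)) ]′ (two-colour D A u)
  where
  u = U a
  v = V a
  open Double S a (first u) using (Z; Pair; E′; double-comp; double-comp⁻) renaming (double to D)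
  -- The edges wanted in the tree: `u` at the copy and `v` at the original of `a`, so that both
  -- values of `a` occur, and a value of `U` or `V` in every other row.
  R : Fin (suc n) → Fin d → Set
  R zero    j = j ≡ u
  R (suc i) j = (i ≡ a × j ≡ v) ⊎ (i ≢ a × (j ≡ U i ⊎ j ≡ V i))
  R? : ∀ r j → Dec (R r j)
  R? zero    j = j ≟ᶠ u
  R? (suc i) j = ((i ≟ᶠ a) ×-dec (j ≟ᶠ v)) ⊎-dec (¬? (i ≟ᶠ a) ×-dec ((j ≟ᶠ U i) ⊎-dec (j ≟ᶠ V i)))
  A : Colouring (suc n) d
  A r j = does (R? r j)
  solution : _ → ∃[ X ] (∀ i → X i ≡ U i ⊎ X i ≡ V i) ×
    Comp S (λ i j → (i ≢ a × X i ≡ j) ⊎ (i ≡ a × j ≡ U a)) ×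
    Comp S (λ i j → (i ≢ a × X i ≡ j) ⊎ (i ≡ a × j ≡ V a))
  solution (I , J , c , h) = X , mix ,
      double-comp⁻ cB (λ { (inj₁ (_ , refl)) _ → bas _ ; (inj₂ (e , _)) ne → contradiction e ne })
        (λ { (inj₁ (ne , _)) → contradiction refl ne
           ; (inj₂ (_ , refl)) → inj₁ (subst (Bas D I J zero) (col zero) (proj₁ (proj₂ (h zero)))) }) ,
      double-comp⁻ cB (λ { (inj₁ (_ , refl)) _ → bas _ ; (inj₂ (e , _)) ne → contradiction e ne })
        (λ { (inj₁ (ne , _)) → contradiction refl ne
           ; (inj₂ (_ , refl)) → inj₂ (subst (Bas D I J (suc a)) Xa (bas a)) })
    where
    cB = comp-bas D {I} {J} c
    X : Fin n → Fin d
    X i = proj₁ (h (suc i))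
    bas : ∀ i → Bas D I J (suc i) (X i)
    bas i = proj₁ (proj₂ (h (suc i)))
    col : ∀ r → R r (proj₁ (h r))
    col r = does-true (R? r _) (proj₂ (proj₂ (h r)))
    mix : ∀ i → X i ≡ U i ⊎ X i ≡ V i
    mix i = case col (suc i) of λ { (inj₁ (refl , e)) → inj₂ e ; (inj₂ (_ , e)) → e }
    Xa : X a ≡ v
    Xa = case col (suc a) of λ { (inj₁ (_ , e)) → e ; (inj₂ (ne , _)) → contradiction refl ne }
  no-cert : _ → Empty
  no-cert (I , J , c , h) = refute (cτ pmP P⊑)
    where
    τ : Fin d → Fin (suc n)
    τ j = proj₁ (h j)
    cτ : Comp D (λ i j → Bas (D ᵀ) J I j i)
    cτ = flip-comp D (comp-bas (D ᵀ) {J} {I} c)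
    bas : ∀ j → Bas (D ᵀ) J I j (τ j)
    bas j = proj₁ (proj₂ (h j))
    ¬col : ∀ j → ¬ R (τ j) j
    ¬col j = does-false (R? (τ j) j) (proj₂ (proj₂ (h j)))
    ext : (Fin n → Fin d) → Fin (suc n) → Fin d
    ext T zero    = T a
    ext T (suc i) = T i
    ext-comp : ∀ {T} → Comp S (Sel T) → Comp D (Sel (ext T))
    ext-comp cT = double-comp cT id id λ p q → inj₁ (trans (sym p) q)
    -- Alternating between the extended tope and the certificate over all columns must reach an edge
    -- common to both. The colouring leaves `k` with `r` as the only candidate.
    fixed : ∀ T → Comp S (Sel T) → ∀ r k → (∀ k′ → ext T (τ k′) ≡ k′ → k′ ≡ k × τ k′ ≡ r) → τ k ≡ r
    fixed T cT r k only with τ k ≟ᶠ r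
    ... | yes e = e
    ... | no ne = ⊥-elim (no-alternation D (ext-comp cT) cτ (ext T) τ (subset {P = λ _ → Fin d} λ j → yes j)
            (k , subset⁺ (λ j → yes j) k) λ {k′} _ → bas k′ , refl , subset⁺ (λ j → yes j) k ,
            λ e → case only k′ e of λ { (refl , e′) → ne e′ })
    τu : τ u ≡ suc a
    τu = fixed U cU (suc a) u λ k e → go k (τ k) refl e
      where
      go : ∀ k r → r ≡ τ k → ext U r ≡ k → k ≡ u × r ≡ suc a
      go k zero q refl = contradiction (subst (λ r → R r u) q refl) (¬col u)
      go k (suc i) q refl with i ≟ᶠ a
      ... | yes refl = refl , refl
      ... | no ne = contradiction (subst (λ r → R r (U i)) q (inj₂ (ne , inj₁ refl))) (¬col (U i))
    τv : τ v ≡ zero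
    τv = fixed V cV zero v λ k e → go k (τ k) refl e
      where
      go : ∀ k r → r ≡ τ k → ext V r ≡ k → k ≡ v × r ≡ zero
      go k zero q refl = refl , refl
      go k (suc i) q refl with i ≟ᶠ a
      ... | yes refl = contradiction (subst (λ r → R r v) q (inj₁ (refl , refl))) (¬col v)
      ... | no ne = contradiction (subst (λ r → R r (V i)) q (inj₂ (ne , inj₂ refl))) (¬col (V i))
    J₂ = ⁅ u ⁆ ⊕ v
    P : BiRel (suc n) d
    P r j = (r ≡ zero × j ≡ v) ⊎ (r ≡ suc a × j ≡ u)
    pmP : PM (inside ∷ ⁅ a ⁆) J₂ P
    pmP = record
      { domˡ = λ { (inj₁ (refl , _)) → here ; (inj₂ (refl , _)) → there (x∈⁅x⁆ a) }
      ; domʳ = λ { (inj₁ (_ , refl)) → ∈-⊕ ⁅ u ⁆ v ; (inj₂ (_ , refl)) → ⊆-⊕ ⁅ u ⁆ v (x∈⁅x⁆ u) }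
      ; totˡ = λ { here → v , inj₁ (refl , refl) ; (there m) → u , inj₂ (cong suc (x∈⁅y⁆⇒x≡y a m) , refl) }
      ; totʳ = λ m → case ⊕-inv ⁅ u ⁆ v m of λ
          { (inj₁ e) → zero , inj₁ (refl , e) ; (inj₂ m′) → suc a , inj₂ (refl , x∈⁅y⁆⇒x≡y u m′) }
      ; func = λ { (inj₁ (refl , refl)) (inj₁ (_ , refl)) → refl ; (inj₁ (refl , _)) (inj₂ (() , _))
                 ; (inj₂ (refl , _)) (inj₁ (() , _)) ; (inj₂ (refl , refl)) (inj₂ (_ , refl)) → refl }
      ; inj = λ { (inj₁ (refl , _)) (inj₁ (refl , _)) → refl ; (inj₁ (_ , refl)) (inj₂ (_ , e)) → contradiction (sym e) u≢v
                ; (inj₂ (_ , refl)) (inj₁ (_ , e)) → contradiction e u≢v ; (inj₂ (refl , _)) (inj₂ (refl , _)) → refl } }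
    P⊑ : ∀ {r j} → P r j → Bas (D ᵀ) J I j r
    P⊑ (inj₁ (refl , refl)) = subst (Bas (D ᵀ) J I v) τv (bas v)
    P⊑ (inj₂ (refl , refl)) = subst (Bas (D ᵀ) J I u) τu (bas u)
    refute : P ⊑ E′ (inside ∷ ⁅ a ⁆) J₂ → Empty
    refute e with e {zero} {v} (inj₁ (refl , refl))
    ... | inj₁ (a∉ , _) = a∉ (x∈⁅x⁆ a)
    ... | inj₂ (_ , y , (_ , y∈ , _) , inj₁ (v≡u , _)) = u≢v (sym v≡u)
    ... | inj₂ (_ , y , (_ , y∈ , _) , inj₂ (_ , y≢u , v<y)) = case ⊕-inv ⁅ u ⁆ v y∈ of λ
            { (inj₁ refl) → <ᶠ-irrefl refl v<y ; (inj₂ m) → y≢u (x∈⁅y⁆⇒x≡y u m) }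

-- Elimination for types with several elements per coordinate

Gr : (Fin n → Subset d) → BiRel n d
Gr T i j = j ∈ T i

-- A matching uses at most one element of the coordinate `a`, so it already lies in one of the two
-- smaller graphs.
comp-split : (S : Sys n d) (T : Fin n → Subset d) (a : Fin n) {B₁ B₂ B : Subset d} →
  Comp S (Gr (update T a B₁)) → Comp S (Gr (update T a B₂)) →
  (∀ {j} → j ∈ B → j ∈ B₁ ⊎ j ∈ B₂) → Comp S (Gr (update T a B))
comp-split S T a {B₁} {B₂} {B} c₁ c₂ h {I} {J} {P} p P⊑ with a ∈? I
... | no a∉ = c₁ p λ {i} {j} q → away i (λ { refl → a∉ (PM.domˡ p q) }) (P⊑ q)
  where
  away : ∀ i {j} → i ≢ a → j ∈ update T a B i → j ∈ update T a B₁ i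
  away i ne m = subst (_ ∈_) (trans (update-≢ T ne) (sym (update-≢ T ne))) m
... | yes a∈ with PM.totˡ p a∈
...   | x , r with h (subst (x ∈_) (update-≡ T a B) (P⊑ r))
...     | inj₁ m = c₁ p λ {i} {j} q → at i q (P⊑ q)
  where
  at : ∀ i {j} → P i j → j ∈ update T a B i → j ∈ update T a B₁ i
  at i q m′ with i ≟ᶠ a
  ... | yes refl = subst (_∈ B₁) (PM.func p r q) m
  ... | no _     = m′
...     | inj₂ m = c₂ p λ {i} {j} q → at i q (P⊑ q)
  where
  at : ∀ i {j} → P i j → j ∈ update T a B i → j ∈ update T a B₂ i
  at i q m′ with i ≟ᶠ a
  ... | yes refl = subst (_∈ B₂) (PM.func p r q) m
  ... | no _     = m′

total : (Fin n → ℕ) → ℕ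
total {zero}  f = 0
total {suc n} f = f zero + total (f ∘ suc)

total-mono : ∀ {f g : Fin n → ℕ} → (∀ i → f i ≤ g i) → total f ≤ total g
total-mono {zero}  h = z≤n
total-mono {suc n} h = ℕ.+-mono-≤ (h zero) (total-mono (h ∘ suc))

total-strict : ∀ {f g : Fin n → ℕ} → (∀ i → f i ≤ g i) → ∀ k → f k < g k → total f < total g
total-strict h zero    l = ℕ.+-mono-<-≤ l (total-mono (h ∘ suc))
total-strict h (suc k) l = ℕ.+-mono-≤-< (h zero) (total-strict (h ∘ suc) k l)

infix 4 _≟ˢ_
_≟ˢ_ : (p q : Subset n) → Dec (p ≡ q)
_≟ˢ_ = ≡-dec _≟ᵇ_

δ : Subset d → Subset d → ℕ
δ p q = if does (p ≟ˢ q) then 0 else 1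

δ-≡ : ∀ {p q : Subset d} → p ≡ q → δ p q ≡ 0
δ-≡ {p = p} {q} e rewrite dec-true (p ≟ˢ q) e = refl

δ-≢ : ∀ {p q : Subset d} → p ≢ q → δ p q ≡ 1
δ-≢ {p = p} {q} e rewrite dec-false (p ≟ˢ q) e = refl

δ≤1 : ∀ (p q : Subset d) → δ p q ≤ 1
δ≤1 p q with p ≟ˢ q
... | yes _ = z≤n
... | no _  = s≤s z≤n

δ-sym : ∀ (p q : Subset d) → δ p q ≤ δ q p
δ-sym p q with q ≟ˢ p
... | yes e = ℕ.≤-reflexive (δ-≡ (sym e))
... | no _  = δ≤1 p q

dist : (U V : Fin n → Subset d) → ℕ
dist U V = total λ i → δ (U i) (V i)

excess : (Fin n → Subset d) → ℕ
excess U = total λ i → ∣ U i ∣ ∸ 1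

Mix : (U V W : Fin n → Subset d) → Set
Mix U V W = ∀ i → W i ≡ U i ⊎ W i ≡ V i

dist-mix : ∀ {U V W : Fin n → Subset d} → Mix U V W → ∀ p → W p ≢ U p → dist W V < dist U V
dist-mix {U = U} {V} {W} mix p ne = total-strict le p lt
  where
  le : ∀ i → δ (W i) (V i) ≤ δ (U i) (V i)
  le i with mix i
  ... | inj₁ e = ℕ.≤-reflexive (cong (λ z → δ z (V i)) e)
  ... | inj₂ e = ℕ.≤-trans (ℕ.≤-reflexive (δ-≡ e)) z≤n
  lt : δ (W p) (V p) < δ (U p) (V p)
  lt with mix p
  ... | inj₁ e = contradiction e ne
  ... | inj₂ e = ℕ.≤-reflexive (trans (cong suc (δ-≡ e)) (sym (δ-≢ λ e′ → ne (trans e (sym e′)))))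

excess-⊖ : ∀ (U : Fin n → Subset d) a {x y} → x ∈ U a → y ∈ U a → x ≢ y →
           excess (update U a (U a ⊖ x)) < excess U
excess-⊖ U a {x} {y} x∈ y∈ x≢y = total-strict le a lt
  where
  lt′ : ∣ U a ⊖ x ∣ ∸ 1 < ∣ U a ∣ ∸ 1
  lt′ rewrite ∣⊖∣ x∈ | ∣⊖∣ (∈-⊖ y∈ (≢-sym x≢y)) = ℕ.≤-refl
  lt : ∣ update U a (U a ⊖ x) a ∣ ∸ 1 < ∣ U a ∣ ∸ 1
  lt rewrite update-≡ U a (U a ⊖ x) = lt′
  le : ∀ i → ∣ update U a (U a ⊖ x) i ∣ ∸ 1 ≤ ∣ U i ∣ ∸ 1
  le i with i ≟ᶠ a
  ... | yes refl = ℕ.<⇒≤ lt′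
  ... | no _     = ℕ.≤-refl

record Elim (S : Sys n d) (U V : Fin n → Subset d) (a : Fin n) : Set₁ where
  field
    W    : Fin n → Subset d
    comp : Comp S (Gr W)
    at   : W a ≡ U a ∪ V a
    off  : ∀ i → i ≢ a → W i ≡ U i ⊎ W i ≡ V i

-- A mix that differs from both ends is strictly closer to each of them than they are to each other,
-- which lets `eliminate` recurse.
record Between (S : Sys n d) (U V : Fin n → Subset d) : Set₁ where
  field
    W    : Fin n → Subset d
    comp : Comp S (Gr W)
    mix  : Mix U V W
    p q  : Fin n
    W≢U  : W p ≢ U p
    W≢V  : W q ≢ V q

between-swap : ∀ {S : Sys n d} {U V} → Between S U V → Between S V U
between-swap b = record { W = W ; comp = comp ; mix = λ i → case mix i of λ { (inj₁ e) → inj₂ e ; (inj₂ e) → inj₁ e }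
                        ; p = q ; q = p ; W≢U = W≢V ; W≢V = W≢U }
  where open Between b

Multi : Subset d → Set
Multi p = ∃[ x ] ∃[ y ] x ∈ p × y ∈ p × x ≢ y

multi? : (p : Subset d) → Dec (Multi p)
multi? p = any? λ x → any? λ y → (x ∈? p) ×-dec ((y ∈? p) ×-dec ¬? (x ≟ᶠ y))

-- Moving x from U a = V a to the copy of a lowers the excess on both sides.
between-shared : (S : Sys n d) (U V : Fin n → Subset d) (a : Fin n) → U a ≡ V a → ∀ {x y} → x ∈ U a → y ∈ U a → x ≢ y →
  let open Double S a (first x) using (double) in
  (split : (Fin n → Subset d) → Fin (suc n) → Subset d) →
  (∀ T → split T zero ≡ ⁅ x ⁆) → (∀ T i → split T (suc i) ≡ update T a (T a ⊖ x) i) →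
  Between double (split U) (split V) → Between S U V
between-shared {n} {d} S U V a Ua≡Va {x} x∈ y∈ x≢y split s₀ s₊ b = record
    { W = W ; comp = double-comp⁻ B.comp off at ; mix = mix ; p = proj₁ pp ; q = proj₁ qq ; W≢U = proj₂ pp ; W≢V = proj₂ qq }
  where
  open Double S a (first x) using (double; double-comp⁻)
  module B = Between b
  W : Fin n → Subset d
  W = update (B.W ∘ suc) a (U a)
  Wi : ∀ {i} → i ≢ a → W i ≡ B.W (suc i)
  Wi ne = update-≢ (B.W ∘ suc) ne
  sU : ∀ {i} → i ≢ a → split U (suc i) ≡ U i
  sU ne = trans (s₊ U _) (update-≢ U ne)
  sV : ∀ {i} → i ≢ a → split V (suc i) ≡ V i
  sV ne = trans (s₊ V _) (update-≢ V ne)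
  zero≡ : B.W zero ≡ ⁅ x ⁆
  zero≡ = case B.mix zero of λ { (inj₁ e) → trans e (s₀ U) ; (inj₂ e) → trans e (s₀ V) }
  a≡ : B.W (suc a) ≡ U a ⊖ x
  a≡ = case B.mix (suc a) of λ
    { (inj₁ e) → trans e (trans (s₊ U a) (update-≡ U a _))
    ; (inj₂ e) → trans e (trans (s₊ V a) (trans (update-≡ V a _) (cong (_⊖ x) (sym Ua≡Va)))) }
  off : ∀ {i j} → j ∈ W i → i ≢ a → j ∈ B.W (suc i)
  off m ne = subst (_ ∈_) (Wi ne) m
  at : ∀ {j} → j ∈ W a → j ∈ B.W zero ⊎ j ∈ B.W (suc a)
  at {j} m with j ≟ᶠ x
  ... | yes refl = inj₁ (subst (x ∈_) (sym zero≡) (x∈⁅x⁆ x))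
  ... | no ne = inj₂ (subst (j ∈_) (sym a≡) (∈-⊖ (subst (j ∈_) (update-≡ (B.W ∘ suc) a (U a)) m) ne))
  mix : Mix U V W
  mix i with i ≟ᶠ a
  ... | yes refl = inj₁ refl
  ... | no ne = case B.mix (suc i) of λ { (inj₁ e) → inj₁ (trans e (sU ne)) ; (inj₂ e) → inj₂ (trans e (sV ne)) }
  pp : ∃[ p ] W p ≢ U p
  pp with B.p | B.W≢U
  ... | zero | ne = contradiction (trans zero≡ (sym (s₀ U))) ne
  ... | suc i | ne with i ≟ᶠ a
  ...   | yes refl = contradiction (trans a≡ (sym (trans (s₊ U a) (update-≡ U a _)))) ne
  ...   | no i≢ = i , λ e → ne (trans (sym (Wi i≢)) (trans e (sym (sU i≢))))
  qq : ∃[ p ] W p ≢ V p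
  qq with B.q | B.W≢V
  ... | zero | ne = contradiction (trans zero≡ (sym (s₀ V))) ne
  ... | suc i | ne with i ≟ᶠ a
  ...   | yes refl = contradiction (trans a≡ (sym (trans (s₊ V a) (trans (update-≡ V a _) (cong (_⊖ x) (sym Ua≡Va)))))) ne
  ...   | no i≢ = i , λ e → ne (trans (sym (Wi i≢)) (trans e (sym (sV i≢))))

-- If removing x, and removing y, from U a only allows a to be switched
-- first, then a can be switched back last.
between-multi : (S : Sys n d) (U V : Fin n → Subset d) (a r : Fin n) → a ≢ r → U a ≢ V a → U r ≢ V r →
  ∀ {x y} → x ≢ y → Elim S (update U a (U a ⊖ x)) V a → Elim S (update U a (U a ⊖ y)) V a → Between S U V
between-multi {n} {d} S U V a r a≢r Ua≢Va Ur≢Vr {x} {y} x≢y ex ey = decide (attempt ex) (attempt ey)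
  where
  attempt : ∀ {x} → Elim S (update U a (U a ⊖ x)) V a → Between S U V ⊎ Comp S (Gr (update V a (U a ⊖ x)))
  attempt {x} e with any? (λ i → ¬? (i ≟ᶠ a) ×-dec ¬? (Elim.W e i ≟ˢ V i))
  ... | yes (q , q≢a , ne) = inj₁ record
      { W = W′ ; comp = comp-mono S below comp ; mix = mix ; p = a ; q = q
      ; W≢U = λ e′ → Ua≢Va (sym (trans (sym (update-≡ W a (V a))) e′))
      ; W≢V = λ e′ → ne (trans (sym (update-≢ W q≢a)) e′) }
    where
    open Elim e
    W′ = update W a (V a)
    below : Gr W′ ⊑ Gr W
    below {i} {j} m with i ≟ᶠ a
    ... | yes refl = subst (j ∈_) (sym at) (x∈p∪q⁺ (inj₂ m))
    ... | no _ = m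
    mix : Mix U V W′
    mix i with i ≟ᶠ a
    ... | yes refl = inj₂ refl
    ... | no ne = case off i ne of λ { (inj₁ e) → inj₁ (trans e (update-≢ U ne)) ; (inj₂ e) → inj₂ e }
  ... | no nope = inj₂ (comp-mono S below comp)
    where
    open Elim e
    below : Gr (update V a (U a ⊖ x)) ⊑ Gr W
    below {i} {j} m with i ≟ᶠ a
    ... | yes refl = subst (j ∈_) (sym at) (x∈p∪q⁺ (inj₁ (subst (j ∈_) (sym (update-≡ U a _)) m)))
    ... | no i≢a with W i ≟ˢ V i
    ...   | yes e′ = subst (j ∈_) (sym e′) m
    ...   | no ne  = contradiction (i , i≢a , ne) nope
  decide : Between S U V ⊎ Comp S (Gr (update V a (U a ⊖ x))) →
           Between S U V ⊎ Comp S (Gr (update V a (U a ⊖ y))) → Between S U V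
  decide (inj₁ b) _ = b
  decide (inj₂ _) (inj₁ b) = b
  decide (inj₂ cx) (inj₂ cy) = record
    { W = W ; comp = comp-split S V a cx cy cover
    ; mix = mix ; p = r ; q = a
    ; W≢U = λ e → Ur≢Vr (trans (sym e) (update-≢ V (≢-sym a≢r)))
    ; W≢V = λ e → Ua≢Va (trans (sym (update-≡ V a (U a))) e) }
    where
    W = update V a (U a)
    cover : ∀ {j} → j ∈ U a → j ∈ U a ⊖ x ⊎ j ∈ U a ⊖ y
    cover {j} m with j ≟ᶠ x
    ... | yes refl = inj₂ (∈-⊖ m x≢y)
    ... | no ne    = inj₁ (∈-⊖ m ne)
    mix : Mix U V W
    mix i with i ≟ᶠ a
    ... | yes refl = inj₁ refl
    ... | no _     = inj₂ refl

-- Tope elimination at `a` leaves both values of `a` admissible. If the result differs from `V`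
-- somewhere off `a`, the value of `V` at `a` makes it differ from both ends. Otherwise it is `V`
-- off `a`, and the value of `U` at `a` serves, with `r` telling it apart from `U`.
between-topes : (S : Sys n d) (U V : Fin n → Subset d) → Comp S (Gr U) → Comp S (Gr V) →
  (∀ i → Nonempty (U i)) → (∀ i → Nonempty (V i)) → (∀ i → ¬ Multi (U i)) → (∀ i → ¬ Multi (V i)) →
  (a r : Fin n) → a ≢ r → U a ≢ V a → U r ≢ V r → Between S U V
between-topes {n} {d} S U V cU cV neU neV sU sV a r a≢r Ua≢Va Ur≢Vr = decide (any? λ i → ¬? (i ≟ᶠ a) ×-dec ¬? (X i ≟ᶠ v i))
  where
  u v : Fin n → Fin d
  u i = proj₁ (neU i)
  v i = proj₁ (neV i)
  onlyU : ∀ {i j} → j ∈ U i → u i ≡ j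
  onlyU {i} {j} m with u i ≟ᶠ j
  ... | yes e = e
  ... | no ne = contradiction (u i , j , proj₂ (neU i) , m , ne) (sU i)
  onlyV : ∀ {i j} → j ∈ V i → v i ≡ j
  onlyV {i} {j} m with v i ≟ᶠ j
  ... | yes e = e
  ... | no ne = contradiction (v i , j , proj₂ (neV i) , m , ne) (sV i)
  same : ∀ {i} → u i ≡ v i → U i ≡ V i
  same {i} e = ⊆-antisym
    (λ m → subst (_∈ V i) (trans (sym e) (onlyU m)) (proj₂ (neV i)))
    (λ m → subst (_∈ U i) (trans e (onlyV m)) (proj₂ (neU i)))
  el = eliminate-topes S u v (comp-mono S (λ { refl → proj₂ (neU _) }) cU) (comp-mono S (λ { refl → proj₂ (neV _) }) cV)
         a λ e → Ua≢Va (same e)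
  X = proj₁ el
  mixX = proj₁ (proj₂ el)
  T : Fin n → Subset d
  T i = if does (X i ≟ᶠ v i) then V i else U i
  TV : ∀ {i} → X i ≡ v i → T i ≡ V i
  TV {i} e rewrite dec-true (X i ≟ᶠ v i) e = refl
  TU : ∀ {i} → X i ≢ v i → T i ≡ U i
  TU {i} e rewrite dec-false (X i ≟ᶠ v i) e = refl
  T-X : ∀ {i j} → j ∈ T i → X i ≡ j
  T-X {i} {j} m with X i ≟ᶠ v i
  ... | yes e = trans e (onlyV m)
  ... | no ne = case mixX i of λ { (inj₁ e) → trans e (onlyU m) ; (inj₂ e) → contradiction e ne }
  mixT : ∀ B → B ≡ U a ⊎ B ≡ V a → Mix U V (update T a B)
  mixT B h i with i ≟ᶠ a
  ... | yes refl = h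
  ... | no _ with X i ≟ᶠ v i
  ...   | yes _ = inj₂ refl
  ...   | no _  = inj₁ refl
  compU : Comp S (Gr (update T a (U a)))
  compU = comp-mono S (λ {i} {j} → below i j) (proj₁ (proj₂ (proj₂ el)))
    where
    below : ∀ i j → j ∈ update T a (U a) i → (i ≢ a × X i ≡ j) ⊎ (i ≡ a × j ≡ u a)
    below i j m with i ≟ᶠ a
    ... | yes refl = inj₂ (refl , sym (onlyU m))
    ... | no ne    = inj₁ (ne , T-X m)
  compV : Comp S (Gr (update T a (V a)))
  compV = comp-mono S (λ {i} {j} → below i j) (proj₂ (proj₂ (proj₂ el)))
    where
    below : ∀ i j → j ∈ update T a (V a) i → (i ≢ a × X i ≡ j) ⊎ (i ≡ a × j ≡ v a)
    below i j m with i ≟ᶠ a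
    ... | yes refl = inj₂ (refl , sym (onlyV m))
    ... | no ne    = inj₁ (ne , T-X m)
  decide : Dec (∃[ i ] i ≢ a × X i ≢ v i) → Between S U V
  decide (yes (q , q≢a , ne)) = record
    { W = update T a (V a) ; comp = compV ; mix = mixT (V a) (inj₂ refl) ; p = a ; q = q
    ; W≢U = λ e → Ua≢Va (sym (trans (sym (update-≡ T a (V a))) e))
    ; W≢V = λ e → ne (trans (T-X (subst (u q ∈_) (sym (TU ne)) (proj₂ (neU q))))
                     (sym (onlyV (subst (u q ∈_) (trans (sym (TU ne)) (trans (sym (update-≢ T q≢a)) e)) (proj₂ (neU q)))))) }
  decide (no nope) = record
    { W = update T a (U a) ; comp = compU ; mix = mixT (U a) (inj₁ refl) ; p = r ; q = a
    ; W≢U = λ e → Ur≢Vr (trans (sym e) (trans (update-≢ T (≢-sym a≢r)) (TV Xr)))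
    ; W≢V = λ e → Ua≢Va (trans (sym (update-≡ T a (U a))) e) }
    where
    Xr : X r ≡ v r
    Xr with X r ≟ᶠ v r
    ... | yes e = e
    ... | no ne = contradiction (r , ≢-sym a≢r , ne) nope

private
  dist-update : ∀ (U V : Fin n → Subset d) a B → U a ≢ V a → dist (update U a B) V ≤ dist U V
  dist-update U V a B ne = total-mono le
    where
    le : ∀ i → δ (update U a B i) (V i) ≤ δ (U i) (V i)
    le i with i ≟ᶠ a
    ... | yes refl = ℕ.≤-trans (δ≤1 B (V i)) (ℕ.≤-reflexive (sym (δ-≢ ne)))
    ... | no _     = ℕ.≤-refl

  update-⊖-⊆ : ∀ (U : Fin n → Subset d) a {x} i → update U a (U a ⊖ x) i ⊆ U i
  update-⊖-⊆ U a i m with i ≟ᶠ a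
  ... | yes refl = ⊖-⊆ (U i) m
  ... | no _     = m

  update-⊖-comp : (S : Sys n d) (U : Fin n → Subset d) → Comp S (Gr U) → ∀ a x → Comp S (Gr (update U a (U a ⊖ x)))
  update-⊖-comp S U cU a x = comp-mono S (λ {i} → update-⊖-⊆ U a i) cU

  update-⊖-nonempty : (U : Fin n → Subset d) → (∀ i → Nonempty (U i)) → ∀ a {x y} → y ∈ U a → x ≢ y →
                      ∀ i → Nonempty (update U a (U a ⊖ x) i)
  update-⊖-nonempty U ne a {x} {y} y∈ x≢y i with i ≟ᶠ a
  ... | yes refl = y , ∈-⊖ y∈ (≢-sym x≢y)
  ... | no _     = ne i

-- Lexicographic induction on bounds for the distance and the excess. A strict mix lowers the
-- distance for `eliminate`; `between` lowers the excess, by deleting an element or by moving it to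
-- a new copy. As doubling raises `n`, the ensemble is quantified inside the induction.
eliminate : ∀ m e {n} (S : Sys n d) (U V : Fin n → Subset d) → Comp S (Gr U) → Comp S (Gr V) →
  (∀ i → Nonempty (U i)) → (∀ i → Nonempty (V i)) → dist U V ≤ m → excess U + excess V ≤ e → ∀ a → Elim S U V a
between : ∀ m e {n} (S : Sys n d) (U V : Fin n → Subset d) → Comp S (Gr U) → Comp S (Gr V) →
  (∀ i → Nonempty (U i)) → (∀ i → Nonempty (V i)) → dist U V ≤ m → excess U + excess V ≤ e →
  ∀ a r → a ≢ r → U a ≢ V a → U r ≢ V r → Between S U V

eliminate m e S U V cU cV neU neV dm ee a with U a ≟ˢ V a
... | yes q = record { W = U ; comp = cU ; at = trans (sym (∪-idem (U a))) (cong (U a ∪_) q) ; off = λ _ _ → inj₁ refl }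
... | no Ua≢Va with any? (λ r → ¬? (a ≟ᶠ r) ×-dec ¬? (U r ≟ˢ V r))
...   | no nope = record
        { W = update U a (U a ∪ V a)
        ; comp = comp-split S U a (comp-mono S (λ {i} m → belowU i m) cU) (comp-mono S (λ {i} m → belowV i m) cV) (x∈p∪q⁻ (U a) (V a))
        ; at = update-≡ U a _ ; off = λ i ne → inj₁ (update-≢ U ne) }
  where
  belowU : ∀ i {j} → j ∈ update U a (U a) i → j ∈ U i
  belowU i m with i ≟ᶠ a
  ... | yes refl = m
  ... | no _     = m
  belowV : ∀ i {j} → j ∈ update U a (V a) i → j ∈ V i
  belowV i m with i ≟ᶠ a
  ... | yes refl = m
  ... | no ne with U i ≟ˢ V i
  ...   | yes e = subst (_ ∈_) e m
  ...   | no ne′ = contradiction (i , ≢-sym ne , ne′) nope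
eliminate zero e S U V cU cV neU neV dm ee a | no Ua≢Va | yes (r , a≢r , Ur≢Vr) =
  contradiction (ℕ.≤-trans (dist-mix {U = U} {V} {V} (λ _ → inj₂ refl) a (≢-sym Ua≢Va)) dm) λ ()
eliminate (suc m) e S U V cU cV neU neV dm ee a | no Ua≢Va | yes (r , a≢r , Ur≢Vr)
  with between (suc m) e S U V cU cV neU neV dm ee a r a≢r Ua≢Va Ur≢Vr
... | b = finish (B.mix a)
  where
  module B = Between b
  neW : ∀ i → Nonempty (B.W i)
  neW i = case B.mix i of λ { (inj₁ e) → subst Nonempty (sym e) (neU i) ; (inj₂ e) → subst Nonempty (sym e) (neV i) }
  swapped : Mix V U B.W
  swapped i = case B.mix i of λ { (inj₁ e) → inj₂ e ; (inj₂ e) → inj₁ e }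
  -- The mix agrees at `a` with one end, so eliminating between it and the other end still produces
  -- the union `U a ∪ V a`.
  finish : B.W a ≡ U a ⊎ B.W a ≡ V a → Elim S U V a
  finish (inj₁ q) = record
    { W = X.W ; comp = X.comp ; at = trans X.at (cong (_∪ V a) q)
    ; off = λ i ne → case X.off i ne of λ { (inj₁ e) → case B.mix i of λ { (inj₁ e′) → inj₁ (trans e e′) ; (inj₂ e′) → inj₂ (trans e e′) } ; (inj₂ e) → inj₂ e } }
    where
    module X = Elim (eliminate m (excess B.W + excess V) S B.W V B.comp cV neW neV
      (s≤s⁻¹ (ℕ.≤-trans (dist-mix {U = U} {V} {B.W} B.mix B.p B.W≢U) dm)) ℕ.≤-refl a)
  finish (inj₂ q) = record
    { W = X.W ; comp = X.comp ; at = trans X.at (cong (U a ∪_) q)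
    ; off = λ i ne → case X.off i ne of λ { (inj₂ e) → case B.mix i of λ { (inj₁ e′) → inj₁ (trans e e′) ; (inj₂ e′) → inj₂ (trans e e′) } ; (inj₁ e) → inj₁ e } }
    where
    module X = Elim (eliminate m (excess U + excess B.W) S U B.W cU B.comp neU neW
      (s≤s⁻¹ (ℕ.≤-trans (s≤s (total-mono λ i → δ-sym (U i) (B.W i)))
        (ℕ.≤-trans (dist-mix {U = V} {U} {B.W} swapped B.q B.W≢V)
          (ℕ.≤-trans (total-mono λ i → δ-sym (V i) (U i)) dm)))) ℕ.≤-refl a)

between m e S U V cU cV neU neV dm ee a r a≢r Ua≢Va Ur≢Vr
  with any? (λ i → multi? (U i)) | any? (λ i → multi? (V i))
... | no sU | no sV = between-topes S U V cU cV neU neV (λ i h → sU (i , h)) (λ i h → sV (i , h)) a r a≢r Ua≢Va Ur≢Vr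
between m zero S U V cU cV neU neV dm ee a r a≢r Ua≢Va Ur≢Vr | yes (i , x , y , x∈ , y∈ , x≢y) | _ =
  contradiction (ℕ.≤-trans (excess-⊖ U i x∈ y∈ x≢y) (ℕ.≤-trans (ℕ.m≤m+n (excess U) (excess V)) ee)) λ ()
between m zero S U V cU cV neU neV dm ee a r a≢r Ua≢Va Ur≢Vr | no _ | yes (i , x , y , x∈ , y∈ , x≢y) =
  contradiction (ℕ.≤-trans (excess-⊖ V i x∈ y∈ x≢y) (ℕ.≤-trans (ℕ.m≤n+m (excess V) (excess U)) ee)) λ ()
between {d = d} m (suc e) {n} S U V cU cV neU neV dm ee a r a≢r Ua≢Va Ur≢Vr | yes (i , x , y , x∈ , y∈ , x≢y) | _ with U i ≟ˢ V i
... | yes q = between-shared S U V i q x∈ y∈ x≢y split (λ _ → refl) (λ _ _ → refl)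
      (between m e double (split U) (split V) (split-comp U cU x∈) (split-comp V cV x∈V)
        (split-ne U neU y∈) (split-ne V neV y∈V) (ℕ.≤-trans dist-split dm) ex-split (suc a) (suc r)
        (λ { refl → a≢r refl }) (away a Ua≢Va) (away r Ur≢Vr))
  where
  open Double S i (first x) using (double; double-comp)
  split : (Fin n → Subset d) → Fin (suc n) → Subset d
  split T zero    = ⁅ x ⁆
  split T (suc k) = update T i (T i ⊖ x) k
  x∈V = subst (x ∈_) q x∈
  y∈V = subst (y ∈_) q y∈
  split-comp : ∀ T → Comp S (Gr T) → x ∈ T i → Comp double (Gr (split T))
  split-comp T cT x∈ = double-comp cT (λ {k} → update-⊖-⊆ T i k) (λ m → subst (_∈ T i) (sym (x∈⁅y⁆⇒x≡y x m)) x∈)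
    λ {j} {k} m m′ → inj₂ (inj₁ (x∈⁅y⁆⇒x≡y x m , ⊖-≢ (T i) (subst (k ∈_) (update-≡ T i _) m′)))
  split-ne : ∀ T → (∀ k → Nonempty (T k)) → y ∈ T i → ∀ k → Nonempty (split T k)
  split-ne T ne y∈ zero    = x , x∈⁅x⁆ x
  split-ne T ne y∈ (suc k) = update-⊖-nonempty T ne i y∈ x≢y k
  dist-split : dist (split U) (split V) ≤ dist U V
  dist-split = ℕ.≤-trans (ℕ.≤-reflexive (cong (_+ total (λ k → δ (split U (suc k)) (split V (suc k)))) (δ-≡ {p = ⁅ x ⁆} refl)))
                 (total-mono le)
    where
    le : ∀ k → δ (split U (suc k)) (split V (suc k)) ≤ δ (U k) (V k)
    le k with k ≟ᶠ i
    ... | yes refl = ℕ.≤-trans (ℕ.≤-reflexive (δ-≡ (cong (_⊖ x) q))) z≤n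
    ... | no _     = ℕ.≤-refl
  ex-split₁ : ∀ T → x ∈ T i → y ∈ T i → excess (split T) < excess T
  ex-split₁ T x∈ y∈ = ℕ.≤-trans (ℕ.≤-reflexive (cong (λ z → suc ((z ∸ 1) + excess (update T i (T i ⊖ x)))) (∣⁅x⁆∣≡1 x)))
                        (excess-⊖ T i x∈ y∈ x≢y)
  ex-split : excess (split U) + excess (split V) ≤ e
  ex-split = s≤s⁻¹ (ℕ.≤-trans (ℕ.+-mono-<-≤ (ex-split₁ U x∈ y∈) (ℕ.<⇒≤ (ex-split₁ V x∈V y∈V))) ee)
  away : ∀ k → U k ≢ V k → split U (suc k) ≢ split V (suc k)
  away k ne with k ≟ᶠ i
  ... | yes refl = contradiction q ne
  ... | no _     = ne
... | no Ui≢Vi = case other of λ (s , i≢s , Us≢Vs) → between-multi S U V i s i≢s Ui≢Vi Us≢Vs x≢y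
      (el x∈ y∈ x≢y) (el y∈ x∈ (≢-sym x≢y))
  where
  other : ∃[ s ] i ≢ s × U s ≢ V s
  other with i ≟ᶠ a
  ... | yes refl = r , a≢r , Ur≢Vr
  ... | no i≢a   = a , i≢a , Ua≢Va
  el : ∀ {x y} → x ∈ U i → y ∈ U i → x ≢ y → Elim S (update U i (U i ⊖ x)) V i
  el {x} x∈ y∈ x≢y = eliminate m e S (update U i (U i ⊖ x)) V (update-⊖-comp S U cU i x) cV
    (update-⊖-nonempty U neU i y∈ x≢y) neV (ℕ.≤-trans (dist-update U V i _ Ui≢Vi) dm)
    (s≤s⁻¹ (ℕ.≤-trans (ℕ.+-monoˡ-< (excess V) (excess-⊖ U i x∈ y∈ x≢y)) ee)) i
between {d = d} m (suc e) {n} S U V cU cV neU neV dm ee a r a≢r Ua≢Va Ur≢Vr | no sU | yes (i , x , y , x∈ , y∈ , x≢y) =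
    case other of λ (s , i≢s , Us≢Vs) → between-swap (between-multi S V U i s i≢s (≢-sym Ui≢Vi) (≢-sym Us≢Vs) x≢y
      (el x∈ y∈ x≢y) (el y∈ x∈ (≢-sym x≢y)))
  where
  Ui≢Vi : U i ≢ V i
  Ui≢Vi q = sU (i , x , y , subst (x ∈_) (sym q) x∈ , subst (y ∈_) (sym q) y∈ , x≢y)
  other : ∃[ s ] i ≢ s × U s ≢ V s
  other with i ≟ᶠ a
  ... | yes refl = r , a≢r , Ur≢Vr
  ... | no i≢a   = a , i≢a , Ua≢Va
  el : ∀ {x y} → x ∈ V i → y ∈ V i → x ≢ y → Elim S (update V i (V i ⊖ x)) U i
  el {x} x∈ y∈ x≢y = eliminate m e S (update V i (V i ⊖ x)) U (update-⊖-comp S V cV i x) cU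
    (update-⊖-nonempty V neV i y∈ x≢y) neU
    (ℕ.≤-trans (dist-update V U i _ (≢-sym Ui≢Vi)) (ℕ.≤-trans (total-mono λ k → δ-sym (V k) (U k)) dm))
    (s≤s⁻¹ (ℕ.≤-trans (ℕ.+-monoˡ-< (excess U) (excess-⊖ V i x∈ y∈ x≢y))
      (ℕ.≤-trans (ℕ.≤-reflexive (ℕ.+-comm (excess V) (excess U))) ee))) i

-- Tuples and matching ensembles

module _ {P : BiRel n d} (P? : ∀ i j → Dec (P i j)) where

  tuple : Tuple n d
  tuple = tabulate λ i → subset (P? i)

  tuple⁺ : P ⊑ G tuple
  tuple⁺ {i} {j} q = subst (j ∈_) (sym (lookup∘tabulate (λ i → subset (P? i)) i)) (subset⁺ (P? i) q)

  tuple⁻ : G tuple ⊑ P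
  tuple⁻ {i} {j} m = subset⁻ (P? i) (subst (j ∈_) (lookup∘tabulate (λ i → subset (P? i)) i) m)

tuple-ext : {T U : Tuple n d} → G T ⊑ G U → G U ⊑ G T → T ≡ U
tuple-ext {T = T} {U} f g = trans (sym (tabulate∘lookup T))
  (trans (tabulate-cong λ i → ⊆-antisym (λ {j} → f {i} {j}) (λ {j} → g {i} {j})) (tabulate∘lookup U))

module _ {I : Subset n} {J : Subset d} {T : Tuple n d} (h : IsPerfectMatching I J T) where
  open IsPerfectMatching h

  matching-pm : PM I J (G T)
  matching-pm = record
    { domˡ = proj₁ ∘ within ; domʳ = proj₂ ∘ within
    ; totˡ = λ m → case left _ m of λ (j , g , _) → j , g
    ; totʳ = λ m → case right _ m of λ (i , g , _) → i , g
    ; func = λ g g′ → case left _ (proj₁ (within g)) of λ (_ , _ , u) → trans (sym (u g)) (u g′)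
    ; inj  = λ g g′ → case right _ (proj₂ (within g)) of λ (_ , _ , u) → trans (sym (u g)) (u g′) }

pm-matching : {I : Subset n} {J : Subset d} {T : Tuple n d} → PM I J (G T) → IsPerfectMatching I J T
pm-matching p = record
  { within = λ g → PM.domˡ p g , PM.domʳ p g
  ; left = λ i m → case PM.totˡ p m of λ (j , g) → j , g , λ {y} q → PM.func p g q
  ; right = λ j m → case PM.totʳ p m of λ (i , g) → i , g , λ {y} q → PM.inj p g q }

pm-≐ : {I : Subset n} {J : Subset d} {P Q : BiRel n d} → PM I J P → P ⊑ Q → Q ⊑ P → PM I J Q
pm-≐ p f g = record
  { domˡ = λ q → PM.domˡ p (g q) ; domʳ = λ q → PM.domʳ p (g q)
  ; totˡ = λ m → case PM.totˡ p m of λ (j , q) → j , f q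
  ; totʳ = λ m → case PM.totʳ p m of λ (i , q) → i , f q
  ; func = λ q r → PM.func p (g q) (g r) ; inj = λ q r → PM.inj p (g q) (g r) }

pm-tuple : {I : Subset n} {J : Subset d} {P : BiRel n d} (p : PM I J P) → IsPerfectMatching I J (tuple (pm-dec p))
pm-tuple p = pm-matching (pm-≐ p (tuple⁺ (pm-dec p)) (tuple⁻ (pm-dec p)))

private
  two-of-three : ∀ {N : Subset n} {a b k} → ∣ N ∣ ≡ 2 → a ∈ N → b ∈ N → k ∈ N → a ≡ b ⊎ b ≡ k ⊎ a ≡ k
  two-of-three {N = N} {a} {b} {k} c a∈ b∈ k∈ with a ≟ᶠ b | b ≟ᶠ k | a ≟ᶠ k
  ... | yes e | _ | _ = inj₁ e
  ... | no _ | yes e | _ = inj₂ (inj₁ e)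
  ... | no _ | no _ | yes e = inj₂ (inj₂ e)
  ... | no ab | no bk | no ak = case trans (sym c) (trans (∣⊖∣ a∈) (cong suc (trans (∣⊖∣ (∈-⊖ b∈ (≢-sym ab)))
      (cong suc (∣⊖∣ (∈-⊖ (∈-⊖ k∈ (≢-sym ak)) (≢-sym bk))))))) of λ ()

  +1 : ∀ m → suc m ≡ m + 1
  +1 m = sym (ℕ.+-comm m 1)

module FromEnsemble (ℳ : MatchingEnsemble n d) where
  open MatchingEnsemble ℳ
  open IsMatchingEnsemble isMatchingEnsemble

  -- Carrying the equality of sizes inside the relation makes it available for all `I` and `J`, and
  -- empty when the sizes differ.
  Em : Subset n → Subset d → BiRel n d
  Em I J i j = Σ[ e ∈ ∣ I ∣ ≡ ∣ J ∣ ] G (M I J e) i j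

  em? : ∀ I J i j → Dec (Em I J i j)
  em? I J i j with ∣ I ∣ ℕ.≟ ∣ J ∣
  ... | no ne = no (ne ∘ proj₁)
  ... | yes e = map′ (e ,_) (λ (e′ , g) → subst (λ z → G (M I J z) i j) (ℕ.≡-irrelevant e′ e) g) (j ∈? lookup (M I J e) i)

  em-G : ∀ {I J i j} (e : ∣ I ∣ ≡ ∣ J ∣) → Em I J i j → G (M I J e) i j
  em-G {I} {J} {i} {j} e (e′ , g) = subst (λ z → G (M I J z) i j) (ℕ.≡-irrelevant e′ e) g

  pm-em : ∀ {I J} → ∣ I ∣ ≡ ∣ J ∣ → PM I J (Em I J)
  pm-em {I} {J} e = pm-≐ (matching-pm (matching I J e)) (λ g → e , g) (em-G {I} {J} e)

  sys : Sys n d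
  sys = record
    { E = Em ; pm = pm-em
    ; closure = λ {I} {J} {I′} {J′} {P} e p P⊑ {i} {j} q →
        let e′ = pm-card p
            M⊑ : G (M I′ J′ e′) ⊑ G (M I J e)
            M⊑ = closure e e′ (λ m → PM.domˡ (pm-em {I} {J} e) (P⊑ (proj₂ (PM.totˡ p m))))
                   (λ m → PM.domʳ (pm-em {I} {J} e) (P⊑ (proj₂ (PM.totʳ p m))))
                   (tuple (pm-dec p) , pm-tuple p , λ g → em-G {I} {J} e (P⊑ (tuple⁻ (pm-dec p) g)))
            t = PM.totˡ (pm-em {I′} {J′} e′) (PM.domˡ p q)
        in subst (Em I′ J′ i) (PM.func (pm-em {I} {J} e) (e , M⊑ (em-G {I′} {J′} e′ (proj₂ t))) (P⊑ q)) (proj₂ t)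
    ; R1 = λ {I} {J} {i} c x∈ y∈ z∈ p q r →
        let rl = rightLinkage I J (trans (sym (+1 ∣ I ∣)) (sym c))
            N = proj₂ rl i (PM.domˡ (pm-em (proj₁ p)) p)
            in-N : ∀ {x a} → x ∈ J → Em I (J ⊖ x) i a → a ∈ proj₁ N
            in-N x∈ p = Equivalence.from (proj₁ (proj₂ N) _) (_ , ⊖-⊆ J , p)
        in two-of-three (proj₂ (proj₂ N)) (in-N x∈ p) (in-N y∈ q) (in-N z∈ r)
    ; L1 = λ {I} {J} {j} c x∈ y∈ z∈ p q r →
        let ll = leftLinkage I J (trans c (+1 ∣ J ∣))
            N = proj₂ ll j (PM.domʳ (pm-em (proj₁ p)) p)
            in-N : ∀ {x a} → x ∈ I → Em (I ⊖ x) J a j → a ∈ proj₁ N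
            in-N x∈ p = Equivalence.from (proj₁ (proj₂ N) _) (_ , ⊖-⊆ I , p)
        in two-of-three (proj₂ (proj₂ N)) (in-N x∈ p) (in-N y∈ q) (in-N z∈ r) }

-- Linkage graphs are spanning trees

private
  next-cases : ∀ {k} (t : Fin (2 + k)) →
               (suc (toℕ t) < 2 + k × toℕ (next t) ≡ suc (toℕ t)) ⊎ (suc (toℕ t) ≡ 2 + k × toℕ (next t) ≡ 0)
  next-cases {k} t with ℕ.m≤n⇒m<n∨m≡n (toℕ<n t)
  ... | inj₁ l = inj₁ (l , trans (toℕ-fromℕ< _) (m<n⇒m%n≡m l))
  ... | inj₂ e = inj₂ (e , trans (toℕ-fromℕ< _) (trans (cong (_% (2 + k)) e) (n%n≡0 (2 + k))))

  next-inj : ∀ {k} {s t : Fin (2 + k)} → next s ≡ next t → s ≡ t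
  next-inj {s = s} {t} e with next-cases s | next-cases t
  ... | inj₁ (_ , p) | inj₁ (_ , q) = toℕ-injective (ℕ.suc-injective (trans (sym p) (trans (cong toℕ e) q)))
  ... | inj₁ (_ , p) | inj₂ (_ , q) = case trans (sym p) (trans (cong toℕ e) q) of λ ()
  ... | inj₂ (_ , p) | inj₁ (_ , q) = case trans (sym q) (trans (cong toℕ (sym e)) p) of λ ()
  ... | inj₂ (p , _) | inj₂ (q , _) = toℕ-injective (ℕ.suc-injective (trans p (sym q)))

  next-≢ : ∀ {k} (t : Fin (2 + k)) → next t ≢ t
  next-≢ t e with next-cases t
  ... | inj₁ (_ , p) = case ℕ.1+n≢n (trans (sym p) (cong toℕ e)) of λ ()
  ... | inj₂ (p , q) = case trans (cong suc (trans (sym q) (cong toℕ e))) p of λ ()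

  next-onto : ∀ {k} (t : Fin (2 + k)) → ∃[ s ] next s ≡ t
  next-onto t = case Bij.onto (bij-from-card {I = ⊤} {⊤} {next} ℕ.≤-refl (λ {s} _ → ∈⊤) λ _ _ → next-inj) ∈⊤ of
    λ (s , _ , e) → s , e

-- A cycle consists of two disjoint matchings with the same ends: its odd edges and its even edges.
acyclic-from-unique : {H : BiRel n d} →
  (∀ {I J P Q} → PM I J P → PM I J Q → P ⊑ H → Q ⊑ H → P ⊑ Q) → Acyclic H
acyclic-from-unique {n} {d} {H} uniq cyc = case uniq pmP pmQ (λ { (t , refl , refl) → a-b t }) (λ { (t , refl , refl) → b-a t }) (zero , refl , refl) of
    λ (s , p , q) → next-≢ zero (trans (cong next (sym (b-injective q))) (a-injective p))
  where
  open Cycle cyc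
  P Q : BiRel n d
  P i j = ∃[ t ] a t ≡ i × b t ≡ j
  Q i j = ∃[ t ] a (next t) ≡ i × b t ≡ j
  I′ = image a ⊤
  J′ = image b ⊤
  pmP : PM I′ J′ P
  pmP = record
    { domˡ = λ { (t , refl , _) → image⁺ a ⊤ ∈⊤ } ; domʳ = λ { (t , _ , refl) → image⁺ b ⊤ ∈⊤ }
    ; totˡ = λ m → case image⁻ a ⊤ m of λ (t , _ , e) → b t , t , e , refl
    ; totʳ = λ m → case image⁻ b ⊤ m of λ (t , _ , e) → a t , t , refl , e
    ; func = λ { (t , refl , refl) (s , e , refl) → cong b (a-injective (sym e)) }
    ; inj  = λ { (t , refl , refl) (s , refl , e) → cong a (b-injective (sym e)) } }
  pmQ : PM I′ J′ Q
  pmQ = record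
    { domˡ = λ { (t , refl , _) → image⁺ a ⊤ ∈⊤ } ; domʳ = λ { (t , _ , refl) → image⁺ b ⊤ ∈⊤ }
    ; totˡ = λ m → case image⁻ a ⊤ m of λ (t , _ , e) → case next-onto t of λ (s , e′) → b s , s , trans (cong a e′) e , refl
    ; totʳ = λ m → case image⁻ b ⊤ m of λ (t , _ , e) → a (next t) , t , refl , e
    ; func = λ { (t , refl , refl) (s , e , refl) → cong b (next-inj (a-injective (sym e))) }
    ; inj  = λ { (t , refl , refl) (s , refl , e) → cong (a ∘ next) (b-injective (sym e)) } }

comp-acyclic : (S : Sys n d) {H : BiRel n d} → Comp S H → Acyclic H
comp-acyclic S cH = acyclic-from-unique λ p q P⊑ Q⊑ →
  pm-⊒ q (Sys.pm S (pm-card p)) (cH q Q⊑) ∘ cH p P⊑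

module _ (S : Sys n d) {I : Subset n} {J : Subset d} (c : ∣ J ∣ ≡ suc ∣ I ∣) where
  open Linkage S {I} {J} c
  open Sys S

  nb-degree : ∀ i → i ∈ I → HasLeftDegree (Nb S I J) i 2
  nb-degree i i∈ = subset (nb? i) , (λ j → mk⇔ (subset⁻ (nb? i)) (subset⁺ (nb? i))) , count
    where
    x = nb-other i∈ (proj₁ (∣∣-nonempty {p = J} c))
    y = nb-other i∈ (proj₁ x)
    N≡ : subset (nb? i) ≡ ⁅ proj₁ x ⁆ ⊕ proj₁ y
    N≡ = ⊆-antisym
      (λ {z} m → case nb-two (proj₁ (proj₂ x)) (proj₁ (proj₂ y)) (subset⁻ (nb? i) m) of λ
        { (inj₁ e) → contradiction (sym e) (proj₂ (proj₂ y))
        ; (inj₂ (inj₁ refl)) → ∈-⊕ ⁅ proj₁ x ⁆ z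
        ; (inj₂ (inj₂ refl)) → ⊆-⊕ ⁅ proj₁ x ⁆ (proj₁ y) (x∈⁅x⁆ z) })
      (λ m → case ⊕-inv ⁅ proj₁ x ⁆ (proj₁ y) m of λ
        { (inj₁ refl) → subset⁺ (nb? i) (proj₁ (proj₂ y))
        ; (inj₂ m′) → subst (_∈ subset (nb? i)) (sym (x∈⁅y⁆⇒x≡y _ m′)) (subset⁺ (nb? i) (proj₁ (proj₂ x))) })
    count : ∣ subset (nb? i) ∣ ≡ 2
    count = trans (cong ∣_∣ N≡) (trans (∣⊕∣ λ m → proj₂ (proj₂ y) (x∈⁅y⁆⇒x≡y _ m)) (cong suc (∣⁅x⁆∣≡1 (proj₁ x))))

  nb-acyclic : Acyclic (Nb S I J)
  nb-acyclic = acyclic-from-unique λ p q P⊑ Q⊑ → unique-pm p q (λ m → nb-domˡ (P⊑ (proj₂ (PM.totˡ p m)))) P⊑ Q⊑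

  private
    _~_ : Vertex n d → Vertex n d → Set
    _~_ = EqClosure (Adjacent (Nb S I J))
    _∙_ : ∀ {u v w} → u ~ v → v ~ w → u ~ w
    p ∙ q = transitive (Adjacent (Nb S I J)) p q
    back : ∀ {u v} → u ~ v → v ~ u
    back = symmetric (Adjacent (Nb S I J))
    step : ∀ {i j} → Nb S I J i j → inj₁ i ~ inj₂ j
    step e = fwd (edge e) ◅ []ʷ

    -- Alternate between M_{I,J-y} and M_{I,J-x}, starting from x.
    right-connected : ∀ {x y} → x ∈ J → y ∈ J → inj₂ x ~ inj₂ y
    right-connected {x} {y} x∈ y∈ with x ≟ᶠ y
    ... | yes refl = []ʷ
    ... | no x≢y = peel J′ (λ j → j ≡ y) nxt stay wf (λ K → ∀ {j} → j ∈ K → inj₂ j ~ inj₂ y) (λ m → contradiction m ∉⊥)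
                    (λ {j} {K} K⊆ j∈ j∉ t h m → case ⊕-inv K j m of λ { (inj₁ refl) → joined j∈ t h ; (inj₂ m′) → h m′ })
                    (subset⁺ J? (x∈ , inj₂ λ e → ⊖-≢ J (F.into (τ-I x∈ x≢y)) e))
      where
      fx = pm-fun (pm⊖ x∈) y
      f = proj₁ fx
      module F = Bij (proj₁ (proj₂ fx))
      f-E : ∀ {i} → i ∈ I → E I (J ⊖ x) i (f i)
      f-E = proj₂ (proj₂ fx)
      i₀ : Fin n
      i₀ = proj₁ (PM.totʳ (pm⊖ y∈) (∈-⊖ x∈ x≢y))
      ty = pm-fun (pm-flip (pm⊖ y∈)) i₀
      τ = proj₁ ty
      module T = Bij (proj₁ (proj₂ ty))
      τ-I : ∀ {j} → j ∈ J → j ≢ y → τ j ∈ I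
      τ-I j∈ ne = T.into (∈-⊖ j∈ ne)
      τ-E : ∀ {j} → j ∈ J → j ≢ y → E I (J ⊖ y) (τ j) j
      τ-E j∈ ne = proj₂ (proj₂ ty) (∈-⊖ j∈ ne)
      nxt : Fin d → Fin d
      nxt j = f (τ j)
      -- Columns fixed by `nxt` are excluded, as there the two matchings agree. The remaining rows
      -- have two different neighbours, as `escape` requires, and injectivity of the alternation
      -- keeps this set closed.
      J? : ∀ j → Dec (j ∈ J × (j ≡ y ⊎ nxt j ≢ j))
      J? j = (j ∈? J) ×-dec ((j ≟ᶠ y) ⊎-dec ¬? (nxt j ≟ᶠ j))
      J′ = subset J?
      nxt-J : ∀ {j} → j ∈ J → j ≢ y → nxt j ∈ J
      nxt-J j∈ ne = ⊖-⊆ J (F.into (τ-I j∈ ne))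
      stay : ∀ {j} → j ∈ J′ → j ≢ y → nxt j ∈ J′
      stay {j} m ne with subset⁻ J? m
      ... | j∈ , inj₁ e = contradiction e ne
      ... | j∈ , inj₂ mv with nxt j ≟ᶠ y
      ...   | yes e = subset⁺ J? (nxt-J j∈ ne , inj₁ e)
      ...   | no ne′ = subset⁺ J? (nxt-J j∈ ne , inj₂ λ e →
                mv (T.inj (∈-⊖ (nxt-J j∈ ne) ne′) (∈-⊖ j∈ ne) (F.inj (τ-I (nxt-J j∈ ne) ne′) (τ-I j∈ ne) e)))
      wf : ∀ {K} → K ⊆ J′ → Nonempty K → ∃[ j ] j ∈ K × (j ≡ y ⊎ (j ≢ y × nxt j ∉ K))
      wf {K} K⊆ (k , k∈) with y ∈? K
      ... | yes y∈K = y , y∈K , inj₁ refl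
      ... | no y∉K with escape g f K′⊆ (τ k , image⁺ τ K k∈) both
        where
        g : Fin n → Fin d
        g = proj₁ (pm-fun (pm⊖ y∈) y)
        g-E : ∀ {i} → i ∈ I → E I (J ⊖ y) i (g i)
        g-E = proj₂ (proj₂ (pm-fun (pm⊖ y∈) y))
        inK : ∀ {j} → j ∈ K → j ∈ J × j ≢ y × nxt j ≢ j
        inK {j} m = case subset⁻ J? (K⊆ m) of λ
          { (j∈ , inj₁ refl) → contradiction m y∉K
          ; (j∈ , inj₂ mv) → j∈ , (λ { refl → y∉K m }) , mv }
        K′⊆ : image τ K ⊆ I
        K′⊆ m = case image⁻ τ K m of λ { (j , m′ , refl) → case inK m′ of λ (j∈ , ne , _) → τ-I j∈ ne }
        gτ : ∀ {j} → j ∈ K → g (τ j) ≡ j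
        gτ m = case inK m of λ (j∈ , ne , _) → PM.func (pm⊖ y∈) (g-E (τ-I j∈ ne)) (τ-E j∈ ne)
        both : ∀ {i} → i ∈ image τ K → Nb S I J i (g i) × Nb S I J i (f i) × f i ≢ g i
        both m = (y , y∈ , g-E (K′⊆ m)) , (x , x∈ , f-E (K′⊆ m)) , λ e → case image⁻ τ K m of λ
          { (j , m′ , refl) → proj₂ (proj₂ (inK m′)) (trans e (gτ m′)) }
      ...   | i , i∈ , f∉ with image⁻ τ K i∈
      ...     | j , j∈K , refl = j , j∈K , inj₂ ((λ { refl → y∉K j∈K }) , λ m → f∉ (subst (_∈ image (proj₁ (pm-fun (pm⊖ y∈) y)) (image τ K))
                  (case subset⁻ J? (K⊆ m) of λ (n∈ , _) → PM.func (pm⊖ y∈)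
                     (proj₂ (proj₂ (pm-fun (pm⊖ y∈) y)) (τ-I n∈ λ e → y∉K (subst (_∈ K) e m)))
                     (τ-E n∈ λ e → y∉K (subst (_∈ K) e m)))
                  (image⁺ (proj₁ (pm-fun (pm⊖ y∈) y)) (image τ K) (image⁺ τ K m))))
      joined : ∀ {j K} → j ∈ J′ → (j ≡ y ⊎ (j ≢ y × nxt j ∈ K)) → (∀ {k} → k ∈ K → inj₂ k ~ inj₂ y) → inj₂ j ~ inj₂ y
      joined j∈ (inj₁ refl) h = []ʷ
      joined {j} m (inj₂ (ne , n∈)) h = case subset⁻ J? m of λ (j∈ , _) →
        back (step (y , y∈ , τ-E j∈ ne)) ∙ (step (x , x∈ , f-E (τ-I j∈ ne)) ∙ h n∈)

    to-right : ∀ u → u ∈ I ⊔ J → ∃[ j ] j ∈ J × u ~ inj₂ j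
    to-right (inj₁ i) m = case nb-other m (proj₁ (∣∣-nonempty {p = J} c)) of λ (j , e , _) → j , nb-domʳ e , step e
    to-right (inj₂ j) m = j , m , []ʷ

  nb-connected : ∀ u v → u ∈ I ⊔ J → v ∈ I ⊔ J → EqClosure (Adjacent (Nb S I J)) u v
  nb-connected u v mu mv = case to-right u mu of λ (x , x∈ , p) → case to-right v mv of λ (y , y∈ , q) →
    p ∙ (right-connected x∈ y∈ ∙ back q)

adjacent-map : {H K : BiRel n d} → H ⊑ K → ∀ {u v} → EqClosure (Adjacent H) u v → EqClosure (Adjacent K) u v
adjacent-map h []ʷ = []ʷ
adjacent-map h (fwd (edge e) ◅ p) = fwd (edge (h e)) ◅ adjacent-map h p
adjacent-map h (bwd (edge e) ◅ p) = bwd (edge (h e)) ◅ adjacent-map h p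

cycle-map : {H K : BiRel n d} → H ⊑ K → Cycle H → Cycle K
cycle-map h z = record { k = k ; a = a ; b = b ; a-injective = a-injective ; b-injective = b-injective
                       ; a-b = λ t → h (a-b t) ; b-a = λ t → h (b-a t) }
  where open Cycle z

private
  turn : Vertex n d → Vertex d n
  turn (inj₁ i) = inj₂ i
  turn (inj₂ j) = inj₁ j

adjacent-flip : {H : BiRel n d} → ∀ {u v} → EqClosure (Adjacent H) u v → EqClosure (Adjacent (flip′ H)) (turn u) (turn v)
adjacent-flip []ʷ = []ʷ
adjacent-flip (fwd (edge e) ◅ p) = bwd (edge e) ◅ adjacent-flip p
adjacent-flip (bwd (edge e) ◅ p) = fwd (edge e) ◅ adjacent-flip p

cycle-flip : {H : BiRel n d} → Cycle H → Cycle (flip′ H)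
cycle-flip z = record { k = k ; a = b ; b = a ∘ next ; a-injective = b-injective
                      ; b-injective = λ e → next-inj (a-injective e) ; a-b = b-a ; b-a = λ t → a-b (next t) }
  where open Cycle z

nb-tree : (S : Sys n d) {I : Subset n} {J : Subset d} → ∣ J ∣ ≡ suc ∣ I ∣ → {H : BiRel n d} →
          H ⊑ Nb S I J → Nb S I J ⊑ H → IsSpanningTree I J H
nb-tree S {I} {J} c h h⁻ = record
  { within = λ e → Linkage.nb-domˡ S {I} {J} c (h e) , Linkage.nb-domʳ S {I} {J} c (h e)
  ; connected = λ u v mu mv → adjacent-map h⁻ (nb-connected S {I} {J} c u v mu mv)
  ; acyclic = λ z → nb-acyclic S {I} {J} c (cycle-map h z) }

tree-flip : {I : Subset n} {J : Subset d} {H : BiRel n d} → IsSpanningTree J I (flip′ H) → IsSpanningTree I J H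
tree-flip {I = I} {J} {H} t = record
  { within = λ e → case T.within e of λ (a , b) → b , a
  ; connected = conn
  ; acyclic = λ z → T.acyclic (cycle-flip z) }
  where
  module T = IsSpanningTree t
  conn : ∀ u v → u ∈ I ⊔ J → v ∈ I ⊔ J → EqClosure (Adjacent H) u v
  conn (inj₁ u) (inj₁ v) a b = adjacent-flip (T.connected (inj₂ u) (inj₂ v) a b)
  conn (inj₁ u) (inj₂ v) a b = adjacent-flip (T.connected (inj₂ u) (inj₁ v) a b)
  conn (inj₂ u) (inj₁ v) a b = adjacent-flip (T.connected (inj₁ u) (inj₂ v) a b)
  conn (inj₂ u) (inj₂ v) a b = adjacent-flip (T.connected (inj₁ u) (inj₁ v) a b)

private
  co-singleton : ∀ {I : Subset n} {J J′ : Subset d} → ∣ J ∣ ≡ suc ∣ I ∣ → J′ ⊆ J → ∣ I ∣ ≡ ∣ J′ ∣ → ∃[ x ] x ∈ J × J′ ≡ J ⊖ x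
  co-singleton {I = I} {J} {J′} c J′⊆ e with any? (λ x → (x ∈? J) ×-dec ¬? (x ∈? J′))
  ... | yes (x , x∈ , x∉) = x , x∈ , ⊆-∣∣-≡ (λ m → ∈-⊖ (J′⊆ m) λ { refl → x∉ m })
          (ℕ.≤-reflexive (trans (sym (∣⊖∣-≡ {I = I} {J} c x∈)) e))
  ... | no ¬x = contradiction (ℕ.≤-trans (ℕ.≤-reflexive (sym c))
          (ℕ.≤-trans (p⊆q⇒∣p∣≤∣q∣ {p = J} {J′} λ {x} m → case x ∈? J′ of λ { (yes h) → h ; (no h) → contradiction (x , m , h) ¬x })
            (ℕ.≤-reflexive (sym e)))) (ℕ.<-irrefl refl)

toEnsemble : Sys n d → MatchingEnsemble n d
toEnsemble {n} {d} S = record { M = M ; isMatchingEnsemble = record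
    { matching = λ I J e → pm-tuple (pm e)
    ; closure = λ {I} {J} {I′} {J′} e e′ _ _ (P , h , P⊑) g →
        P⊑ (pm-⊒ (matching-pm h) (pm {I′} {J′} e′) (closure e (matching-pm h) (λ q → out {I} {J} e (P⊑ q))) (out {I′} {J′} e′ g))
    ; leftLinkage = λ I J c → let c′ = trans c (sym (+1 ∣ J ∣)) in
        tree-flip (nb-tree (S ᵀ) {J} {I} c′ (lu {I} {J} c′) (ul {I} {J} c′)) ,
        λ j m → case nb-degree (S ᵀ) {J} {I} c′ j m of λ (N , h , e) → N ,
          (λ i → mk⇔ (λ q → ul {I} {J} c′ (Equivalence.to (h i) q)) (λ q → Equivalence.from (h i) (lu {I} {J} c′ q))) , e
    ; rightLinkage = λ I J c → let c′ = trans (sym c) (sym (+1 ∣ I ∣)) in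
        nb-tree S {I} {J} c′ (ru {I} {J} c′) (ur {I} {J} c′) ,
        λ i m → case nb-degree S {I} {J} c′ i m of λ (N , h , e) → N ,
          (λ j → mk⇔ (λ q → ur {I} {J} c′ (Equivalence.to (h j) q)) (λ q → Equivalence.from (h j) (ru {I} {J} c′ q))) , e } }
  where
  open Sys S
  M : Family n d
  M I J e = tuple (pm-dec (pm {I} {J} e))
  out : ∀ {I J} (e : ∣ I ∣ ≡ ∣ J ∣) → G (M I J e) ⊑ E I J
  out {I} {J} e = tuple⁻ (pm-dec (pm {I} {J} e))
  into : ∀ {I J} (e : ∣ I ∣ ≡ ∣ J ∣) → E I J ⊑ G (M I J e)
  into {I} {J} e = tuple⁺ (pm-dec (pm {I} {J} e))
  ru : ∀ {I J} → ∣ J ∣ ≡ suc ∣ I ∣ → rightUnion M I J ⊑ Nb S I J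
  ru {I} {J} c (J′ , J′⊆ , e , g) with co-singleton {I = I} {J} {J′} c J′⊆ e
  ... | x , x∈ , refl = x , x∈ , out {I} {J ⊖ x} e g
  ur : ∀ {I J} → ∣ J ∣ ≡ suc ∣ I ∣ → Nb S I J ⊑ rightUnion M I J
  ur {I} {J} c (x , x∈ , e) = J ⊖ x , ⊖-⊆ J , ∣⊖∣-≡ {I = I} {J} c x∈ , into {I} {J ⊖ x} (∣⊖∣-≡ {I = I} {J} c x∈) e
  lu : ∀ {I J} → ∣ I ∣ ≡ suc ∣ J ∣ → flip′ (leftUnion M I J) ⊑ Nb (S ᵀ) J I
  lu {I} {J} c (I′ , I′⊆ , e , g) with co-singleton {I = J} {I} {I′} c I′⊆ (sym e)
  ... | x , x∈ , refl = x , x∈ , out {I ⊖ x} {J} e g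
  ul : ∀ {I J} → ∣ I ∣ ≡ suc ∣ J ∣ → Nb (S ᵀ) J I ⊑ flip′ (leftUnion M I J)
  ul {I} {J} c (x , x∈ , e) = I ⊖ x , ⊖-⊆ I , sym (∣⊖∣-≡ {I = J} {I} c x∈) , into {I ⊖ x} {J} (sym (∣⊖∣-≡ {I = J} {I} c x∈)) e

-- From matching ensembles to tropical oriented matroids

private
  all-subsets? : {P : Subset n → Set} → (∀ I → Dec (P I)) → Dec (∀ I → P I)
  all-subsets? P? with anySubset? (λ I → ¬? (P? I))
  ... | yes (I , ¬p) = no λ h → ¬p (h I)
  ... | no h = yes λ I → case P? I of λ { (yes p) → p ; (no ¬p) → contradiction (I , ¬p) h }

  all-vectors? : ∀ n {P : Vec (Fin d) n → Set} → (∀ v → Dec (P v)) → Dec (∀ v → P v)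
  all-vectors? zero    P? = map′ (λ p → λ { [] → p }) (λ h → h []) (P? [])
  all-vectors? (suc n) P? = map′ (λ h → λ { (x ∷ v) → h x v }) (λ h x v → h (x ∷ v))
    (all? λ x → all-vectors? n λ v → P? (x ∷ v))

module ToTOM (ℳ : MatchingEnsemble n d) where
  open FromEnsemble ℳ

  -- The image of v on I plays the part of J̄, which makes compatibility with ℳ
  -- decidable.
  Agrees : Tuple n d → Subset n → Vec (Fin d) n → Set
  Agrees T I v = (∀ i → i ∈ I → lookup v i ∈ lookup T i) →
    (∀ i → i ∈ I → ∀ i′ → i′ ∈ I → lookup v i ≡ lookup v i′ → i ≡ i′) →
    ∀ i → i ∈ I → Em I (image (lookup v) I) i (lookup v i)

  agrees? : ∀ T I v → Dec (Agrees T I v)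
  agrees? T I v = (all? λ i → (i ∈? I) →-dec (lookup v i ∈? lookup T i)) →-dec
    ((all? λ i → (i ∈? I) →-dec (all? λ i′ → (i′ ∈? I) →-dec ((lookup v i ≟ᶠ lookup v i′) →-dec (i ≟ᶠ i′)))) →-dec
    (all? λ i → (i ∈? I) →-dec em? I (image (lookup v) I) i (lookup v i)))

  Member : Tuple n d → Set
  Member T = IsType T × (∀ I v → Agrees T I v)

  member? : ∀ T → Dec (Member T)
  member? T = (all? λ i → any? λ j → j ∈? lookup T i) ×-dec (all-subsets? λ I → all-vectors? n (agrees? T I))

  member-comp : ∀ {T} → Member T → Comp sys (G T)
  member-comp {T} (_ , h) {I} {J} {P} p P⊑ {i} {j} q =
    subst (Em I J i) (PM.func p (P-v i∈) q) (subst (λ K → Em I K i (lookup v i)) im≡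
      (h I v (λ k m → P⊑ (P-v m)) (λ k m k′ m′ e → PM.inj p (P-v m) (subst (P k′) (sym e) (P-v m′))) i i∈))
    where
    i∈ = PM.domˡ p q
    pf = pm-fun p j
    v = tabulate (proj₁ pf)
    P-v : ∀ {k} → k ∈ I → P k (lookup v k)
    P-v {k} m = subst (P k) (sym (lookup∘tabulate (proj₁ pf) k)) (proj₂ (proj₂ pf) m)
    im≡ : image (lookup v) I ≡ J
    im≡ = ⊆-antisym (λ m → case image⁻ (lookup v) I m of λ { (k , k∈ , refl) → PM.domʳ p (P-v k∈) })
      (λ m → case PM.totʳ p m of λ (k , r) → subst (_∈ image (lookup v) I) (PM.func p (P-v (PM.domˡ p r)) r) (image⁺ (lookup v) I (PM.domˡ p r)))

  comp-member : ∀ {T} → IsType T → Comp sys (G T) → Member T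
  comp-member ty c = ty , λ I v h inj i i∈ → c
    (bij-pm record { into = image⁺ (lookup v) I ; inj = λ m m′ → inj _ m _ m′ ; onto = image⁻ (lookup v) I })
    (λ { (m , refl) → h _ m }) (i∈ , refl)

  tom : GenericTOM n d
  tom = record
    { collection = Member
    ; decidable = member?
    ; isGenericTOM = record
      { types = proj₁
      ; acyclic = λ {T} m → comp-acyclic sys (member-comp {T} m)
      ; boundary = λ j → comp-member {replicate n ⁅ j ⁆} (λ i → j , subst (j ∈_) (sym (lookup-replicate i ⁅ j ⁆)) (x∈⁅x⁆ j)) (constant j)
      ; surrounding = λ {T} {T′} m ty h → comp-member {T′} ty (comp-mono sys h (member-comp {T} m))
      ; compatibility = λ {U} {V} mU mV I J P Q hP P⊑ hQ Q⊑ →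
          let P⊑E = member-comp {U} mU (matching-pm hP) P⊑
              Q⊑E = member-comp {V} mV (matching-pm hQ) Q⊑
              e = pm-card (matching-pm hP)
          in tuple-ext (λ q → pm-⊒ (matching-pm hQ) (pm-em e) Q⊑E (P⊑E q)) (λ q → pm-⊒ (matching-pm hP) (pm-em e) P⊑E (Q⊑E q))
      ; elimination = λ {U} {V} → elim {U} {V} } }
    where
    -- A matching inside a constant type has at most one edge, and its ends determine it.
    constant : ∀ j → Comp sys (G (replicate n ⁅ j ⁆))
    constant j {I} {J} {P} p P⊑ {i} {k} q with PM.totˡ (pm-em (pm-card p)) (PM.domˡ p q)
    ... | l , e with PM.totʳ p (PM.domʳ (pm-em (pm-card p)) e)
    ...   | i′ , r = subst (Em I J i) (trans (at r) (sym (at q))) e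
      where
      at : ∀ {i k} → P i k → k ≡ j
      at {i} {k} q = x∈⁅y⁆⇒x≡y j (subst (k ∈_) (lookup-replicate i ⁅ j ⁆) (P⊑ q))
    elim : ∀ {U V} → Member U → Member V → ∀ a → ∃[ W ] Member W × lookup W a ≡ lookup U a ∪ lookup V a ×
           (∀ i → i ≢ a → lookup W i ≡ lookup U i ⊎ lookup W i ≡ lookup V i)
    elim {U} {V} mU mV a = tabulate X.W
      , comp-member {tabulate X.W} (λ i → subst Nonempty (sym (lW i)) (ne i)) (comp-mono sys (λ {i} {j} → subst (j ∈_) (lW i)) X.comp)
      , trans (lW a) X.at
      , λ i i≢a → case X.off i i≢a of λ { (inj₁ e) → inj₁ (trans (lW i) e) ; (inj₂ e) → inj₂ (trans (lW i) e) }
      where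
      module X = Elim (eliminate (dist (lookup U) (lookup V)) (excess (lookup U) + excess (lookup V)) sys (lookup U) (lookup V)
        (member-comp {U} mU) (member-comp {V} mV) (proj₁ mU) (proj₁ mV) ℕ.≤-refl ℕ.≤-refl a)
      lW : ∀ i → lookup (tabulate X.W) i ≡ X.W i
      lW i = lookup∘tabulate X.W i
      ne : ∀ i → Nonempty (X.W i)
      ne i with i ≟ᶠ a
      ... | yes refl = case proj₁ mU i of λ (j , m) → j , subst (j ∈_) (sym X.at) (x∈p∪q⁺ (inj₁ m))
      ... | no i≢a   = case X.off i i≢a of λ
        { (inj₁ e) → subst Nonempty (sym e) (proj₁ mU i) ; (inj₂ e) → subst Nonempty (sym e) (proj₁ mV i) }

-- Matchings in graphs without two matchings on the same ends

-- The form in which acyclicity of a type is used; it is compatibility of the type with itself.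
UniquePM : BiRel n d → Set₁
UniquePM {n} {d} H = ∀ {I J P Q} → PM {n} {d} I J P → PM I J Q → P ⊑ H → Q ⊑ H → P ⊑ Q

-- A nonempty set of nonterminal rows closed under `nxt` has a core that `nxt` permutes. On this
-- core `p` and `p ∘ nxt` give two matchings with the same ends that differ in every row.
alternating-wf : {H : BiRel n d} → UniquePM H → (p s : Fin n → Fin d) (nxt : Fin n → Fin n) (I : Subset n) (Term : Fin n → Set) →
  (∀ i → Dec (Term i)) → (∀ {i k} → i ∈ I → k ∈ I → p i ≡ p k → i ≡ k) → (∀ {i} → i ∈ I → H i (p i)) →
  (∀ {i} → i ∈ I → ¬ Term i → H i (s i) × s i ≢ p i × p (nxt i) ≡ s i) →
  ∀ {K} → K ⊆ I → Nonempty K → ∃[ i ] i ∈ K × (Term i ⊎ (¬ Term i × nxt i ∉ K))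
alternating-wf {H = H} uniq p s nxt I Term term? p-inj Hp Hs {K} K⊆ ne
  with any? (λ i → (i ∈? K) ×-dec term? i)
... | yes (i , i∈ , t) = i , i∈ , inj₁ t
... | no nt with any? (λ i → (i ∈? K) ×-dec ¬? (nxt i ∈? K))
...   | yes (i , i∈ , h) = i , i∈ , inj₂ ((λ t → nt (i , i∈ , t)) , h)
...   | no closed with bijective-core nxt ∣ K ∣ K ℕ.≤-refl ne (λ {x} x∈ → case nxt x ∈? K of λ
          { (yes h) → h ; (no h) → contradiction (x , x∈ , h) closed })
...     | K′ , K′⊆ , (k , k∈) , b = ⊥-elim (proj₁ (proj₂ (on-edge k∈)) (trans (sym (proj₂ (proj₂ (on-edge k∈)))) (proj₂ same)))
  where
  module B = Bij b
  on-edge : ∀ {i} → i ∈ K′ → H i (s i) × s i ≢ p i × p (nxt i) ≡ s i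
  on-edge m = Hs (K⊆ (K′⊆ m)) λ t → nt (_ , K′⊆ m , t)
  bp : Bij K′ (image p K′) p
  bp = record { into = image⁺ p K′ ; inj = λ m m′ → p-inj (K⊆ (K′⊆ m)) (K⊆ (K′⊆ m′)) ; onto = image⁻ p K′ }
  bs : Bij K′ (image p K′) (p ∘ nxt)
  bs = record
    { into = λ m → image⁺ p K′ (B.into m)
    ; inj = λ m m′ e → B.inj m m′ (p-inj (K⊆ (K′⊆ (B.into m))) (K⊆ (K′⊆ (B.into m′))) e)
    ; onto = λ m → case image⁻ p K′ m of λ { (i , i∈ , refl) → case B.onto i∈ of λ (l , l∈ , e) → l , l∈ , cong p e } }
  same : k ∈ K′ × p (nxt k) ≡ p k
  same = uniq (bij-pm bp) (bij-pm bs) (λ { (m , refl) → Hp (K⊆ (K′⊆ m)) })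
    (λ { (m , refl) → subst (H _) (sym (proj₂ (proj₂ (on-edge m)))) (proj₁ (on-edge m)) }) (k∈ , refl)

Branching : BiRel n d → Fin n → Set
Branching H i = ∃[ a ] ∃[ b ] H i a × H i b × a ≢ b

other-edge : {H : BiRel n d} → ∀ {i} → Branching H i → ∀ x → ∃[ c ] H i c × c ≢ x
other-edge (a , b , p , q , a≢b) x with a ≟ᶠ x
... | yes refl = b , q , ≢-sym a≢b
... | no a≢x   = a , p , a≢x

-- Adding the edge (r, k) to a matching and pushing the occupant of k along.
module Augment {H : BiRel n d} (uniq : UniquePM H) {I : Subset n} (p : Fin n → Fin d)
  (p-inj : ∀ {i k} → i ∈ I → k ∈ I → p i ≡ p k → i ≡ k) (Hp : ∀ {i} → i ∈ I → H i (p i))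
  (branch : ∀ {i} → i ∈ I → Branching H i) {r : Fin n} (r∉ : r ∉ I) where

  J : Subset d
  J = image p I

  pB : Bij I J p
  pB = record { into = image⁺ p I ; inj = p-inj ; onto = image⁻ p I }

  s′ : ∀ i → Dec (i ∈ I) → Fin d
  s′ i (yes m) = proj₁ (other-edge {H = H} (branch m) (p i))
  s′ i (no _)  = p i

  s : Fin n → Fin d
  s i = s′ i (i ∈? I)

  s-on-edge : ∀ {i} → i ∈ I → H i (s i) × s i ≢ p i
  s-on-edge {i} = go (i ∈? I)
    where
    go : (D : Dec (i ∈ I)) → i ∈ I → H i (s′ i D) × s′ i D ≢ p i
    go (yes m) _ = proj₂ (other-edge {H = H} (branch m) (p i))
    go (no h)  m = contradiction m h

  nxt′ : ∀ i → Dec (s i ∈ J) → Fin n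
  nxt′ i (yes m) = proj₁ (image⁻ p I m)
  nxt′ i (no _)  = i

  nxt : Fin n → Fin n
  nxt i = nxt′ i (s i ∈? J)

  nxt-p : ∀ i → s i ∈ J → nxt i ∈ I × p (nxt i) ≡ s i
  nxt-p i = go (s i ∈? J)
    where
    go : (D : Dec (s i ∈ J)) → s i ∈ J → nxt′ i D ∈ I × p (nxt′ i D) ≡ s i
    go (yes m) _ = proj₂ (image⁻ p I m)
    go (no h)  m = contradiction m h

  inJ : ∀ i → ¬ (s i ∉ J) → s i ∈ J
  inJ i nt = case s i ∈? J of λ { (yes m) → m ; (no m) → contradiction m nt }

  vac = vacate I (λ i → s i ∉ J) nxt (λ {i} _ nt → proj₁ (nxt-p i (inJ i nt)))
    (alternating-wf uniq p s nxt I (λ i → s i ∉ J) (λ i → ¬? (s i ∈? J)) p-inj Hp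
      λ {i} m nt → proj₁ (s-on-edge m) , proj₂ (s-on-edge m) , proj₂ (nxt-p i (inJ i nt)))

  record Result (k : Fin d) : Set₁ where
    field
      q  : Fin d
      q∉ : q ∉ J
      P  : BiRel n d
      pm : PM (I ⊕ r) (J ⊕ q) P
      P⊑ : P ⊑ H
      Pr : P r k

  extend : ∀ k → H r k → Result k
  extend k h with k ∈? J
  ... | no k∉ = record
    { q = k ; q∉ = k∉ ; pm = pm-add (bij-pm pB) r∉ k∉
    ; P⊑ = λ { (inj₁ (refl , refl)) → h ; (inj₂ (m , refl)) → Hp m } ; Pr = inj₁ (refl , refl) }
  -- The walk from the occupant of `k` ends at a row `e` whose second edge leaves `J`; that edge
  -- supplies the new column.
  ... | yes k∈ = record
    { q = s e ; q∉ = V.term ; P = λ i j → (i ≡ e × j ≡ s e) ⊎ A i j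
    ; pm = subst (λ z → PM z (J ⊕ s e) (λ i j → (i ≡ e × j ≡ s e) ⊎ A i j)) rows (pm-add pmA e∉ V.term)
    ; P⊑ = λ { (inj₁ (refl , refl)) → proj₁ (s-on-edge V.e∈I) ; (inj₂ a) → A⊑ a }
    ; Pr = inj₂ (inj₁ (refl , refl)) }
    where
    x = proj₁ (image⁻ p I k∈)
    x∈ = proj₁ (proj₂ (image⁻ p I k∈))
    px = proj₂ (proj₂ (image⁻ p I k∈))
    e = proj₁ vac x
    module V = Vacate (proj₂ vac x∈)
    module Gb = Bij V.bij
    A : BiRel n d
    A i j = (i ≡ r × j ≡ k) ⊎ (i ∈ I ⊖ e × p (V.shift i) ≡ j)
    pg : Bij (I ⊖ e) (J ⊖ k) (p ∘ V.shift)
    pg = record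
      { into = λ m → ∈-⊖ (image⁺ p I (⊖-⊆ I (Gb.into m))) λ eq′ → ⊖-≢ I (Gb.into m)
                 (p-inj (⊖-⊆ I (Gb.into m)) x∈ (trans eq′ (sym px)))
      ; inj = λ m m′ eq′ → Gb.inj m m′ (p-inj (⊖-⊆ I (Gb.into m)) (⊖-⊆ I (Gb.into m′)) eq′)
      ; onto = λ m → case image⁻ p I (⊖-⊆ J m) of λ { (i , i∈ , refl) →
          case Gb.onto (∈-⊖ i∈ λ { refl → ⊖-≢ J m px }) of λ (l , l∈ , eq′) → l , l∈ , cong p eq′ } }
    pmA : PM ((I ⊖ e) ⊕ r) J A
    pmA = subst (λ z → PM ((I ⊖ e) ⊕ r) z A) (⊖⊕ k∈) (pm-add (bij-pm pg) (λ m → r∉ (⊖-⊆ I m)) λ m → ⊖-≢ J m refl)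
    e∉ : e ∉ (I ⊖ e) ⊕ r
    e∉ m = case ⊕-inv (I ⊖ e) r m of λ
      { (inj₁ eq′) → r∉ (subst (_∈ I) eq′ V.e∈I) ; (inj₂ m′) → ⊖-≢ I m′ refl }
    rows : ((I ⊖ e) ⊕ r) ⊕ e ≡ I ⊕ r
    rows = ⊆-antisym
      (λ m → case ⊕-inv _ e m of λ
        { (inj₁ eq′) → ⊆-⊕ I r (subst (_∈ I) (sym eq′) V.e∈I)
        ; (inj₂ m′) → case ⊕-inv _ r m′ of λ { (inj₁ refl) → ∈-⊕ I r ; (inj₂ m″) → ⊆-⊕ I r (⊖-⊆ I m″) } })
      (λ {i} m → case i ≟ᶠ e of λ
        { (yes eq′) → subst (_∈ ((I ⊖ e) ⊕ r) ⊕ e) (sym eq′) (∈-⊕ _ e)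
        ; (no ne) → ⊆-⊕ _ e (case ⊕-inv I r m of λ { (inj₁ refl) → ∈-⊕ _ r ; (inj₂ m′) → ⊆-⊕ _ r (∈-⊖ m′ ne) }) })
    A⊑ : A ⊑ H
    A⊑ {i} (inj₁ (refl , refl)) = h
    A⊑ {i} (inj₂ (m , refl)) with V.moves (⊖-⊆ I m) (⊖-≢ I m)
    ... | inj₁ eq′ = subst (λ z → H _ (p z)) (sym eq′) (Hp (⊖-⊆ I m))
    ... | inj₂ (eq′ , nt , _) = subst (H _) (sym (trans (cong p eq′) (proj₂ (nxt-p i (inJ i nt))))) (proj₁ (s-on-edge (⊖-⊆ I m)))

record Avoiding (H : BiRel n d) (I : Subset n) (j : Fin d) : Set where
  field
    f       : Fin n → Fin d
    on-edge : ∀ {i} → i ∈ I → H i (f i)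
    inj     : ∀ {i k} → i ∈ I → k ∈ I → f i ≡ f k → i ≡ k
    avoid   : ∀ {i} → i ∈ I → f i ≢ j

-- A matching of `I ⊖ r` that avoids `j` is augmented along each of two edges at `r`. If both
-- augmentations used `j` as the new column, they would have the same ends and would therefore
-- coincide, also at `r`.
avoiding : {H : BiRel n d} → UniquePM H → ∀ k I → ∣ I ∣ ≤ k → (∀ {i} → i ∈ I → Branching H i) → ∀ j → Avoiding H I j
avoiding {n} {d} {H} uniq k I le br j with any? (_∈? I)
... | no none′ = record { f = λ _ → j ; on-edge = λ m → contradiction (_ , m) none′ ; inj = λ m → contradiction (_ , m) none′
                       ; avoid = λ m → contradiction (_ , m) none′ }
avoiding uniq zero I le br j | yes (r , r∈) = contradiction (ℕ.≤-trans (ℕ.≤-reflexive (sym (∣⊖∣ r∈))) le) λ ()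
avoiding {n} {d} {H} uniq (suc k) I le br j | yes (r , r∈) =
    case br r∈ of λ (a , b , ha , hb , a≢b) → choose (A.extend a ha) (A.extend b hb) a≢b
  where
  module P = Avoiding (avoiding uniq k (I ⊖ r) (s≤s⁻¹ (ℕ.≤-trans (ℕ.≤-reflexive (sym (∣⊖∣ r∈))) le)) (λ m → br (⊖-⊆ I m)) j)
  module A = Augment uniq {I ⊖ r} P.f P.inj P.on-edge (λ m → br (⊖-⊆ I m)) {r} (λ m → ⊖-≢ I m refl)
  finish : ∀ {a} (R : A.Result a) → A.Result.q R ≢ j → Avoiding H I j
  finish R q≢j = record
    { f = proj₁ pf
    ; on-edge = λ m → R.P⊑ (proj₂ (proj₂ pf) (rows m))
    ; inj = λ m m′ → Bij.inj (proj₁ (proj₂ pf)) (rows m) (rows m′)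
    ; avoid = λ m e → case ⊕-inv A.J R.q (Bij.into (proj₁ (proj₂ pf)) (rows m)) of λ
        { (inj₁ e′) → q≢j (trans (sym e′) e)
        ; (inj₂ m′) → case image⁻ P.f (I ⊖ r) m′ of λ (i , i∈ , e′) → P.avoid i∈ (trans e′ e) } }
    where
    module R = A.Result R
    pf = pm-fun R.pm j
    rows : ∀ {i} → i ∈ I → i ∈ (I ⊖ r) ⊕ r
    rows m = subst (_ ∈_) (sym (⊖⊕ r∈)) m
  choose : ∀ {a b} → A.Result a → A.Result b → a ≢ b → Avoiding H I j
  choose Ra Rb a≢b with A.Result.q Ra ≟ᶠ j | A.Result.q Rb ≟ᶠ j
  ... | no ne | _ = finish Ra ne
  ... | yes _ | no ne = finish Rb ne
  ... | yes refl | yes e = contradiction (PM.func Rb.pm (uniq Ra.pm pmb Ra.P⊑ Rb.P⊑ Ra.Pr) Rb.Pr) a≢b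
    where
    module Ra = A.Result Ra
    module Rb = A.Result Rb
    pmb : PM ((I ⊖ r) ⊕ r) (A.J ⊕ Ra.q) Rb.P
    pmb = subst (λ z → PM ((I ⊖ r) ⊕ r) (A.J ⊕ z) Rb.P) e Rb.pm

-- From tropical oriented matroids to matching ensembles

module FromTOM {n d : ℕ} (𝒯 : GenericTOM n d) (j₀ : Fin d) where
  open GenericTOM 𝒯 renaming (collection to T)
  open IsGenericTOM isGenericTOM

  compatible : ∀ {U V I J P Q} → T U → T V → PM I J P → PM I J Q → P ⊑ G U → Q ⊑ G V → P ⊑ Q
  compatible {U} {V} {I} {J} {P} {Q} tU tV p q P⊑ Q⊑ {i} {j} r = tuple⁻ (pm-dec q) (subst (λ X → G X i j)
    (compatibility tU tV I J (tuple (pm-dec p)) (tuple (pm-dec q)) (pm-tuple p) (λ g → P⊑ (tuple⁻ (pm-dec p) g))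
      (pm-tuple q) (λ g → Q⊑ (tuple⁻ (pm-dec q) g))) (tuple⁺ (pm-dec p) r))

  unique : ∀ {U} → T U → UniquePM (G U)
  unique tU p q = compatible tU tU p q

  record Branched (I : Subset n) (J : Subset d) : Set where
    field
      W      : Tuple n d
      W∈T    : T W
      within : ∀ {i j} → G W i j → j ∈ J
      branch : ∀ {i} → i ∈ I → Branching (G W) i

  -- Coordinate r takes a value e ≠ k in a solution that avoids the right
  -- vertex k; eliminating between the solutions for k and for e makes r branch.
  branched : ∀ k {I J} → ∣ I ∣ ≤ k → ∣ J ∣ ≡ suc ∣ I ∣ → Branched I J
  branched k {I} {J} le c with any? (_∈? I)
  ... | no none′ = case ∣∣-nonempty {p = J} c of λ (j , j∈) → record
        { W = replicate n ⁅ j ⁆ ; W∈T = boundary j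
        ; within = λ {i} {k} g → subst (_∈ J) (sym (x∈⁅y⁆⇒x≡y j (subst (k ∈_) (lookup-replicate i ⁅ j ⁆) g))) j∈
        ; branch = λ m → contradiction (_ , m) none′ }
  branched zero le c | yes (r , r∈) = contradiction (ℕ.≤-trans (ℕ.≤-reflexive (sym (∣⊖∣ r∈))) le) λ ()
  branched (suc k) {I} {J} le c | yes (r , r∈) = join (part (proj₂ (∣∣-nonempty {p = J} c)))
    where
    part : ∀ {x} → x ∈ J → Branched (I ⊖ r) (J ⊖ x)
    part {x} x∈ = branched k {I ⊖ r} {J ⊖ x} (s≤s⁻¹ (ℕ.≤-trans (ℕ.≤-reflexive (sym (∣⊖∣ r∈))) le))
      (trans (sym (∣⊖∣-≡ {I = I} {J} c x∈)) (∣⊖∣ r∈))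
    join : ∀ {x} → Branched (I ⊖ r) (J ⊖ x) → Branched I J
    join {x} B₁ = case types B₁.W∈T r of λ (e , m) → join′ m (part (⊖-⊆ J (B₁.within m)))
      where
      module B₁ = Branched B₁
      join′ : ∀ {e} → G B₁.W r e → Branched (I ⊖ r) (J ⊖ e) → Branched I J
      join′ {e} m B₂ = case types B₂.W∈T r of λ (e′ , m′) → case elimination B₁.W∈T B₂.W∈T r of λ
          (W , tW , at , off) → record
            { W = W ; W∈T = tW
            ; within = λ {i} {j} g → within W i g at off
            ; branch = λ {i} i∈ → branch W i i∈ m′ at off }
        where
        module B₂ = Branched B₂
        Off : Tuple n d → Set
        Off W = ∀ i → i ≢ r → lookup W i ≡ lookup B₁.W i ⊎ lookup W i ≡ lookup B₂.W i
        within : ∀ W i {j} → j ∈ lookup W i → lookup W r ≡ lookup B₁.W r ∪ lookup B₂.W r → Off W → j ∈ J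
        within W i {j} g at off with i ≟ᶠ r
        ... | yes refl = case x∈p∪q⁻ _ _ (subst (j ∈_) at g) of λ
            { (inj₁ h) → ⊖-⊆ J (B₁.within h) ; (inj₂ h) → ⊖-⊆ J (B₂.within h) }
        ... | no ne = case off i ne of λ
            { (inj₁ q) → ⊖-⊆ J (B₁.within (subst (j ∈_) q g)) ; (inj₂ q) → ⊖-⊆ J (B₂.within (subst (j ∈_) q g)) }
        branch : ∀ W i → i ∈ I → ∀ {e′} → G B₂.W r e′ → lookup W r ≡ lookup B₁.W r ∪ lookup B₂.W r → Off W → Branching (G W) i
        branch W i i∈ {e′} m′ at off with i ≟ᶠ r
        ... | yes refl = e , e′ , subst (e ∈_) (sym at) (x∈p∪q⁺ (inj₁ m)) , subst (e′ ∈_) (sym at) (x∈p∪q⁺ (inj₂ m′))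
                       , ≢-sym (⊖-≢ J (B₂.within m′))
        ... | no ne = case off i ne of λ
            { (inj₁ q) → move B₁.W q (B₁.branch (∈-⊖ i∈ ne)) ; (inj₂ q) → move B₂.W q (B₂.branch (∈-⊖ i∈ ne)) }
          where
          move : ∀ W′ → lookup W i ≡ lookup W′ i → Branching (G W′) i → Branching (G W) i
          move W′ q (a , b , ga , gb , a≢b) = a , b , subst (a ∈_) (sym q) ga , subst (b ∈_) (sym q) gb , a≢b

  module Tree {I : Subset n} {J : Subset d} (c : ∣ J ∣ ≡ suc ∣ I ∣) where
    B : Branched I J
    B = branched ∣ I ∣ {I} {J} ℕ.≤-refl c
    open Branched B public

    av : ∀ x → Avoiding (G W) I x
    av = avoiding (unique W∈T) ∣ I ∣ I ℕ.≤-refl branch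

    cover-bij : ∀ {x} → x ∈ J → Bij I (J ⊖ x) (Avoiding.f (av x))
    cover-bij {x} x∈ = bij-from-card (ℕ.≤-reflexive (sym (∣⊖∣-≡ {I = I} {J} c x∈)))
      (λ m → ∈-⊖ (within (A.on-edge m)) (A.avoid m)) A.inj
      where module A = Avoiding (av x)

    cover : ∀ {x} → x ∈ J → Σ[ P ∈ BiRel n d ] PM I (J ⊖ x) P × P ⊑ G W
    cover {x} x∈ = _ , bij-pm (cover-bij x∈) , λ { (m , refl) → Avoiding.on-edge (av x) m }

    cover⁺ : ∀ {r k} → r ∉ I → G W r k → Σ[ P ∈ BiRel n d ] PM (I ⊕ r) J P × P ⊑ G W × P r k
    cover⁺ {r} {k} r∉ g = case cover (within g) of λ (P , p , P⊑) →
      _ , pm-insert r∉ (within g) p , (λ { (inj₁ (refl , refl)) → g ; (inj₂ q) → P⊑ q }) , inj₁ (refl , refl)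

  abstract
    -- Set one row `r` aside and take a branched type for the remaining rows and `J`. Any element
    -- `k` of its coordinate `r` serves as the partner of `r`, because the other rows can be matched
    -- onto `J ⊖ k`.
    realize : ∀ {I J} → ∣ I ∣ ≡ ∣ J ∣ → Σ[ P ∈ BiRel n d ] PM I J P × ∃[ U ] T U × P ⊑ G U
    realize {I} {J} c with any? (_∈? I)
    ... | no none′ = (λ _ _ → Empty) , record
          { domˡ = λ () ; domʳ = λ () ; totˡ = λ m → contradiction (_ , m) none′
          ; totʳ = λ m → contradiction (trans c (∣⊖∣ m)) λ c′ → none′ (∣∣-nonempty {p = I} c′)
          ; func = λ () ; inj = λ () } , _ , boundary j₀ , λ ()
    ... | yes (r , r∈) = case types W∈T r of λ (k , g) → case cover⁺ (λ m → ⊖-≢ I m refl) g of λ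
            (P , p , P⊑ , _) → P , subst (λ z → PM z J P) (⊖⊕ r∈) p , W , W∈T , λ {i} {j} q → P⊑ q
      where open Tree {I ⊖ r} {J} (trans (sym c) (∣⊖∣ r∈))

  Er : Subset n → Subset d → BiRel n d
  Er I J i j = Σ[ e ∈ ∣ I ∣ ≡ ∣ J ∣ ] proj₁ (realize {I} {J} e) i j

  ⊑Er : ∀ {U I J P} → T U → PM I J P → P ⊑ G U → P ⊑ Er I J
  ⊑Er {I = I} {J} tU p P⊑ q =
    pm-card p , compatible tU (proj₁ (proj₂ (proj₂ (proj₂ R)))) p (proj₁ (proj₂ R)) P⊑ (proj₂ (proj₂ (proj₂ (proj₂ R)))) q
    where R = realize {I} {J} (pm-card p)

  Er⊑ : ∀ {U I J P} → T U → PM I J P → P ⊑ G U → Er I J ⊑ P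
  Er⊑ {I = I} {J} tU p P⊑ (e , q) = compatible (proj₁ (proj₂ (proj₂ (proj₂ R)))) tU (proj₁ (proj₂ R)) p (proj₂ (proj₂ (proj₂ (proj₂ R)))) P⊑ q
    where R = realize {I} {J} e

  pm-Er : ∀ {I J} → ∣ I ∣ ≡ ∣ J ∣ → PM I J (Er I J)
  pm-Er {I} {J} e = case realize {I} {J} e of λ (P , p , U , tU , P⊑) → pm-≐ p (⊑Er tU p P⊑) (Er⊑ tU p P⊑)

  closure-Er : ∀ {I J I′ J′ P} → ∣ I ∣ ≡ ∣ J ∣ → PM I′ J′ P → P ⊑ Er I J → P ⊑ Er I′ J′
  closure-Er {I} {J} e p P⊑ = case realize {I} {J} e of λ (Q , q , U , tU , Q⊑) →
    ⊑Er tU p λ r → Q⊑ (Er⊑ tU q Q⊑ (P⊑ r))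

  -- A left vertex of the tree with three neighbours could spare one of them.
  R1-Er : ∀ {I J i x y z a b k} → ∣ J ∣ ≡ suc ∣ I ∣ → x ∈ J → y ∈ J → z ∈ J →
          Er I (J ⊖ x) i a → Er I (J ⊖ y) i b → Er I (J ⊖ z) i k → a ≡ b ⊎ b ≡ k ⊎ a ≡ k
  R1-Er {I} {J} {i} {x} {y} {z} {a} {b} {k} c x∈ y∈ z∈ p q r with a ≟ᶠ b | b ≟ᶠ k | a ≟ᶠ k
  ... | yes e | _ | _ = inj₁ e
  ... | no _ | yes e | _ = inj₂ (inj₁ e)
  ... | no _ | no _ | yes e = inj₂ (inj₂ e)
  ... | no ab | no bk | no ak = ⊥-elim (proj₂ (Av.on-edge i∈) (refl , sym (proj₂ at-a)))
    where
    open Tree {I} {J} c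
    inW : ∀ {x a} → x ∈ J → Er I (J ⊖ x) i a → G W i a
    inW x∈ p = case cover x∈ of λ (P , pp , P⊑) → P⊑ (Er⊑ W∈T pp P⊑ p)
    i∈ : i ∈ I
    i∈ = PM.domˡ (pm-Er (proj₁ p)) p
    -- Without the edge from `i` to `a` every row of `I` still branches, so `H` contains a matching
    -- onto `J ⊖ x`. By uniqueness it is `Er I (J ⊖ x)`, which contains the deleted edge.
    H : BiRel n d
    H i′ j = G W i′ j × ¬ (i′ ≡ i × a ≡ j)
    br : ∀ {i′} → i′ ∈ I → Branching H i′
    br {i′} m with i′ ≟ᶠ i
    ... | yes refl = b , k , (inW y∈ q , λ (_ , e) → ab e) , (inW z∈ r , λ (_ , e) → ak e) , bk
    ... | no ne = case branch m of λ (a , b , ga , gb , a≢b) → a , b , (ga , λ (e , _) → ne e) , (gb , λ (e , _) → ne e) , a≢b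
    Avd = avoiding {H = H} (λ p q P⊑ Q⊑ → unique W∈T p q (proj₁ ∘ P⊑) (proj₁ ∘ Q⊑)) ∣ I ∣ I ℕ.≤-refl br x
    module Av = Avoiding Avd
    bij : Bij I (J ⊖ x) Av.f
    bij = bij-from-card (ℕ.≤-reflexive (sym (∣⊖∣-≡ {I = I} {J} c x∈)))
      (λ m → ∈-⊖ (within (proj₁ (Av.on-edge m))) (Av.avoid m)) Av.inj
    at-a : i ∈ I × Av.f i ≡ a
    at-a = Er⊑ W∈T (bij-pm bij) (λ { (m , refl) → proj₁ (Av.on-edge m) }) p

  -- Both matchings lie in one type `W`. Starting from `f`, which leaves out `x`, the row `x` takes
  -- its column `s x`, and displaced rows move from `f` to `s` until the push ends at `y`, at `b`,
  -- or at a row where `f` and `s` agree. Only the end `b` turns out to be possible.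
  module ShiftOut {I : Subset n} {J : Subset d} {j : Fin d} {x y a b : Fin n} (x∈ : x ∈ I) (y∈ : y ∈ I)
    (p : Er (I ⊖ x) J a j) (q : Er (I ⊖ y) J b j) (a≢b : a ≢ b) (x≢y : x ≢ y) (b≢x : b ≢ x)
    (px : PM (I ⊖ x) J (Er (I ⊖ x) J)) (py : PM (I ⊖ y) J (Er (I ⊖ y) J)) {W : Tuple n d} (W∈T : T W) (x-W : Er (I ⊖ x) J ⊑ G W) (y-W : Er (I ⊖ y) J ⊑ G W) where
    x∈′ : x ∈ I ⊖ y
    x∈′ = ∈-⊖ x∈ x≢y
    fx = pm-fun px j₀
    f = proj₁ fx
    module F = Bij (proj₁ (proj₂ fx))
    f-E : ∀ {i} → i ∈ I ⊖ x → Er (I ⊖ x) J i (f i)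
    f-E = proj₂ (proj₂ fx)
    sy = pm-fun py j₀
    s = proj₁ sy
    module Y = Bij (proj₁ (proj₂ sy))
    s-E : ∀ {i} → i ∈ I ⊖ y → Er (I ⊖ y) J i (s i)
    s-E = proj₂ (proj₂ sy)
    finv = pm-fun (pm-flip px) a
    g = proj₁ finv
    g-into : ∀ {k} → k ∈ J → g k ∈ I ⊖ x
    g-into = Bij.into (proj₁ (proj₂ finv))
    fg : ∀ {k} → k ∈ J → f (g k) ≡ k
    fg m = PM.func px (f-E (g-into m)) (proj₂ (proj₂ finv) m)
    Term : Fin n → Set
    Term i = i ≡ y ⊎ i ≡ b ⊎ s i ≡ f i
    term? : ∀ i → Dec (Term i)
    term? i = (i ≟ᶠ y) ⊎-dec ((i ≟ᶠ b) ⊎-dec (s i ≟ᶠ f i))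
    nxt : Fin n → Fin n
    nxt i = g (s i)
    to-y : ∀ {i} → i ∈ I ⊖ x → i ≢ y → i ∈ I ⊖ y
    to-y m ne = ∈-⊖ (⊖-⊆ I m) ne
    vac = vacate (I ⊖ x) Term nxt (λ m nt → g-into (Y.into (to-y m (nt ∘ inj₁))))
      (alternating-wf (unique W∈T) f s nxt (I ⊖ x) Term term? F.inj (λ m → x-W (f-E m))
        λ {i} m nt → y-W (s-E (to-y m (nt ∘ inj₁))) , (λ e → nt (inj₂ (inj₂ e))) , fg (Y.into (to-y m (nt ∘ inj₁))))
    x₁ = g (s x)
    x₁∈ : x₁ ∈ I ⊖ x
    x₁∈ = g-into (Y.into x∈′)
    module V = Vacate (proj₂ vac x₁∈)
    module Gb = Bij V.bij
    b∈y : b ∈ I ⊖ y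
    b∈y = PM.domˡ py q
    a∈x : a ∈ I ⊖ x
    a∈x = PM.domˡ px p
    fa : f a ≡ j
    fa = PM.func px (f-E a∈x) p
    sb : s b ≡ j
    sb = PM.func py (s-E b∈y) q
    e : Fin n
    e = proj₁ vac x₁
    A : BiRel n d
    A i k = (i ≡ x × k ≡ s x) ⊎ (i ∈ (I ⊖ x) ⊖ e × f (V.shift i) ≡ k)
    pg : Bij ((I ⊖ x) ⊖ e) (J ⊖ s x) (f ∘ V.shift)
    pg = record
      { into = λ m → ∈-⊖ (F.into (⊖-⊆ (I ⊖ x) (Gb.into m))) λ eq′ → ⊖-≢ (I ⊖ x) (Gb.into m)
                 (F.inj (⊖-⊆ (I ⊖ x) (Gb.into m)) x₁∈ (trans eq′ (sym (fg (Y.into x∈′)))))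
      ; inj = λ m m′ eq′ → Gb.inj m m′ (F.inj (⊖-⊆ (I ⊖ x) (Gb.into m)) (⊖-⊆ (I ⊖ x) (Gb.into m′)) eq′)
      ; onto = λ m → case F.onto (⊖-⊆ J m) of λ { (i , i∈ , refl) →
          case Gb.onto (∈-⊖ i∈ λ { refl → ⊖-≢ J m (fg (Y.into x∈′)) }) of λ (l , l∈ , eq′) → l , l∈ , cong f eq′ } }
    rows : ((I ⊖ x) ⊖ e) ⊕ x ≡ I ⊖ e
    rows = trans (cong (_⊕ x) (⊖-comm I x e)) (⊖⊕ (∈-⊖ x∈ λ eq′ → ⊖-≢ I V.e∈I (sym eq′)))
    pmA : PM (I ⊖ e) J A
    pmA = subst (λ z → PM z J A) rows (subst (λ z → PM (((I ⊖ x) ⊖ e) ⊕ x) z A) (⊖⊕ (Y.into x∈′))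
      (pm-add (bij-pm pg) (λ m → ⊖-≢ I (⊖-⊆ (I ⊖ x) m) refl) λ m → ⊖-≢ J m refl))
    A-cases : ∀ {i} → i ∈ (I ⊖ x) ⊖ e → f (V.shift i) ≡ f i ⊎ (f (V.shift i) ≡ s i × ¬ Term i)
    A-cases {i} m = case V.moves (⊖-⊆ (I ⊖ x) m) (⊖-≢ (I ⊖ x) m) of λ
      { (inj₁ eq′) → inj₁ (cong f eq′)
      ; (inj₂ (eq′ , nt , _)) → inj₂ (trans (cong f eq′) (fg (Y.into (to-y (⊖-⊆ (I ⊖ x) m) (nt ∘ inj₁)))) , nt) }
    A⊑ : A ⊑ G W
    A⊑ (inj₁ (refl , refl)) = y-W (s-E x∈′)
    A⊑ {i} (inj₂ (m , refl)) = case A-cases m of λ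
      { (inj₁ eq′) → subst (G W i) (sym eq′) (x-W (f-E (⊖-⊆ (I ⊖ x) m)))
      ; (inj₂ (eq′ , nt)) → subst (G W i) (sym eq′) (y-W (s-E (to-y (⊖-⊆ (I ⊖ x) m) (nt ∘ inj₁)))) }
    A⊑Er : A ⊑ Er (I ⊖ e) J
    A⊑Er = ⊑Er W∈T pmA A⊑
    b∈x : b ∈ I ⊖ x
    b∈x = ∈-⊖ (⊖-⊆ I b∈y) b≢x

    -- Then `A` is the matching that leaves out `y` and gives `b` the column `j`. But the push does
    -- not move `b`, so `f` would give `j` to both `a` and `b`.
    end-y : e ≡ y → Empty
    end-y e≡y = from-cases (A-cases b∈′)
      where
      b∈′ : b ∈ (I ⊖ x) ⊖ e
      b∈′ = ∈-⊖ b∈x λ b≡e → ⊖-≢ I b∈y (trans b≡e e≡y)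
      at-b : Er (I ⊖ y) J b (f (V.shift b))
      at-b = subst (λ z → Er (I ⊖ z) J b (f (V.shift b))) e≡y (A⊑Er (inj₂ (b∈′ , refl)))
      from-cases : f (V.shift b) ≡ f b ⊎ (f (V.shift b) ≡ s b × ¬ Term b) → Empty
      from-cases (inj₁ eq′) = a≢b (F.inj a∈x b∈x (trans fa (trans (sym sb) (trans (sym (PM.func py at-b (s-E b∈y))) eq′))))
      from-cases (inj₂ (_ , nt)) = nt (inj₂ (inj₁ refl))

    -- The column `j` goes to a row that keeps it, which is `a`: the only row that could move to `j`
    -- is `b`, which is left out.
    end-b : e ≡ b → ∃[ r ] A r j → Er (I ⊖ b) J a j
    end-b e≡b (r , inj₁ (refl , j≡)) = contradiction (Y.inj b∈y x∈′ (trans sb j≡)) b≢x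
    end-b e≡b (r , inj₂ (m , eq₁)) = from-cases (A-cases m)
      where
      from-cases : f (V.shift r) ≡ f r ⊎ (f (V.shift r) ≡ s r × ¬ Term r) → Er (I ⊖ b) J a j
      from-cases (inj₁ eq₂) = subst (λ z → Er (I ⊖ z) J a j) e≡b
        (subst (λ z → Er (I ⊖ e) J z j) (F.inj (⊖-⊆ (I ⊖ x) m) a∈x (trans (sym eq₂) (trans eq₁ (sym fa)))) (A⊑Er (inj₂ (m , eq₁))))
      from-cases (inj₂ (eq₂ , nt)) = contradiction
        (trans (Y.inj (to-y (⊖-⊆ (I ⊖ x) m) (nt ∘ inj₁)) b∈y (trans (sym eq₂) (trans eq₁ (sym sb)))) (sym e≡b)) (⊖-≢ (I ⊖ x) m)

    -- Both matchings give the column `f e` to `e`, so with `e` left out no row of `A` could take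
    -- it.
    end-fixed : s e ≡ f e → e ≢ y → ∃[ r ] A r (f e) → Empty
    end-fixed se≡fe e≢y (r , inj₁ (refl , eq₁)) = ⊖-≢ I V.e∈I (Y.inj (to-y V.e∈I e≢y) x∈′ (trans se≡fe eq₁))
    end-fixed se≡fe e≢y (r , inj₂ (m , eq₁)) = from-cases (A-cases m)
      where
      from-cases : f (V.shift r) ≡ f r ⊎ (f (V.shift r) ≡ s r × ¬ Term r) → Empty
      from-cases (inj₁ eq₂) = ⊖-≢ (I ⊖ x) m (F.inj (⊖-⊆ (I ⊖ x) m) V.e∈I (trans (sym eq₂) eq₁))
      from-cases (inj₂ (eq₂ , nt)) = ⊖-≢ (I ⊖ x) m (Y.inj (to-y (⊖-⊆ (I ⊖ x) m) (nt ∘ inj₁)) (to-y V.e∈I e≢y)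
        (trans (sym eq₂) (trans eq₁ (sym se≡fe))))

    finish : Dec (e ≡ y) → Term e → Er (I ⊖ b) J a j
    finish (yes e≡y) _ = ⊥-elim (end-y e≡y)
    finish (no e≢y) (inj₁ e≡y) = contradiction e≡y e≢y
    finish (no e≢y) (inj₂ (inj₁ e≡b)) = end-b e≡b (PM.totʳ pmA (PM.domʳ px p))
    finish (no e≢y) (inj₂ (inj₂ se≡fe)) = ⊥-elim (end-fixed se≡fe e≢y (PM.totʳ pmA (F.into V.e∈I)))

    result : Er (I ⊖ b) J a j
    result = finish (e ≟ᶠ y) V.term

  -- If j is matched with a when x is left out and with b ≠ a when y is left
  -- out, push b out of the matching for x towards x: then j is matched with a.
  shift-out : ∀ {I J j x y a b} → ∣ I ∣ ≡ suc ∣ J ∣ → x ∈ I → y ∈ I →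
              Er (I ⊖ x) J a j → Er (I ⊖ y) J b j → a ≢ b → Er (I ⊖ b) J a j
  shift-out {I} {J} {j} {x} {y} {a} {b} c x∈ y∈ p q a≢b = decide (x ≟ᶠ y) (b ≟ᶠ x)
    where
    decide : Dec (x ≡ y) → Dec (b ≡ x) → Er (I ⊖ b) J a j
    decide (yes refl) _ = contradiction (PM.inj (pm-Er (proj₁ p)) p q) a≢b
    decide (no _) (yes refl) = p
    decide (no x≢y) (no b≢x) = ShiftOut.result x∈ y∈ p q a≢b x≢y b≢x (pm-Er (proj₁ p)) (pm-Er (proj₁ q)) W∈T x-W y-W
      where
      -- A branched type for these rows and `J` contains both matchings at once, since `y` and `x`
      -- can each be attached to it as a leaf.
      K = (I ⊖ x) ⊖ y
      y∈′ : y ∈ I ⊖ x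
      y∈′ = ∈-⊖ y∈ (≢-sym x≢y)
      x∈′ : x ∈ I ⊖ y
      x∈′ = ∈-⊖ x∈ x≢y
      cx : ∣ I ⊖ x ∣ ≡ ∣ J ∣
      cx = sym (∣⊖∣-≡ {I = J} {I} c x∈)
      open Tree {K} {J} (trans (sym cx) (∣⊖∣ y∈′))
      K⊕y : K ⊕ y ≡ I ⊖ x
      K⊕y = ⊖⊕ y∈′
      K⊕x : K ⊕ x ≡ I ⊖ y
      K⊕x = trans (cong (_⊕ x) (⊖-comm I x y)) (⊖⊕ x∈′)
      inW : ∀ {r} → r ∉ K → Er (K ⊕ r) J ⊑ G W
      inW {r} r∉ e = case types W∈T r of λ (_ , g) → case cover⁺ r∉ g of λ (P , pp , P⊑ , _) → P⊑ (Er⊑ W∈T pp P⊑ e)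
      x-W : Er (I ⊖ x) J ⊑ G W
      x-W e = inW (λ m → ⊖-≢ (I ⊖ x) m refl) (subst (λ z → Er z J _ _) (sym K⊕y) e)
      y-W : Er (I ⊖ y) J ⊑ G W
      y-W e = inW (λ m → ⊖-≢ I (⊖-⊆ (I ⊖ x) m) refl) (subst (λ z → Er z J _ _) (sym K⊕x) e)

  -- If `k` differs from `a` and from `b`, then leaving out `k` matches `j` with both, so these are
  -- equal.
  L1-Er : ∀ {I J j x y z a b k} → ∣ I ∣ ≡ suc ∣ J ∣ → x ∈ I → y ∈ I → z ∈ I →
          Er (I ⊖ x) J a j → Er (I ⊖ y) J b j → Er (I ⊖ z) J k j → a ≡ b ⊎ b ≡ k ⊎ a ≡ k
  L1-Er {I} {J} {a = a} {b} {k} c x∈ y∈ z∈ p q r with a ≟ᶠ k | b ≟ᶠ k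
  ... | yes e | _ = inj₂ (inj₂ e)
  ... | no _ | yes e = inj₂ (inj₁ e)
  ... | no ak | no bk = inj₁ (PM.inj (pm-Er (proj₁ one)) one two)
    where
    one = shift-out {I} {J} c x∈ z∈ p r ak
    two = shift-out {I} {J} c y∈ z∈ q r bk

  sysT : Sys n d
  sysT = record { E = Er ; pm = λ {I} {J} → pm-Er {I} {J}
                ; closure = λ {I} {J} → closure-Er {I} {J}
                ; R1 = λ {I} {J} → R1-Er {I} {J} ; L1 = λ {I} {J} → L1-Er {I} {J} }

  -- Membership in the matroid is compatibility with its matchings

  member-compatible : ∀ {U} → T U → Comp sysT (G U)
  member-compatible tU p P⊑ = ⊑Er tU p P⊑

  basic-member : ∀ {I J} → ∣ J ∣ ≡ suc ∣ I ∣ → ∃[ U ] T U × Bas sysT I J ⊑ G U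
  basic-member {I} {J} c = W , W∈T , λ
      { (inj₁ (_ , x , x∈ , e)) → case cover x∈ of λ (P , p , P⊑) → P⊑ (Er⊑ W∈T p P⊑ e)
      ; {i} (inj₂ (i∉ , e)) → case types W∈T i of λ (_ , g) → case cover⁺ i∉ g of λ (P , p , P⊑ , _) → P⊑ (Er⊑ W∈T p P⊑ e) }
    where open Tree {I} {J} c

  -- Colour the edges of `f` true. A certificate would alternate with `f` along edges outside `f`,
  -- so there is a tree with an edge of `f` in every row, and that tree lies in a type of the
  -- matroid.
  compatible-tope : ∀ (f : Fin n → Fin d) → Comp sysT (Sel f) → ∀ {U} → IsType U → (∀ {i j} → G U i j → f i ≡ j) → T U
  compatible-tope f cf {U} ty h with two-colour sysT (λ i j → does (j ≟ᶠ f i)) j₀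
  ... | inj₁ (I , J , c , sel) = case basic-member {I} {J} c of λ (W , tW , ⊑W) →
        surrounding tW ty λ {i} {j} g → case sel i of λ (k , bas , col) →
          ⊑W (subst (Bas sysT I J i) (trans (does-true (k ≟ᶠ f i) col) (h g)) bas)
  ... | inj₂ (I , J , c , sel) = ⊥-elim (no-alternation sysT cf (flip-comp sysT (comp-bas (sysT ᵀ) {J} {I} c)) f (λ j → proj₁ (sel j))
          ⊤ (j₀ , ∈⊤) λ {k} _ → proj₁ (proj₂ (sel k)) , refl , ∈⊤ ,
            λ e → does-false (k ≟ᶠ f (proj₁ (sel k))) (proj₂ (proj₂ (sel k))) (sym e))

  -- Induction on the excess: dropping `x` and dropping `y` from one coordinate gives two members,
  -- and eliminating between them in that coordinate restores `U`.
  compatible-member : ∀ e {U} → excess (lookup U) ≤ e → IsType U → Comp sysT (G U) → T U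
  compatible-member e {U} le ty cU with any? (λ i → multi? (lookup U i))
  ... | no single = compatible-tope (λ i → proj₁ (ty i)) (comp-mono sysT (λ { {i} refl → proj₂ (ty i) }) cU) ty
        λ {i} {j} g → case proj₁ (ty i) ≟ᶠ j of λ { (yes q) → q ; (no ne) → contradiction (i , proj₁ (ty i) , j , proj₂ (ty i) , g , ne) single }
  compatible-member zero {U} le ty cU | yes (i , x , y , x∈ , y∈ , x≢y) =
    contradiction (ℕ.≤-trans (excess-⊖ (lookup U) i x∈ y∈ x≢y) le) λ ()
  compatible-member (suc e) {U} le ty cU | yes (i , x , y , x∈ , y∈ , x≢y) =
    case elimination (drop x∈ y∈ x≢y) (drop y∈ x∈ (≢-sym x≢y)) i of λ (W , tW , at , off) →
      subst T (tuple-ext {T = W} {U} (λ {k} {j} → W⊑ W k at off) (λ {k} {j} → ⊑W W k at off)) tW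
    where
    U⊖ : Fin d → Tuple n d
    U⊖ x = tabulate (update (lookup U) i (lookup U i ⊖ x))
    lU : ∀ x k → lookup (U⊖ x) k ≡ update (lookup U) i (lookup U i ⊖ x) k
    lU x k = lookup∘tabulate (update (lookup U) i (lookup U i ⊖ x)) k
    drop : ∀ {x y} → x ∈ lookup U i → y ∈ lookup U i → x ≢ y → T (U⊖ x)
    drop {x} {y} x∈ y∈ x≢y = compatible-member e {U⊖ x}
      (ℕ.≤-trans (total-mono λ k → ℕ.≤-reflexive (cong (λ z → ∣ z ∣ ∸ 1) (lU x k)))
        (s≤s⁻¹ (ℕ.≤-trans (excess-⊖ (lookup U) i x∈ y∈ x≢y) le)))
      (λ k → subst Nonempty (sym (lU x k)) (update-⊖-nonempty (lookup U) ty i y∈ x≢y k))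
      (comp-mono sysT (λ {k} {j} g → update-⊖-⊆ (lookup U) i k (subst (j ∈_) (lU x k) g)) cU)
    at-i : ∀ x → lookup (U⊖ x) i ≡ lookup U i ⊖ x
    at-i x = trans (lU x i) (update-≡ (lookup U) i _)
    off-i : ∀ x {k} → k ≢ i → lookup (U⊖ x) k ≡ lookup U k
    off-i x {k} ne = trans (lU x k) (update-≢ (lookup U) ne)
    Off : Tuple n d → Set
    Off W = ∀ k → k ≢ i → lookup W k ≡ lookup (U⊖ x) k ⊎ lookup W k ≡ lookup (U⊖ y) k
    same : ∀ W k → k ≢ i → Off W → lookup W k ≡ lookup U k
    same W k ne off = case off k ne of λ { (inj₁ q) → trans q (off-i x ne) ; (inj₂ q) → trans q (off-i y ne) }
    W⊑ : ∀ W k {j} → lookup W i ≡ lookup (U⊖ x) i ∪ lookup (U⊖ y) i → Off W → j ∈ lookup W k → j ∈ lookup U k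
    W⊑ W k {j} at off m with k ≟ᶠ i
    ... | no ne = subst (j ∈_) (same W k ne off) m
    ... | yes refl = case x∈p∪q⁻ _ _ (subst (j ∈_) at m) of λ
        { (inj₁ m′) → ⊖-⊆ (lookup U k) (subst (j ∈_) (at-i x) m′) ; (inj₂ m′) → ⊖-⊆ (lookup U k) (subst (j ∈_) (at-i y) m′) }
    ⊑W : ∀ W k {j} → lookup W i ≡ lookup (U⊖ x) i ∪ lookup (U⊖ y) i → Off W → j ∈ lookup U k → j ∈ lookup W k
    ⊑W W k {j} at off m with k ≟ᶠ i
    ... | no ne = subst (j ∈_) (sym (same W k ne off)) m
    ... | yes refl with j ≟ᶠ x
    ...   | yes refl = subst (j ∈_) (sym at) (x∈p∪q⁺ (inj₂ (subst (j ∈_) (sym (at-i y)) (∈-⊖ m x≢y))))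
    ...   | no ne    = subst (j ∈_) (sym at) (x∈p∪q⁺ (inj₁ (subst (j ∈_) (sym (at-i x)) (∈-⊖ m ne))))

-- The extraction map

restrict⁻ : ∀ (I : Subset n) (J : Subset d) X {i j} → G (restrict I J X) i j → i ∈ I × G X i j × j ∈ J
restrict⁻ I J X {i} {j} m = go (lookup I i) refl (subst (j ∈_) (lookup-zipWith _ i I X) m)
  where
  go : ∀ b → lookup I i ≡ b → j ∈ (if b then lookup X i ∩ J else ∅) → i ∈ I × G X i j × j ∈ J
  go true  e m = case x∈p∩q⁻ _ _ m of λ (a , b) → lookup⇒[]= i I e , a , b
  go false e m = contradiction m ∉⊥

restrict⁺ : ∀ (I : Subset n) (J : Subset d) X {i j} → i ∈ I → G X i j → j ∈ J → G (restrict I J X) i j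
restrict⁺ I J X {i} {j} i∈ g j∈ = subst (j ∈_) (sym (trans (lookup-zipWith _ i I X)
  (cong (λ b → if b then lookup X i ∩ J else ∅) ([]=⇒lookup i∈)))) (x∈p∩q⁺ (g , j∈))

private
  single : ∀ {N : Subset n} {a b} → ∣ N ∣ ≡ 1 → a ∈ N → b ∈ N → a ≡ b
  single {a = a} {b} c a∈ b∈ with a ≟ᶠ b
  ... | yes e = e
  ... | no ne = case trans (sym c) (trans (∣⊖∣ a∈) (cong suc (∣⊖∣ (∈-⊖ b∈ (≢-sym ne))))) of λ ()

  𝟏-∈ : ∀ {J : Subset d} {j} → j ∈ J → lookup (𝟏 J) j ≡ 1
  𝟏-∈ {J = J} {j} m = trans (lookup-map j _ J) (cong (λ b → if b then 1 else 0) ([]=⇒lookup m))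

  𝟏-∉ : ∀ {J : Subset d} {j} → j ∉ J → lookup (𝟏 J) j ≡ 0
  𝟏-∉ {J = J} {j} j∉ with lookup J j in e
  ... | true  = contradiction (lookup⇒[]= j J e) j∉
  ... | false = trans (lookup-map j _ J) (cong (λ b → if b then 1 else 0) e)

  ∣∅∣ : ∣ ∅ {n} ∣ ≡ 0
  ∣∅∣ {zero}  = refl
  ∣∅∣ {suc n} = ∣∅∣ {n}

module _ {n d : ℕ} (j₀ : Fin d) where

  extract : GenericTOM n d → MatchingEnsemble n d
  extract 𝒯 = toEnsemble (FromTOM.sysT 𝒯 j₀)

  module _ (𝒯 : GenericTOM n d) where
    open FromTOM 𝒯 j₀
    open GenericTOM 𝒯 renaming (collection to T)
    open IsGenericTOM isGenericTOM

    Mt : Family n d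
    Mt = MatchingEnsemble.M (extract 𝒯)

    Mt⁻ : ∀ {I J} (e : ∣ I ∣ ≡ ∣ J ∣) → G (Mt I J e) ⊑ Er I J
    Mt⁻ {I} {J} e = tuple⁻ (pm-dec (pm-Er {I} {J} e))

    Mt⁺ : ∀ {I J} (e : ∣ I ∣ ≡ ∣ J ∣) → Er I J ⊑ G (Mt I J e)
    Mt⁺ {I} {J} e = tuple⁺ (pm-dec (pm-Er {I} {J} e))

    Er-member : ∀ {I J} → ∣ I ∣ ≡ ∣ J ∣ → ∃[ U ] T U × Er I J ⊑ G U
    Er-member {I} {J} e = case realize {I} {J} e of λ (P , p , U , tU , P⊑) → U , tU , λ {i} {j} q → P⊑ (Er⊑ tU p P⊑ q)

    module _ (I : Subset n) (J : Subset d) (e : ∣ I ∣ ≡ ∣ J ∣) where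
      private
        E-pm : PM I J (Er I J)
        E-pm = pm-Er {I} {J} e
        mem = Er-member {I} {J} e
        U = proj₁ mem
        tU = proj₁ (proj₂ mem)
        ⊑U : Er I J ⊑ G U
        ⊑U = proj₂ (proj₂ mem)
        fe = pm-fun E-pm j₀
        f = proj₁ fe
        f-E : ∀ {i} → i ∈ I → Er I J i (f i)
        f-E = proj₂ (proj₂ fe)
        -- The type containing the matching may have further elements of `J` in the rows of `I`.
        -- These rows are cut down to the partner, while the others keep their elements so that the
        -- tuple remains a type.
        row : ∀ i → Dec (i ∈ I) → Subset d
        row i (yes _) = ⁅ f i ⁆
        row i (no _)  = lookup U i
        X : Tuple n d
        X = tabulate λ i → row i (i ∈? I)
        lX : ∀ i → lookup X i ≡ row i (i ∈? I)
        lX i = lookup∘tabulate (λ i → row i (i ∈? I)) i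
        row-in : ∀ {i} (D : Dec (i ∈ I)) → i ∈ I → row i D ≡ ⁅ f i ⁆
        row-in (yes _) _ = refl
        row-in (no h)  m = contradiction m h
        X-in : ∀ {i} → i ∈ I → lookup X i ≡ ⁅ f i ⁆
        X-in {i} m = trans (lX i) (row-in (i ∈? I) m)
        tX : T X
        tX = surrounding tU (λ i → subst Nonempty (sym (lX i)) (ne i (i ∈? I))) (λ {i} {j} g → below i (i ∈? I) (subst (j ∈_) (lX i) g))
          where
          ne : ∀ i D → Nonempty (row i D)
          ne i (yes _) = f i , x∈⁅x⁆ (f i)
          ne i (no _)  = types tU i
          below : ∀ i D {j} → j ∈ row i D → G U i j
          below i (yes m) h = subst (G U i) (sym (x∈⁅y⁆⇒x≡y (f i) h)) (⊑U (f-E m))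
          below i (no _)  h = h
        restricted : Mt I J e ≡ restrict I J X
        restricted = tuple-ext
          (λ {i} {j} g → let q = Mt⁻ {I} {J} e g ; i∈ = PM.domˡ E-pm q in
            restrict⁺ I J X i∈ (subst (_∈ lookup X i) (PM.func E-pm (f-E i∈) q) (subst (f i ∈_) (sym (X-in i∈)) (x∈⁅x⁆ (f i)))) (PM.domʳ E-pm q))
          (λ {i} {j} g → case restrict⁻ I J X g of λ (i∈ , x , _) →
            Mt⁺ {I} {J} e (subst (Er I J i) (sym (x∈⁅y⁆⇒x≡y (f i) (subst (j ∈_) (X-in i∈) x))) (f-E i∈)))
        row≡ : ∀ {i} → i ∈ I → lookup (Mt I J e) i ≡ ⁅ f i ⁆
        row≡ {i} i∈ = ⊆-antisym
          (λ {j} g → subst (_∈ ⁅ f i ⁆) (PM.func E-pm (f-E i∈) (Mt⁻ {I} {J} e g)) (x∈⁅x⁆ (f i)))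
          (λ m → subst (_∈ lookup (Mt I J e) i) (sym (x∈⁅y⁆⇒x≡y (f i) m)) (Mt⁺ {I} {J} e (f-E i∈)))
        column : ∀ j → Dec (j ∈ J) → HasRightDegree (G (Mt I J e)) j (lookup (𝟏 J) j)
        column j (yes j∈) = case PM.totʳ E-pm j∈ of λ (i , q) → ⁅ i ⁆ ,
          (λ k → mk⇔ (λ m → subst (λ z → G (Mt I J e) z j) (sym (x∈⁅y⁆⇒x≡y i m)) (Mt⁺ {I} {J} e q))
                     (λ g → subst (_∈ ⁅ i ⁆) (PM.inj E-pm q (Mt⁻ {I} {J} e g)) (x∈⁅x⁆ i)))
          , trans (∣⁅x⁆∣≡1 i) (sym (𝟏-∈ j∈))
        column j (no j∉) = ∅ , (λ k → mk⇔ (λ m → contradiction m ∉⊥) (λ g → contradiction (PM.domʳ E-pm (Mt⁻ {I} {J} e g)) j∉))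
          , trans (∣∅∣ {n}) (sym (𝟏-∉ j∉))

      extract-tope : IsTopeAt T I J (𝟏 J) (Mt I J e)
      extract-tope = record
        { minor = (λ i i∈ → f i , Mt⁺ {I} {J} e (f-E i∈)) , X , tX , restricted
        ; tope = λ i i∈ → lookup (Mt I J e) i , (λ j → mk⇔ id id) , trans (cong ∣_∣ (row≡ i∈)) (∣⁅x⁆∣≡1 (f i))
        ; position = λ j → column j (j ∈? J) }

      extract-unique : ∀ {S′} → IsTopeAt T I J (𝟏 J) S′ → Mt I J e ≡ S′
      extract-unique {S′} h = case minor of λ (ne , Y , tY , S≡) → same ne tY S≡
        where
        open IsTopeAt h
        -- The degree conditions make a tope at this position a perfect matching inside the type
        -- `Y`, and compatibility identifies it with the extracted one.
        same : (∀ i → i ∈ I → Nonempty (lookup S′ i)) → ∀ {Y} → T Y → S′ ≡ restrict I J Y → Mt I J e ≡ S′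
        same ne {Y} tY S≡ = tuple-ext (λ g → Er⊑ tY pmS (λ g → proj₁ (proj₂ (inY g))) (Mt⁻ {I} {J} e g))
            (λ g → Mt⁺ {I} {J} e (⊑Er tY pmS (λ g → proj₁ (proj₂ (inY g))) g))
          where
          inY : ∀ {i j} → G S′ i j → i ∈ I × G Y i j × j ∈ J
          inY {i} {j} g = restrict⁻ I J Y (subst (λ Z → G Z i j) S≡ g)
          pmS : PM I J (G S′)
          pmS = record
            { domˡ = λ g → proj₁ (inY g) ; domʳ = λ g → proj₂ (proj₂ (inY g))
            ; totˡ = λ i∈ → ne _ i∈
            ; totʳ = λ {j} j∈ → case position j of λ (N , iff , c) →
                case ∣∣-nonempty {p = N} (trans c (𝟏-∈ j∈)) of λ (i , m) → i , Equivalence.to (iff i) m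
            ; func = λ {i} g g′ → case tope i (proj₁ (inY g)) of λ (N , iff , c) →
                single {N = N} c (Equivalence.from (iff _) g) (Equivalence.from (iff _) g′)
            ; inj = λ {_} {_} {j} g g′ → case position j of λ (N , iff , c) →
                single {N = N} (trans c (𝟏-∈ (proj₂ (proj₂ (inY g))))) (Equivalence.from (iff _) g) (Equivalence.from (iff _) g′) }

  -- Equality, injectivity and surjectivity of the extraction map

  Er-mono : ∀ 𝒯 𝒯′ → (∀ {U} → GenericTOM.collection 𝒯 U → GenericTOM.collection 𝒯′ U) →
            ∀ {I J} → ∣ I ∣ ≡ ∣ J ∣ → FromTOM.Er 𝒯 j₀ I J ⊑ FromTOM.Er 𝒯′ j₀ I J
  Er-mono 𝒯 𝒯′ h {I} {J} e = case Er-member 𝒯 {I} {J} e of λ (U , tU , ⊑U) →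
    FromTOM.⊑Er 𝒯′ j₀ (h tU) (FromTOM.pm-Er 𝒯 j₀ {I} {J} e) ⊑U

  extract-injective : ∀ 𝒯 𝒯′ → (∀ I J e → Mt 𝒯 I J e ≡ Mt 𝒯′ I J e) →
                      ∀ {U} → GenericTOM.collection 𝒯 U → GenericTOM.collection 𝒯′ U
  extract-injective 𝒯 𝒯′ h {U} tU = FromTOM.compatible-member 𝒯′ j₀ (excess (lookup U)) {U} ℕ.≤-refl
    (IsGenericTOM.types (GenericTOM.isGenericTOM 𝒯) tU)
    λ {I} {J} p P⊑ {i} {j} q → Mt⁻ 𝒯′ {I} {J} (pm-card p) (subst (λ Z → G Z i j) (h I J (pm-card p))
      (Mt⁺ 𝒯 {I} {J} (pm-card p) (FromTOM.member-compatible 𝒯 j₀ tU p P⊑ q)))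

  -- One inclusion of types suffices: each extracted matching lies in a type compatible with `ℳ`, so
  -- it is contained in, and therefore equal to, the matching of `ℳ` with the same ends.
  extract-tom : ∀ ℳ 𝒯 → (∀ {U} → GenericTOM.collection 𝒯 U → ToTOM.Member ℳ U) →
                ∀ I J e → Mt 𝒯 I J e ≡ MatchingEnsemble.M ℳ I J e
  extract-tom ℳ 𝒯 h I J e = case Er-member 𝒯 {I} {J} e of λ (U , tU , ⊑U) →
      let Er⊑Em : FromTOM.Er 𝒯 j₀ I J ⊑ Em I J
          Er⊑Em = ToTOM.member-comp ℳ {U} (h tU) (FromTOM.pm-Er 𝒯 j₀ {I} {J} e) ⊑U
      in tuple-ext (λ g → em-G {I} {J} e (Er⊑Em (Mt⁻ 𝒯 {I} {J} e g)))
           (λ g → Mt⁺ 𝒯 {I} {J} e (pm-⊒ (FromTOM.pm-Er 𝒯 j₀ {I} {J} e) (pm-em {I} {J} e) Er⊑Em (e , g)))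
    where open FromEnsemble ℳ using (Em; em-G; pm-em)

mainTheorem8 : (n d : ℕ) .{{_ : NonZero n}} .{{_ : NonZero d}} →
    Σ[ φ ∈ Bijection (GenericTOM-setoid n d) (MatchingEnsemble-setoid n d) ]
    IsExtractionMap (Bijection.to φ)
mainTheorem8 n d = φ , λ 𝒯 I J e → extract-tope j₀ 𝒯 I J e , extract-unique j₀ 𝒯 I J e
  where
  -- Some right vertex is needed: its constant type holds the empty matching, and it is the
  -- distinguished vertex in the two-colour theorem.
  j₀ : Fin d
  j₀ = fromℕ< (>-nonZero⁻¹ d)
  φ : Bijection (GenericTOM-setoid n d) (MatchingEnsemble-setoid n d)
  φ = record
    { to = extract j₀
    ; cong = λ {𝒯} {𝒯′} (f , g) I J e → tuple-ext
        (λ q → Mt⁺ j₀ 𝒯′ {I} {J} e (Er-mono j₀ 𝒯 𝒯′ f {I} {J} e (Mt⁻ j₀ 𝒯 {I} {J} e q)))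
        (λ q → Mt⁺ j₀ 𝒯 {I} {J} e (Er-mono j₀ 𝒯′ 𝒯 g {I} {J} e (Mt⁻ j₀ 𝒯′ {I} {J} e q)))
    ; bijective = (λ {𝒯} {𝒯′} h → extract-injective j₀ 𝒯 𝒯′ h , extract-injective j₀ 𝒯′ 𝒯 λ I J e → sym (h I J e))
                , λ ℳ → ToTOM.tom ℳ , λ {𝒯} (f , _) → extract-tom j₀ ℳ 𝒯 f }
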